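{- Let $G$ be a minimally $2$-edge-connected graph of order $n$. Then \[ \overline{\lambda}(G)\leq 2+\frac{(n-2)^2}{4n(n-1)}<\frac{9}{4}. \] Moreover, let $n=4k+\ell$, where $k,\ell\in\mathbb{Z}$ and $0\leq \ell<4$. (a) If $k\geq 8$ and $\ell=0$, then \[ \overline{\lambda}(G)\leq 2+\frac{n^2-4n}{4n(n-1)}, \] with equality if and only if $G$ is obtained from an ideally edge-connected $6$-regular (multi)graph of order $k$ by subdividing every edge. (b) If $k\geq 30$ and $\ell=1$, then \[ \overline{\lambda}(G)\leq 2+\frac{n^2-6n+13}{4n(n-1)}, \] with equality if and only if $G$ is obtained from an ideally edge-connected nearly regular (multi)graph of order $k$ and size $n-k$ by subdividing every edge. (c) If $k\geq 68$ and $\ell=2$, then \[ \overline{\lambda}(G)\leq 2+\frac{n^2-8n+60}{4n(n-1)}, \] with equality if and only if $G$ is obtained from an ideally edge-connected nearly regular (multi)graph of either order $k$ and size $n-k$, or order $k+1$ and size $n-k-1$, by subdividing every edge. (d) If $k\geq 30$ and $\ell=3$, then \[ \overline{\lambda}(G)\leq 2+\frac{n^2-6n+17}{4n(n-1)}, \] with equality if and only if $G$ is obtained from an ideally edge-connected nearly regular (multi)graph of order $k+1$ and size $n-k-1$ by subdividing every edge.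
   Context: Graphs are finite and may have multiple edges but no loops; the degree of a vertex counts edges with multiplicity, the order of a graph is its number of vertices and its size is its number of edges (with multiplicity). For distinct vertices $u,v$ of a graph $G$, $\lambda_G(u,v)$ denotes the maximum number of edge-disjoint $u$--$v$ paths in $G$. The average edge-connectivity of a graph $G$ of order $n$ is $\overline{\lambda}(G)=\sum_{\{u,v\}\subseteq V(G)}\lambda_G(u,v)/\binom{n}{2}$. The edge-connectivity $\lambda(G)$ of a non-trivial graph $G$ is the smallest number of edges whose removal disconnects $G$. A graph $G$ is minimally $2$-edge-connected if $\lambda(G)=2$ and $\lambda(G-e)<2$ for every edge $e$ of $G$. A graph $G$ is ideally edge-connected if $\lambda_G(u,v)=\min\{\deg(u),\deg(v)\}$ for all pairs of distinct vertices $u,v$ of $G$. A graph is nearly regular if the difference between its maximum degree and its minimum degree is at most $1$. Subdividing an edge means replacing it by a path of length $2$ through a new vertex of degree $2$ (every edge, including each of several parallel edges, is subdivided exactly once). -}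

module Defs where

open import Data.Nat.Base
  using (ℕ; zero; suc; _+_; _*_; _∸_; _⊓_; _≤_; _<_; z≤n; s≤s; s≤s⁻¹; NonZero; NonTrivial;
         >-nonZero; nonTrivial⇒n>1)
import Data.Nat.Properties as ℕₚ
open import Data.Nat.Combinatorics using (_C_; nCk+nC[k+1]≡[n+1]C[k+1]; nC1≡n)
open import Data.Integer.Base as ℤ using (ℤ; +_)
open import Data.Rational.Base as ℚ using (ℚ)
open import Data.Fin.Base as Fin using (Fin; zero; suc; _↑ˡ_; _↑ʳ_; splitAt)
import Data.Fin.Properties as Finₚ
open import Data.Fin.Subset using (Subset; ∣_∣; ⊤; ⁅_⁆)
open import Data.Fin.Subset.Properties using (_∈?_; ∈⊤; ∣⊤∣≡n; anySubset?; ∣p∣≤n)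
open import Data.List.Base using (List; []; _∷_; length; map; filter; lookup; allFin;
                                  upTo; cartesianProduct)
open import Level using (0ℓ)
open import Data.Nat.ListAction using (sum)
open import Data.List.Extrema.Nat using (min; max; argmax-sel; argmin-sel; xs≤max; min≤xs)
open import Data.List.Membership.Propositional using () renaming (_∈_ to _∈ₗ_)
import Data.List.Membership.Propositional.Properties as ∈ₗ
open import Data.List.Relation.Unary.Any using (here; there)
import Data.List.Relation.Unary.All as All
open import Data.List.Relation.Unary.AllPairs using ([]; _∷_; allPairs?)
open import Data.List.Relation.Unary.Unique.Propositional using (Unique)
open import Data.List.Relation.Binary.Disjoint.Propositional using (Disjoint)
import Data.List.Relation.Binary.Disjoint.DecPropositional as DisjointDec
open import Data.Vec.Base as Vec using (Vec; []; _∷_)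
import Data.Vec.Relation.Unary.All as VAll
import Data.Vec.Relation.Unary.All.Properties as VAllₚ
open import Data.Vec.Relation.Unary.All using ([]; _∷_)
import Data.Vec.Relation.Unary.AllPairs as VAllPairs
open import Data.Vec.Relation.Unary.AllPairs using ([]; _∷_)
open import Data.Product.Base using (Σ; ∃-syntax; _×_; _,_; proj₁; proj₂; uncurry)
open import Data.Sum.Base using (_⊎_; inj₁; inj₂; [_,_]′)
open import Function.Base using (_∘_; id)
open import Function.Bundles using (_↔_; Inverse)
open import Relation.Nullary.Decidable using (Dec; yes; no; ¬?; _×-dec_; _⊎-dec_; map′)
open import Relation.Nullary.Negation using (¬_; contradiction)
open import Relation.Unary using (Pred; Decidable)
open import Relation.Binary.PropositionalEquality
  using (_≡_; _≢_; refl; sym; trans; cong; subst)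

------------------------------------------------------------------------
-- Loopless multigraphs

-- The orientation of an edge given by `source` and `target` carries no meaning:
-- up to `_≅_`, every notion below is symmetric in the two ends.
record Multigraph : Set where
  field
    order    : ℕ
    size     : ℕ
    source   : Fin size → Fin order
    target   : Fin size → Fin order
    loopless : ∀ e → source e ≢ target e

  Vertex : Set
  Vertex = Fin order

  Edge : Set
  Edge = Fin size

  Joins : Edge → Vertex → Vertex → Set
  Joins e u v = (source e ≡ u × target e ≡ v) ⊎ (source e ≡ v × target e ≡ u)

  joins? : ∀ e u v → Dec (Joins e u v)
  joins? e u v = ((source e Finₚ.≟ u) ×-dec (target e Finₚ.≟ v))
           ⊎-dec ((source e Finₚ.≟ v) ×-dec (target e Finₚ.≟ u))

  Joins-irrelevant : ∀ {e u v} (i j : Joins e u v) → i ≡ j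
  Joins-irrelevant (inj₁ (refl , refl)) (inj₁ (refl , refl)) = refl
  Joins-irrelevant (inj₂ (refl , refl)) (inj₂ (refl , refl)) = refl
  Joins-irrelevant {e} (inj₁ (p , _)) (inj₂ (_ , s)) = contradiction (trans p (sym s)) (loopless e)
  Joins-irrelevant {e} (inj₂ (_ , q)) (inj₁ (r , _)) = contradiction (trans r (sym q)) (loopless e)

  Incident : Vertex → Edge → Set
  Incident v e = source e ≡ v ⊎ target e ≡ v

  incident? : ∀ v → Decidable (Incident v)
  incident? v e = (source e Finₚ.≟ v) ⊎-dec (target e Finₚ.≟ v)

  degree : Vertex → ℕ
  degree v = length (filter (incident? v) (allFin size))

  degrees : List ℕ
  degrees = map degree (allFin order)

  maxDegree : ℕ
  maxDegree = max 0 degrees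

  -- Degrees never exceed `size`, so the default value does not affect the
  -- minimum unless there are no vertices.
  minDegree : ℕ
  minDegree = min size degrees

  data Walk : Vertex → Vertex → Set where
    []  : ∀ {v} → Walk v v
    _∷_ : ∀ {e u v w} → Joins e u v → Walk v w → Walk u w

  vertices : ∀ {u v} → Walk u v → List Vertex
  vertices {u} []      = u ∷ []
  vertices {u} (_ ∷ p) = u ∷ vertices p

  edges : ∀ {u v} → Walk u v → List Edge
  edges []              = []
  edges (_∷_ {e = e} _ p) = e ∷ edges p

  IsPath : ∀ {u v} → Walk u v → Set
  IsPath p = Unique (vertices p)

  EdgeDisjoint : ∀ {u v} → Walk u v → Walk u v → Set
  EdgeDisjoint p q = Disjoint (edges p) (edges q)

  EdgeDisjointPaths : Vertex → Vertex → ℕ → Set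
  EdgeDisjointPaths u v k =
    ∃[ ps ] VAll.All IsPath ps × VAllPairs.AllPairs (EdgeDisjoint {u} {v}) {k} ps

  Connected : Set
  Connected = ∀ u v → ∃[ p ] IsPath {u} {v} p

open Multigraph

------------------------------------------------------------------------
-- Decidability

private
  Search : (A : Set) → Pred A 0ℓ → Set₁
  Search A Q = ∀ {P : Pred A 0ℓ} → Decidable P → Dec (∃[ a ] Q a × P a)

  searchVec : ∀ {A Q} → Search A Q → ∀ k → Search (Vec A k) (VAll.All Q)
  searchVec s zero P? = map′ (λ p → [] , [] , p) (λ { ([] , [] , p) → p }) (P? [])
  searchVec s (suc k) P? =
    map′ (λ { (x , q , xs , qs , p) → x ∷ xs , q ∷ qs , p })
         (λ { (x ∷ xs , q ∷ qs , p) → x , q , xs , qs , p })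
         (s λ x → searchVec s k λ xs → P? (x ∷ xs))

  lookup-injective : ∀ {A : Set} {xs : List A} → Unique xs →
                     ∀ {i j} → lookup xs i ≡ lookup xs j → i ≡ j
  lookup-injective (_ ∷ _)  {zero}  {zero}  _  = refl
  lookup-injective (a ∷ _)  {zero}  {suc j} eq =
    contradiction eq (All.lookup a (∈ₗ.∈-lookup j))
  lookup-injective (a ∷ _)  {suc i} {zero}  eq =
    contradiction (sym eq) (All.lookup a (∈ₗ.∈-lookup i))
  lookup-injective (_ ∷ un) {suc i} {suc j} eq = cong suc (lookup-injective un eq)

  module _ {P : Pred ℕ 0ℓ} (P? : Decidable P) where

    max-filter : ∀ {d} xs → P d → P (max d (filter P? xs))
    max-filter {d} xs p with argmax-sel id d (filter P? xs)
    ... | inj₁ eq = subst P (sym eq) p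
    ... | inj₂ x∈ = proj₂ (∈ₗ.∈-filter⁻ P? {xs = xs} x∈)

    max-filter-upper : ∀ {d x xs} → x ∈ₗ xs → P x → x ≤ max d (filter P? xs)
    max-filter-upper {d} {xs = xs} x∈ p = All.lookup (xs≤max d (filter P? xs)) (∈ₗ.∈-filter⁺ P? x∈ p)

    min-filter : ∀ {d} xs → P d → P (min d (filter P? xs))
    min-filter {d} xs p with argmin-sel id d (filter P? xs)
    ... | inj₁ eq = subst P (sym eq) p
    ... | inj₂ x∈ = proj₂ (∈ₗ.∈-filter⁻ P? {xs = xs} x∈)

    min-filter-lower : ∀ {d x xs} → x ∈ₗ xs → P x → min d (filter P? xs) ≤ x
    min-filter-lower {d} {xs = xs} x∈ p = All.lookup (min≤xs d (filter P? xs)) (∈ₗ.∈-filter⁺ P? x∈ p)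

module _ (G : Multigraph) where

  private
    searchWalk : ∀ l {u v} → Search (Walk G u v) (λ p → length (edges G p) ≤ l)
    searchNonempty : ∀ l {u v} {P : Pred (Walk G u v) 0ℓ} → Decidable P →
      Dec (∃[ e ] ∃[ w ] Σ (Joins G e u w) λ j → ∃[ p ] length (edges G p) < l × P (j ∷ p))
    searchWalk l {u} {v} {P} P? = map′ to from (empty? ⊎-dec searchNonempty l P?)
      where
      Empty : Set
      Empty = Σ (u ≡ v) λ { refl → P [] }

      empty? : Dec Empty
      empty? with u Finₚ.≟ v
      ... | yes refl = map′ (refl ,_) (λ { (refl , p) → p }) (P? [])
      ... | no u≢v   = no (u≢v ∘ proj₁)

      NonEmpty : Set
      NonEmpty = ∃[ e ] ∃[ w ] Σ (Joins G e u w) λ j → ∃[ p ] length (edges G p) < l × P (j ∷ p)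

      to : Empty ⊎ NonEmpty → ∃[ p ] length (edges G p) ≤ l × P p
      to (inj₁ (refl , p))                = [] , z≤n , p
      to (inj₂ (_ , _ , j , p , p<l , q)) = j ∷ p , p<l , q

      from : (∃[ p ] length (edges G p) ≤ l × P p) → Empty ⊎ NonEmpty
      from ([] , _ , p)          = inj₁ (refl , p)
      from (j ∷ p , p<l , q)     = inj₂ (_ , _ , j , p , p<l , q)
    searchNonempty zero P? = no λ { (_ , _ , _ , _ , () , _) }
    searchNonempty (suc l) {u} {P = P} P? = Finₚ.any? λ e → Finₚ.any? λ w → viaEdge e w
      where
      viaEdge : ∀ e w → Dec (Σ (Joins G e u w) λ j → ∃[ p ] length (edges G p) < suc l × P (j ∷ p))
      viaEdge e w with joins? G e u w
      ... | no ¬j = no (¬j ∘ proj₁)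
      ... | yes j = map′ (λ { (p , p≤l , q) → j , p , s≤s p≤l , q })
                         (λ { (j′ , p , p<l , q) → p , s≤s⁻¹ p<l ,
                              subst (λ i → P (i ∷ p)) (Joins-irrelevant G j′ j) q })
                         (searchWalk l (λ p → P? (j ∷ p)))

    length-edges : ∀ {u v} (p : Walk G u v) → suc (length (edges G p)) ≡ length (vertices G p)
    length-edges []      = refl
    length-edges (_ ∷ p) = cong suc (length-edges p)

    isPath⇒short : ∀ {u v} {p : Walk G u v} → IsPath G p → length (edges G p) ≤ order G
    isPath⇒short {p = p} un = ℕₚ.<⇒≤ (subst (_≤ order G) (sym (length-edges p))
      (Finₚ.injective⇒≤ {f = lookup (vertices G p)} (lookup-injective un)))

  isPath? : ∀ {u v} → Decidable (IsPath G {u} {v})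
  isPath? p = allPairs? (λ x y → ¬? (x Finₚ.≟ y)) (vertices G p)

  private
    searchPath : ∀ {u v} → Search (Walk G u v) (IsPath G)
    searchPath P? = map′ (λ { (p , _ , q) → p , q }) (λ { (p , q) → p , isPath⇒short (proj₁ q) , q })
      (searchWalk (order G) (λ p → isPath? p ×-dec P? p))

  opaque
    edgeDisjointPaths? : ∀ u v → Decidable (EdgeDisjointPaths G u v)
    edgeDisjointPaths? u v k = searchVec searchPath k
      (VAllPairs.allPairs? λ p q → DisjointDec.disjoint? Finₚ._≟_ (edges G p) (edges G q))

  opaque
    connected? : Dec (Connected G)
    connected? = Finₚ.all? λ u → Finₚ.all? λ v →
      map′ (λ { (p , q , _) → p , q }) (λ { (p , q) → p , q , q }) (searchPath (isPath? {u} {v}))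

------------------------------------------------------------------------
-- Local edge-connectivity

-- For u ≢ v the truncation at `size G` is harmless, since edge-disjoint u–v
-- paths use distinct edges; see `localEdgeConnectivity-greatest`.
-- The value at u ≡ v is not used.
localEdgeConnectivity : (G : Multigraph) → Vertex G → Vertex G → ℕ
localEdgeConnectivity G u v = max 0 (filter (edgeDisjointPaths? G u v) (upTo (suc (size G))))

module _ (G : Multigraph) {u v : Vertex G} (u≢v : u ≢ v) where

  private
    someEdge : (p : Walk G u v) → ∃[ e ] e ∈ₗ edges G p
    someEdge []                = contradiction refl u≢v
    someEdge (_∷_ {e = e} _ _) = e , here refl

    someEdge-injective : ∀ {k} {ps : Vec (Walk G u v) k} → VAllPairs.AllPairs (EdgeDisjoint G) ps →
      ∀ {i j} → proj₁ (someEdge (Vec.lookup ps i)) ≡ proj₁ (someEdge (Vec.lookup ps j)) → i ≡ j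
    someEdge-injective _ {zero} {zero} _ = refl
    someEdge-injective {ps = p ∷ ps} (a ∷ _) {zero} {suc j} eq =
      contradiction (proj₂ (someEdge p) , subst (_∈ₗ edges G (Vec.lookup ps j)) (sym eq) (proj₂ (someEdge _)))
                    (VAllₚ.lookup⁺ a j)
    someEdge-injective {ps = p ∷ ps} (a ∷ _) {suc i} {zero} eq =
      contradiction (proj₂ (someEdge p) , subst (_∈ₗ edges G (Vec.lookup ps i)) eq (proj₂ (someEdge _)))
                    (VAllₚ.lookup⁺ a i)
    someEdge-injective {ps = p ∷ ps} (_ ∷ d) {suc i} {suc j} eq = cong suc (someEdge-injective d eq)

  localEdgeConnectivity-greatest :
    EdgeDisjointPaths G u v (localEdgeConnectivity G u v) ×
    (∀ k → EdgeDisjointPaths G u v k → k ≤ localEdgeConnectivity G u v)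
  localEdgeConnectivity-greatest = attained , bounds
    where
    attained : EdgeDisjointPaths G u v (localEdgeConnectivity G u v)
    attained = max-filter (edgeDisjointPaths? G u v) (upTo (suc (size G))) ([] , [] , [])

    bounds : ∀ k → EdgeDisjointPaths G u v k → k ≤ localEdgeConnectivity G u v
    bounds k ps = max-filter-upper (edgeDisjointPaths? G u v)
      (∈ₗ.∈-upTo⁺ (s≤s (Finₚ.injective⇒≤ (someEdge-injective (proj₂ (proj₂ ps)))))) ps

IdeallyEdgeConnected : Multigraph → Set
IdeallyEdgeConnected G = ∀ u v → u ≢ v → localEdgeConnectivity G u v ≡ degree G u ⊓ degree G v

unorderedPairs : (n : ℕ) → List (Fin n × Fin n)
unorderedPairs n = filter (uncurry Finₚ._<?_) (cartesianProduct (allFin n) (allFin n))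

nC2≢0 : ∀ n .{{_ : NonTrivial n}} → NonZero (n C 2)
nC2≢0 (suc (suc n)) = >-nonZero (subst (0 <_) (nCk+nC[k+1]≡[n+1]C[k+1] (suc n) 1)
  (subst (λ x → 0 < x + suc n C 2) (sym (nC1≡n (suc n))) (s≤s z≤n)))

averageEdgeConnectivity : (G : Multigraph) .{{_ : NonTrivial (order G)}} → ℚ
averageEdgeConnectivity G =
  + sum (map (uncurry (localEdgeConnectivity G)) (unorderedPairs (order G))) ℚ./ (order G C 2)
  where instance _ = nC2≢0 (order G)

------------------------------------------------------------------------
-- Edge-connectivity

infixl 6 _∖_

remainingEdges : (G : Multigraph) → Subset (size G) → List (Edge G)
remainingEdges G S = filter (λ e → ¬? (e ∈? S)) (allFin (size G))

_∖_ : (G : Multigraph) → Subset (size G) → Multigraph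
G ∖ S = record
  { order    = order G
  ; size     = length (remainingEdges G S)
  ; source   = source G ∘ lookup (remainingEdges G S)
  ; target   = target G ∘ lookup (remainingEdges G S)
  ; loopless = loopless G ∘ lookup (remainingEdges G S)
  }

Disconnects : (G : Multigraph) → Subset (size G) → Set
Disconnects G S = ¬ Connected (G ∖ S)

opaque
  disconnectedBy? : (G : Multigraph) → Decidable (λ k → ∃[ S ] ∣ S ∣ ≡ k × Disconnects G S)
  disconnectedBy? G k = anySubset? λ S → (∣ S ∣ ℕₚ.≟ k) ×-dec ¬? (connected? (G ∖ S))

-- In a non-trivial graph removing all edges leaves a disconnected graph, so the
-- default value `size G` is itself attained; see `edgeConnectivity-least`.
edgeConnectivity : (G : Multigraph) .{{_ : NonTrivial (order G)}} → ℕ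
edgeConnectivity G = min (size G) (filter (disconnectedBy? G) (upTo (suc (size G))))

module _ (G : Multigraph) .{{_ : NonTrivial (order G)}} where

  private
    distinctVertices : ∀ {n} → 1 < n → Σ (Fin n) λ u → Σ (Fin n) λ v → u ≢ v
    distinctVertices (s≤s (s≤s _)) = zero , suc zero , λ ()

    disconnects-⊤ : Disconnects G ⊤
    disconnects-⊤ connected with distinctVertices (nonTrivial⇒n>1 (order G))
    ... | u , v , u≢v with connected u v
    ...   | []                , _ = u≢v refl
    ...   | (_∷_ {e = i} _ _) , _ = proj₂ (∈ₗ.∈-filter⁻ (λ e → ¬? (e ∈? ⊤)) {xs = allFin (size G)}
                                      (∈ₗ.∈-lookup i)) ∈⊤

  edgeConnectivity-least :
    (∃[ S ] ∣ S ∣ ≡ edgeConnectivity G × Disconnects G S) ×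
    (∀ S → Disconnects G S → edgeConnectivity G ≤ ∣ S ∣)
  edgeConnectivity-least = attained , bounds
    where
    attained : ∃[ S ] ∣ S ∣ ≡ edgeConnectivity G × Disconnects G S
    attained = min-filter (disconnectedBy? G) (upTo (suc (size G)))
                 (⊤ , ∣⊤∣≡n (size G) , disconnects-⊤)

    bounds : ∀ S → Disconnects G S → edgeConnectivity G ≤ ∣ S ∣
    bounds S d = min-filter-lower (disconnectedBy? G) (∈ₗ.∈-upTo⁺ (s≤s (∣p∣≤n S))) (S , refl , d)

MinimallyTwoEdgeConnected : (G : Multigraph) .{{_ : NonTrivial (order G)}} → Set
MinimallyTwoEdgeConnected G =
  edgeConnectivity G ≡ 2 × (∀ e → edgeConnectivity (G ∖ ⁅ e ⁆) < 2)

------------------------------------------------------------------------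
-- Regularity

Regular : ℕ → Multigraph → Set
Regular d G = ∀ v → degree G v ≡ d

NearlyRegular : Multigraph → Set
NearlyRegular G = maxDegree G ∸ minDegree G ≤ 1

------------------------------------------------------------------------
-- Subdivision

infix 4 _≅_

record _≅_ (G H : Multigraph) : Set where
  field
    vertexBijection : Vertex G ↔ Vertex H
    edgeBijection   : Edge G ↔ Edge H

  onVertex : Vertex G → Vertex H
  onVertex = Inverse.to vertexBijection

  onEdge : Edge G → Edge H
  onEdge = Inverse.to edgeBijection

  field
    incidence : ∀ e → Joins H (onEdge e) (onVertex (source G e)) (onVertex (target G e))

-- The vertices are those of H followed by one new vertex per edge of H; the edge e
-- is replaced by the two edges joining source e and target e to the new vertex of e.
subdivide : Multigraph → Multigraph
subdivide H = record
  { order    = n + m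
  ; size     = m + m
  ; source   = [ old ∘ source H , old ∘ target H ]′ ∘ splitAt m
  ; target   = [ new , new ]′ ∘ splitAt m
  ; loopless = λ e → noLoop (splitAt m e)
  }
  where
  n = order H
  m = size H

  old : Vertex H → Fin (n + m)
  old v = v ↑ˡ m

  new : Edge H → Fin (n + m)
  new e = n ↑ʳ e

  old≢new : ∀ v e → old v ≢ new e
  old≢new v e eq with trans (sym (Finₚ.splitAt-↑ˡ n v m)) (trans (cong (splitAt n) eq) (Finₚ.splitAt-↑ʳ n m e))
  ... | ()

  noLoop : ∀ x → [ old ∘ source H , old ∘ target H ]′ x ≢ [ new , new ]′ x
  noLoop (inj₁ e) = old≢new (source H e) e
  noLoop (inj₂ e) = old≢new (target H e) e

IsObtainedBySubdividingEveryEdgeOf : Multigraph → Multigraph → Set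
IsObtainedBySubdividingEveryEdgeOf G H = G ≅ subdivide H

------------------------------------------------------------------------
-- Bounds

4n[n∸1]≢0 : ∀ n .{{_ : NonTrivial n}} → NonZero (4 * n * (n ∸ 1))
4n[n∸1]≢0 (suc (suc n)) = _

-- 2 + c / 4n(n − 1)
bound : (n : ℕ) .{{_ : NonTrivial n}} → ℤ → ℚ
bound n c = + 2 ℚ./ 1 ℚ.+ c ℚ./ (4 * n * (n ∸ 1))
  where instance _ = 4n[n∸1]≢0 n

{-# OPTIONS --safe #-}

-- By minimality every edge e lies in an edge cut W e of size two. Call two vertices
-- equivalent if none of these cuts separates them. Inequivalent vertices have local
-- connectivity at most 2, and every edge joins inequivalent vertices. Adding the classes one at
-- a time, each new class needs at most one more cut to be separated from the old ones; hence
-- c classes are separated by c - 1 of the cuts, and since every edge lies in one of these,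
-- there are at most 2(c - 1) edges.
--
-- Let x v = deg v - 2, let p be the size of a largest class and F the sum of the local
-- connectivities minus 2. The bound on the size gives Σ x ≤ 2n - 4p, and F is at most the sum of
-- min (x u) (x v) over equivalent pairs, hence at most (p - 1)(Σ x)/2 ≤ (n - 2)²/8. If x is
-- integral with Σ x = q p + s on a class of p vertices, the sum of minima is at most
-- q p(p - 1)/2 + s(s - 1)/2, with equality only for x in {q, q + 1}; optimising over p gives the
-- bounds for the residues of n modulo 4. In the case of equality there is a single nontrivial
-- class, it is independent and all other vertices have degree 2, so G is a subdivision.

module Submission where

open import Data.Bool.Base using (Bool)
import Data.Bool.Properties as Boolₚ
open import Data.Fin.Base as Fin using (Fin; zero; suc; _↑ˡ_; _↑ʳ_; punchIn; splitAt)
open import Data.Fin.Permutation using (↔⇒≡)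
import Data.Fin.Properties as Finₚ
open import Data.Fin.Subset using (Subset; ∣_∣; ⁅_⁆) renaming (_∈_ to _∈ˢ_; _∉_ to _∉ˢ_; ⊥ to ∅)
import Data.Fin.Subset.Properties as Subsetₚ
open import Data.List.Base
  using (List; []; _∷_; _++_; length; map; filter; lookup; allFin; tabulate; cartesianProduct)
open import Data.List.Extrema.Nat using (argmax; f[xs]≤f[argmax]; xs≤max; min≤xs)
open import Data.List.Membership.Propositional using (_∈_; _∉_; find; lose)
import Data.List.Membership.DecPropositional as DecMembership
import Data.List.Membership.Propositional.Properties as ∈ₚ
open import Data.List.Properties using (map-++; filter-++; map-tabulate)
open import Data.List.Relation.Binary.Disjoint.Propositional using (Disjoint)
open import Data.List.Relation.Binary.Subset.Propositional using (_⊆_)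
import Data.List.Relation.Unary.All as All
import Data.List.Relation.Unary.All.Properties as Allₚ
import Data.List.Relation.Unary.AllPairs as AllPairs
open import Data.List.Relation.Unary.Any using (Any; here; there; index; any?)
open import Data.List.Relation.Unary.Any.Properties using (lookup-index)
open import Data.List.Relation.Unary.Unique.Propositional using (Unique)
import Data.List.Relation.Unary.Unique.Propositional.Properties as Uniqueₚ
open import Data.Nat.Base
  using (ℕ; zero; suc; _+_; _*_; _∸_; _⊓_; _≤_; _<_; z≤n; s≤s; s≤s⁻¹; NonZero; NonTrivial;
         nonTrivial⇒n>1; compare; less; equal; greater)
open import Data.Nat.ListAction using () renaming (sum to sumₗ)
open import Data.Nat.ListAction.Properties using (sum-++)
import Data.Nat.Properties as ℕₚ
open import Data.Nat.Tactic.RingSolver using (solve-∀; solve)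
open import Data.List.Extrema ℕₚ.≤-totalOrder using (max≤v⁺; v≤min⁺)
open import Data.Product.Base using (Σ; ∃; ∃-syntax; _×_; _,_; proj₁; proj₂; uncurry)
open import Data.Sum.Base as Sum using (_⊎_; inj₁; inj₂; [_,_]′)
open import Data.Vec.Base as Vec using (Vec)
import Data.Vec.Relation.Unary.All as VAll
import Data.Vec.Relation.Unary.All.Properties as VAllₚ
import Data.Vec.Relation.Unary.AllPairs as VAllPairs
import Data.Vec.Relation.Unary.AllPairs.Properties as VAllPairsₚ
open import Function.Base using (_∘_; id)
open import Function.Bundles using (_↔_; _⇔_; Inverse; mk⇔; mk⤖)
open import Function.Consequences.Propositional using (strictlySurjective⇒surjective)
import Function.Construct.Symmetry as Symmetry
open import Function.Properties.Bijection using (⤖⇒↔)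
open import Level as _ using (0ℓ)
open import Relation.Binary.Definitions using (tri<; tri≈; tri>)
open import Relation.Binary.PropositionalEquality
open import Relation.Nullary.Decidable
  using (Dec; yes; no; ¬?; _×-dec_; _⊎-dec_; map′; does; does-⇔; dec-true; dec-false; False;
    toWitnessFalse)
open import Relation.Nullary.Negation using (¬_; contradiction)
open import Relation.Unary using (Pred; Decidable)
open import Algebra.Properties.Semiring.Sum ℕₚ.+-*-semiring
  using (sum; sum-cong-≗; ∑-distrib-+; ∑-comm; sum-permute; *-distribˡ-sum; *-distribʳ-sum)
open import Defs
open Multigraph

-- Sums over finite types

𝟙 : ∀ {a} {A : Set a} → Dec A → ℕ
𝟙 (yes _) = 1
𝟙 (no _)  = 0

module _ {a} {A : Set a} where

  𝟙-yes : (a? : Dec A) → A → 𝟙 a? ≡ 1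
  𝟙-yes (yes _) _ = refl
  𝟙-yes (no ¬p) p = contradiction p ¬p

  𝟙-no : (a? : Dec A) → ¬ A → 𝟙 a? ≡ 0
  𝟙-no (yes p) ¬p = contradiction p ¬p
  𝟙-no (no _)  _  = refl

  𝟙-¬ : (a? : Dec A) → 𝟙 a? + 𝟙 (¬? a?) ≡ 1
  𝟙-¬ (yes _) = refl
  𝟙-¬ (no _)  = refl

  𝟙≤1 : (a? : Dec A) → 𝟙 a? ≤ 1
  𝟙≤1 (yes _) = ℕₚ.≤-refl
  𝟙≤1 (no _)  = z≤n

𝟙-cong : ∀ {a b} {A : Set a} {B : Set b} (a? : Dec A) (b? : Dec B) → (A → B) → (B → A) → 𝟙 a? ≡ 𝟙 b?
𝟙-cong (yes p) b? f g = sym (𝟙-yes b? (f p))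
𝟙-cong (no ¬p) b? f g = sym (𝟙-no b? (¬p ∘ g))

∑-mono : ∀ {n} {f g : Fin n → ℕ} → (∀ i → f i ≤ g i) → sum f ≤ sum g
∑-mono {zero}  f≤g = z≤n
∑-mono {suc n} f≤g = ℕₚ.+-mono-≤ (f≤g zero) (∑-mono (f≤g ∘ suc))

∑-mono-tight : ∀ {n} {f g : Fin n → ℕ} → (∀ i → f i ≤ g i) → sum g ≤ sum f → ∀ i → f i ≡ g i
∑-mono-tight {suc n} {f} {g} f≤g ∑g≤∑f = λ
  { zero    → ℕₚ.≤-antisym (f≤g zero) (ℕₚ.+-cancelʳ-≤ (sum (g ∘ suc)) _ _
                (ℕₚ.≤-trans ∑g≤∑f (ℕₚ.+-monoʳ-≤ (f zero) (∑-mono (f≤g ∘ suc)))))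
  ; (suc i) → ∑-mono-tight (f≤g ∘ suc) (ℕₚ.+-cancelˡ-≤ (g zero) _ _
                (ℕₚ.≤-trans ∑g≤∑f (ℕₚ.+-monoˡ-≤ _ (f≤g zero)))) i }

∑-const : ∀ n c → sum {n} (λ _ → c) ≡ n * c
∑-const zero    c = refl
∑-const (suc n) c = cong (c +_) (∑-const n c)

∑-single : ∀ {n} (f : Fin n → ℕ) a → (∀ i → i ≢ a → f i ≡ 0) → sum f ≡ f a
∑-single {suc n} f zero    f≡0 = trans (cong (f zero +_)
  (trans (sum-cong-≗ λ i → f≡0 (suc i) λ ()) (trans (∑-const n 0) (ℕₚ.*-zeroʳ n)))) (ℕₚ.+-identityʳ _)
∑-single {suc n} f (suc a) f≡0 = cong₂ _+_ (f≡0 zero λ ())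
  (∑-single (f ∘ suc) a λ i i≢a → f≡0 (suc i) (i≢a ∘ Finₚ.suc-injective))

∑-term : ∀ {n} (f : Fin n → ℕ) i → f i ≤ sum f
∑-term f zero    = ℕₚ.m≤m+n _ _
∑-term f (suc i) = ℕₚ.≤-trans (∑-term (f ∘ suc) i) (ℕₚ.m≤n+m _ _)

∑≡0⇒ : ∀ {n} (f : Fin n → ℕ) → sum f ≡ 0 → ∀ i → f i ≡ 0
∑≡0⇒ f eq i = ℕₚ.n≤0⇒n≡0 (subst (f i ≤_) eq (∑-term f i))

∑-split : ∀ m {n} (f : Fin (m + n) → ℕ) → sum f ≡ sum (f ∘ (_↑ˡ n)) + sum (f ∘ (m ↑ʳ_))
∑-split zero    f = refl
∑-split (suc m) f = trans (cong (f zero +_) (∑-split m (f ∘ suc))) (sym (ℕₚ.+-assoc (f zero) _ _))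

module _ {A : Set} {P : Pred A 0ℓ} (P? : Decidable P) where

  length-filter-tabulate : ∀ {n} (f : Fin n → A) →
    length (filter P? (tabulate f)) ≡ sum (λ i → 𝟙 (P? (f i)))
  length-filter-tabulate {zero}  f = refl
  length-filter-tabulate {suc n} f with P? (f zero)
  ... | yes _ = cong suc (length-filter-tabulate (f ∘ suc))
  ... | no _  = length-filter-tabulate (f ∘ suc)

  sum-map-filter-tabulate : ∀ {n} (g : A → ℕ) (f : Fin n → A) →
    sumₗ (map g (filter P? (tabulate f))) ≡ sum (λ i → 𝟙 (P? (f i)) * g (f i))
  sum-map-filter-tabulate {zero}  g f = refl
  sum-map-filter-tabulate {suc n} g f with P? (f zero)
  ... | yes _ = cong₂ _+_ (sym (ℕₚ.+-identityʳ _)) (sum-map-filter-tabulate g (f ∘ suc))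
  ... | no _  = sum-map-filter-tabulate g (f ∘ suc)

pairSum : ∀ {n} → (Fin n → Fin n → ℕ) → ℕ
pairSum g = sum λ u → sum λ v → 𝟙 (u Finₚ.<? v) * g u v

sum-unorderedPairs : ∀ {n} (g : Fin n → Fin n → ℕ) → sumₗ (map (uncurry g) (unorderedPairs n)) ≡
  pairSum g
sum-unorderedPairs {n} g = go id
  where
  go : ∀ {m} (f : Fin m → Fin n) →
    sumₗ (map (uncurry g) (filter (uncurry Finₚ._<?_) (cartesianProduct (tabulate f) (allFin n))))
    ≡ sum (λ u → sum λ v → 𝟙 (f u Finₚ.<? v) * g (f u) v)
  go {zero}  f = refl
  go {suc m} f = begin
    S (filter Q (map (f zero ,_) (allFin n) ++ rest))
      ≡⟨ cong S (filter-++ Q (map (f zero ,_) (allFin n)) rest) ⟩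
    S (filter Q (map (f zero ,_) (allFin n)) ++ filter Q rest)
      ≡⟨ cong sumₗ (map-++ (uncurry g) (filter Q (map (f zero ,_) (allFin n))) (filter Q rest)) ⟩
    sumₗ (map (uncurry g) (filter Q (map (f zero ,_) (allFin n))) ++ map (uncurry g) (filter Q rest))
      ≡⟨ sum-++ (map (uncurry g) (filter Q (map (f zero ,_) (allFin n)))) _ ⟩
    S (filter Q (map (f zero ,_) (allFin n))) + S (filter Q rest)
      ≡⟨ cong₂ _+_ (trans (cong (S ∘ filter Q) (map-tabulate id (f zero ,_)))
                          (sum-map-filter-tabulate Q (uncurry g) (f zero ,_)))
                   (go (f ∘ suc)) ⟩
    sum (λ u → sum λ v → 𝟙 (f u Finₚ.<? v) * g (f u) v) ∎
    where
    open ≡-Reasoning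
    Q = uncurry (Finₚ._<?_ {n} {n})
    S = sumₗ ∘ map (uncurry g)
    rest = cartesianProduct (tabulate (f ∘ suc)) (allFin n)

module _ {n} {f g : Fin n → Fin n → ℕ} (f≤g : ∀ u v → u ≢ v → f u v ≤ g u v) where

  private
    weighted : ∀ u v → 𝟙 (u Finₚ.<? v) * f u v ≤ 𝟙 (u Finₚ.<? v) * g u v
    weighted u v with u Finₚ.<? v
    ... | yes u<v = ℕₚ.*-monoʳ-≤ 1 (f≤g u v (Finₚ.<⇒≢ u<v))
    ... | no _    = z≤n

  pairSum-mono : pairSum f ≤ pairSum g
  pairSum-mono = ∑-mono λ u → ∑-mono (weighted u)

  pairSum-tight : pairSum g ≤ pairSum f → ∀ u v → u Fin.< v → f u v ≡ g u v
  pairSum-tight ∑g≤∑f u v u<v = subst (λ b → b * f u v ≡ b * g u v → f u v ≡ g u v)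
    (sym (𝟙-yes (u Finₚ.<? v) u<v))
    (λ eq → trans (sym (ℕₚ.+-identityʳ _)) (trans eq (ℕₚ.+-identityʳ _)))
    (∑-mono-tight (weighted u)
      (ℕₚ.≤-reflexive (sym (∑-mono-tight (λ u → ∑-mono (weighted u)) ∑g≤∑f u))) v)

2*pairSum+diagonal : ∀ {n} (g : Fin n → Fin n → ℕ) → (∀ u v → g u v ≡ g v u) →
  2 * pairSum g + sum (λ u → g u u) ≡ sum (λ u → sum (g u))
2*pairSum+diagonal {n} g g-sym = begin
  2 * pairSum g + sum (λ u → g u u)
    ≡⟨ cong (λ x → pairSum g + x + sum (λ u → g u u)) (ℕₚ.+-identityʳ _) ⟩
  pairSum g + pairSum g + sum (λ u → g u u)
    ≡⟨ cong₂ (λ x y → pairSum g + x + y) (∑-comm λ u v → 𝟙 (u Finₚ.<? v) * g u v)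
         (sum-cong-≗ λ u → sym (diagonal u)) ⟩
  pairSum g + sum (λ u → sum λ v → 𝟙 (v Finₚ.<? u) * g v u) + sum
    (λ u → sum λ v → 𝟙 (u Finₚ.≟ v) * g u v)
    ≡⟨ cong (_+ sum (λ u → sum λ v → 𝟙 (u Finₚ.≟ v) * g u v))
         (∑-distrib-+ (λ u → sum λ v → 𝟙 (u Finₚ.<? v) * g u v)
           (λ u → sum λ v → 𝟙 (v Finₚ.<? u) * g v u)) ⟨
  sum (λ u → sum (λ v → 𝟙 (u Finₚ.<? v) * g u v) + sum (λ v → 𝟙 (v Finₚ.<? u) * g v u)) +
  sum (λ u → sum λ v → 𝟙 (u Finₚ.≟ v) * g u v)
    ≡⟨ ∑-distrib-+ (λ u → sum (λ v → 𝟙 (u Finₚ.<? v) * g u v) + sum (λ v → 𝟙 (v Finₚ.<? u) * g v u))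
         (λ u → sum λ v → 𝟙 (u Finₚ.≟ v) * g u v) ⟨
  sum (λ u → sum (λ v → 𝟙 (u Finₚ.<? v) * g u v) + sum (λ v → 𝟙 (v Finₚ.<? u) * g v u) +
             sum (λ v → 𝟙 (u Finₚ.≟ v) * g u v))
    ≡⟨ sum-cong-≗ (λ u → trans
         (cong (_+ sum (λ v → 𝟙 (u Finₚ.≟ v) * g u v))
            (sym (∑-distrib-+ (λ v → 𝟙 (u Finₚ.<? v) * g u v) (λ v → 𝟙 (v Finₚ.<? u) * g v u))))
         (sym (∑-distrib-+ (λ v → 𝟙 (u Finₚ.<? v) * g u v + 𝟙 (v Finₚ.<? u) * g v u)
            (λ v → 𝟙 (u Finₚ.≟ v) * g u v)))) ⟩
  sum (λ u → sum λ v → 𝟙 (u Finₚ.<? v) * g u v + 𝟙 (v Finₚ.<? u) * g v u + 𝟙 (u Finₚ.≟ v) * g u v)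
    ≡⟨ sum-cong-≗ (λ u → sum-cong-≗ λ v → trichotomy u v) ⟩
  sum (λ u → sum (g u)) ∎
  where
  open ≡-Reasoning
  diagonal : ∀ u → sum (λ v → 𝟙 (u Finₚ.≟ v) * g u v) ≡ g u u
  diagonal u = trans (∑-single (λ v → 𝟙 (u Finₚ.≟ v) * g u v) u
      (λ v v≢u → cong (_* g u v) (𝟙-no (u Finₚ.≟ v) (v≢u ∘ sym))))
    (trans (cong (_* g u u) (𝟙-yes (u Finₚ.≟ u) refl)) (ℕₚ.+-identityʳ _))

  trichotomy : ∀ u v → 𝟙 (u Finₚ.<? v) * g u v + 𝟙 (v Finₚ.<? u) * g v u + 𝟙
    (u Finₚ.≟ v) * g u v ≡ g u v
  trichotomy u v with Finₚ.<-cmp u v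
  ... | tri< u<v u≢v v≮u rewrite 𝟙-yes (u Finₚ.<? v) u<v | 𝟙-no (v Finₚ.<? u) v≮u | 𝟙-no
      (u Finₚ.≟ v) u≢v =
    identity (g u v)
    where
    identity : ∀ x → x + 0 + 0 + 0 ≡ x
    identity = solve-∀
  ... | tri≈ u≮v u≡v v≮u rewrite 𝟙-no (u Finₚ.<? v) u≮v | 𝟙-no (v Finₚ.<? u) v≮u | 𝟙-yes
      (u Finₚ.≟ v) u≡v =
    ℕₚ.+-identityʳ _
  ... | tri> u≮v u≢v v<u rewrite 𝟙-no (u Finₚ.<? v) u≮v | 𝟙-yes (v Finₚ.<? u) v<u | 𝟙-no
      (u Finₚ.≟ v) u≢v =
    trans (ℕₚ.+-identityʳ _) (trans (ℕₚ.+-identityʳ _) (g-sym v u))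

-- Walks and edge-disjoint paths

module _ (G : Multigraph) where

  open import Data.List.Relation.Unary.AllPairs using ([]; _∷_)
  open import Data.Vec.Base using ([]; _∷_)
  open import Data.Vec.Relation.Unary.All using ([]; _∷_)
  open import Data.Vec.Relation.Unary.AllPairs using ([]; _∷_)

  private
    λᴳ : Vertex G → Vertex G → ℕ
    λᴳ = localEdgeConnectivity G

    open DecMembership (Finₚ._≟_ {size G}) using () renaming (_∈?_ to _∈ᴱ?_)
    open DecMembership (Finₚ._≟_ {order G}) using () renaming (_∈?_ to _∈ⱽ?_)

  joins-sym : ∀ {e u v} → Joins G e u v → Joins G e v u
  joins-sym = Sum.swap

  joins-ends : ∀ {e u v x y} → Joins G e u v → Joins G e x y → x ≡ u ⊎ x ≡ v
  joins-ends (inj₁ (refl , _))    (inj₁ (refl , _)) = inj₁ refl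
  joins-ends (inj₁ (_    , refl)) (inj₂ (_ , refl)) = inj₂ refl
  joins-ends (inj₂ (refl , _))    (inj₁ (refl , _)) = inj₂ refl
  joins-ends (inj₂ (_    , refl)) (inj₂ (_ , refl)) = inj₁ refl

  infixr 5 _++ʷ_

  _++ʷ_ : ∀ {u v w} → Walk G u v → Walk G v w → Walk G u w
  []      ++ʷ q = q
  (j ∷ p) ++ʷ q = j ∷ (p ++ʷ q)

  edges-++ʷ : ∀ {u v w} (p : Walk G u v) (q : Walk G v w) → edges G (p ++ʷ q) ≡ edges G p ++ edges G q
  edges-++ʷ []      q = refl
  edges-++ʷ (_ ∷ p) q = cong (_ ∷_) (edges-++ʷ p q)

  ∈-++ʷ⁻ : ∀ {u v w e} (p : Walk G u v) {q : Walk G v w} →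
    e ∈ edges G (p ++ʷ q) → e ∈ edges G p ⊎ e ∈ edges G q
  ∈-++ʷ⁻ {e = e} p {q} e∈ = ∈ₚ.∈-++⁻ (edges G p) (subst (e ∈_) (edges-++ʷ p q) e∈)

  edge : ∀ {e u v} → Joins G e u v → Walk G u v
  edge j = j ∷ []

  reverse : ∀ {u v} → Walk G u v → Walk G v u
  reverse []      = []
  reverse (j ∷ p) = reverse p ++ʷ edge (joins-sym j)

  edges-reverse : ∀ {u v} (p : Walk G u v) → edges G (reverse p) ⊆ edges G p
  edges-reverse (j ∷ p) e∈ with ∈-++ʷ⁻ (reverse p) e∈
  ... | inj₁ e∈p         = there (edges-reverse p e∈p)
  ... | inj₂ (here refl) = here refl

  start∈ : ∀ {u v} (p : Walk G u v) → u ∈ vertices G p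
  start∈ []      = here refl
  start∈ (_ ∷ _) = here refl

  prefix : ∀ {u v z} (p : Walk G u v) → z ∈ vertices G p →
    Σ (Walk G u z) λ q → edges G q ⊆ edges G p
  prefix []      (here refl) = [] , id
  prefix (j ∷ p) (here refl) = [] , λ ()
  prefix (j ∷ p) (there z∈p) with prefix p z∈p
  ... | q , q⊆p = j ∷ q , λ { (here eq) → here eq ; (there e∈q) → there (q⊆p e∈q) }

  suffix : ∀ {u v z} (p : Walk G u v) → z ∈ vertices G p →
    Σ (Walk G z v) λ q → edges G q ⊆ edges G p × (IsPath G p → IsPath G q)
  suffix []      (here refl) = [] , id , id
  suffix (j ∷ p) (here refl) = j ∷ p , id , id
  suffix (j ∷ p) (there z∈p) with suffix p z∈p
  ... | q , q⊆p , path = q , there ∘ q⊆p , λ { (_ ∷ unique) → path unique }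

  walk⇒path : ∀ {u v} (p : Walk G u v) → Σ (Walk G u v) λ q → IsPath G q × edges G q ⊆ edges G p
  walk⇒path []          = [] , (All.[] ∷ []) , id
  walk⇒path {u} (j ∷ p) with walk⇒path p
  ... | q , path , q⊆p with u ∈ⱽ? vertices G q
  ...   | yes u∈q with suffix q u∈q
  ...     | r , r⊆q , isPath = r , isPath path , there ∘ q⊆p ∘ r⊆q
  walk⇒path {u} (j ∷ p) | q , path , q⊆p | no u∉q =
    j ∷ q , Allₚ.¬Any⇒All¬ _ u∉q ∷ path , λ { (here eq) → here eq ; (there e∈q) → there (q⊆p e∈q) }

  disjointWalks⇒≤λ : ∀ {u v k} → u ≢ v → (ps : Vec (Walk G u v) k) →
    VAllPairs.AllPairs (EdgeDisjoint G) ps → k ≤ λᴳ u v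
  disjointWalks⇒≤λ u≢v ps disjoint = proj₂ (localEdgeConnectivity-greatest G u≢v) _
    ( Vec.map (proj₁ ∘ walk⇒path) ps
    , VAllₚ.map⁺ (VAll.universal (proj₁ ∘ proj₂ ∘ walk⇒path) ps)
    , VAllPairsₚ.map⁺ (VAllPairs.map (λ {p} {q} p#q {_} (e∈p , e∈q) →
        p#q (proj₂ (proj₂ (walk⇒path p)) e∈p , proj₂ (proj₂ (walk⇒path q)) e∈q)) disjoint) )

  common-edge⇒same-index : ∀ {u v k e} {ps : Vec (Walk G u v) k} → VAllPairs.AllPairs
    (EdgeDisjoint G) ps →
    ∀ i j → e ∈ edges G (Vec.lookup ps i) → e ∈ edges G (Vec.lookup ps j) → i ≡ j
  common-edge⇒same-index _             zero    zero    _   _   = refl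
  common-edge⇒same-index (p#ps ∷ _)    zero    (suc j) e∈p e∈q = contradiction (e∈p , e∈q)
    (VAllₚ.lookup⁺ p#ps j)
  common-edge⇒same-index (p#ps ∷ _)    (suc i) zero    e∈p e∈q = contradiction (e∈q , e∈p)
    (VAllₚ.lookup⁺ p#ps i)
  common-edge⇒same-index (_ ∷ disjoint) (suc i) (suc j) e∈p e∈q =
    cong suc (common-edge⇒same-index disjoint i j e∈p e∈q)

  λ-sym-≤ : ∀ {u v} → u ≢ v → λᴳ u v ≤ λᴳ v u
  λ-sym-≤ u≢v with proj₁ (localEdgeConnectivity-greatest G u≢v)
  ... | ps , _ , disjoint = disjointWalks⇒≤λ (u≢v ∘ sym) (Vec.map reverse ps)
    (VAllPairsₚ.map⁺ (VAllPairs.map (λ {p} {q} p#q {_} (e∈p , e∈q) →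
      p#q (edges-reverse p e∈p , edges-reverse q e∈q)) disjoint))

  Crosses : (Vertex G → Bool) → Edge G → Set
  Crosses W e = W (source G e) ≢ W (target G e)

  joins-crosses : ∀ {W e u v} → Joins G e u v → W u ≢ W v → Crosses W e
  joins-crosses (inj₁ (refl , refl)) Wu≢Wv = Wu≢Wv
  joins-crosses (inj₂ (refl , refl)) Wu≢Wv = Wu≢Wv ∘ sym

  walk-crosses : ∀ {W u v} (p : Walk G u v) → W u ≢ W v → ∃ λ e → e ∈ edges G p × Crosses W e
  walk-crosses     []                    Wu≢Wv = contradiction refl Wu≢Wv
  walk-crosses {W} (_∷_ {u = u} {v} j p) Wu≢Wv with W u Boolₚ.≟ W v
  ... | no Wu≢Wx = _ , here refl , joins-crosses j Wu≢Wx
  ... | yes eq with walk-crosses p (Wu≢Wv ∘ trans eq)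
  ...   | e , e∈p , crosses = e , there e∈p , crosses

  λ≤cut : ∀ {u v} W (L : List (Edge G)) → (∀ e → Crosses W e → e ∈ L) → W u ≢ W v → λᴳ u v ≤ length L
  λ≤cut {u} {v} W L crosses⇒∈L Wu≢Wv with proj₁
    (localEdgeConnectivity-greatest G {u} {v} (Wu≢Wv ∘ cong W))
  ... | ps , _ , disjoint = Finₚ.injective⇒≤ {f = position} λ {i} {j} → injective i j
    where
    crossing : ∀ i → ∃ λ e → e ∈ edges G (Vec.lookup ps i) × Crosses W e
    crossing i = walk-crosses (Vec.lookup ps i) Wu≢Wv

    ∈L : ∀ i → proj₁ (crossing i) ∈ L
    ∈L i = crosses⇒∈L _ (proj₂ (proj₂ (crossing i)))

    position : Fin (localEdgeConnectivity G u v) → Fin (length L)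
    position i = index (∈L i)

    injective : ∀ i j → position i ≡ position j → i ≡ j
    injective i j eq = common-edge⇒same-index disjoint i j (proj₁ (proj₂ (crossing i)))
      (subst (_∈ edges G (Vec.lookup ps j))
        (trans (lookup-index (∈L j)) (trans (cong (lookup L) (sym eq)) (sym (lookup-index (∈L i)))))
        (proj₁ (proj₂ (crossing j))))

  private
    isVertex : Vertex G → Vertex G → Bool
    isVertex v x = does (x Finₚ.≟ v)

    star-cut : ∀ v e → Crosses (isVertex v) e → e ∈ filter (incident? G v) (allFin (size G))
    star-cut v e crosses with source G e Finₚ.≟ v | target G e Finₚ.≟ v
    ... | yes s | _     = ∈ₚ.∈-filter⁺ (incident? G v) (∈ₚ.∈-allFin e) (inj₁ s)
    ... | no _  | yes t = ∈ₚ.∈-filter⁺ (incident? G v) (∈ₚ.∈-allFin e) (inj₂ t)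
    ... | no _  | no _  = contradiction refl crosses

    isVertex-≢ : ∀ {u v} → u ≢ v → isVertex u u ≢ isVertex u v
    isVertex-≢ {u} {v} u≢v eq with trans (sym (dec-true (u Finₚ.≟ u) refl))
      (trans eq (dec-false (v Finₚ.≟ u) (u≢v ∘ sym)))
    ... | ()

  λ≤degreeˡ : ∀ {u v} → u ≢ v → λᴳ u v ≤ degree G u
  λ≤degreeˡ {u} u≢v = λ≤cut (isVertex u) _ (star-cut u) (isVertex-≢ u≢v)

  λ≤degreeʳ : ∀ {u v} → u ≢ v → λᴳ u v ≤ degree G v
  λ≤degreeʳ {u} {v} u≢v = λ≤cut (isVertex v) _ (star-cut v) (isVertex-≢ (u≢v ∘ sym) ∘ sym)

  Bridgeless : Set
  Bridgeless = ∀ e u v → Σ (Walk G u v) λ p → e ∉ edges G p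

  private
    TwoWalks : Vertex G → Vertex G → Set
    TwoWalks u v = Σ (Walk G u v) λ p → Σ (Walk G u v) λ q → EdgeDisjoint G p q

    swap : ∀ {u v} → TwoWalks u v → TwoWalks u v
    swap (p , q , p#q) = q , p , λ (e∈q , e∈p) → p#q (e∈p , e∈q)

    beforeFirst : ∀ {u v f} (p : Walk G u v) → f ∈ edges G p →
      ∃ λ x → ∃ λ y → Joins G f x y × Σ (Walk G u x) λ q → f ∉ edges G q × edges G q ⊆ edges G p
    beforeFirst {f = f} (_∷_ {e = e} j p) f∈ with e Finₚ.≟ f
    ... | yes refl = _ , _ , j , [] , (λ ()) , λ ()
    beforeFirst (j ∷ p) (here refl) | no e≢f = contradiction refl e≢f
    beforeFirst (j ∷ p) (there f∈p) | no e≢f with beforeFirst p f∈p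
    ... | x , y , jf , q , f∉q , q⊆p = x , y , jf , j ∷ q
        , (λ { (here refl) → e≢f refl ; (there f∈q) → f∉q f∈q })
        , λ { (here eq) → here eq ; (there e∈q) → there (q⊆p e∈q) }

    ends∈ : ∀ {u v e x y} (p : Walk G u v) → e ∈ edges G p → Joins G e x y → x ∈ vertices G p
    ends∈ (j ∷ p) (here refl) j′ with joins-ends j j′
    ... | inj₁ refl = here refl
    ... | inj₂ refl = there (start∈ p)
    ends∈ (j ∷ p) (there e∈p) j′ = there (ends∈ p e∈p j′)

    module _ {u v : Vertex G} (p q : Walk G u v) where

      Touches : Vertex G → Set
      Touches z = z ∈ vertices G p ⊎ z ∈ vertices G q

      touches? : ∀ z → Dec (Touches z)
      touches? z with z ∈ⱽ? vertices G p | z ∈ⱽ? vertices G q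
      ... | yes z∈p | _       = yes (inj₁ z∈p)
      ... | no _    | yes z∈q = yes (inj₂ z∈q)
      ... | no z∉p  | no z∉q  = no [ z∉p , z∉q ]′

      Tail : ∀ {x y} → Walk G x y → Set
      Tail {x} {y} r = ∃ λ z → Touches z × Σ (Walk G z y) λ t →
        edges G t ⊆ edges G r × Disjoint (edges G t) (edges G p) × Disjoint (edges G t) (edges G q)

      lastTouch : ∀ {x y} (r : Walk G x y) → Tail r ⊎ (∀ {z} → z ∈ vertices G r → ¬ Touches z)
      lastTouch {x} [] with touches? x
      ... | yes touch = inj₁ (x , touch , [] , id , (λ ()) , λ ())
      ... | no ¬touch = inj₂ λ { (here refl) → ¬touch }
      lastTouch {x} (j ∷ r) with lastTouch r
      ... | inj₁ (z , touch , t , t⊆r , t#p , t#q) = inj₁ (z , touch , t , there ∘ t⊆r , t#p , t#q)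
      ... | inj₂ untouched with touches? x
      ...   | no ¬touch = inj₂ λ { (here refl) → ¬touch ; (there z∈r) → untouched z∈r }
      ...   | yes touch = inj₁ (x , touch , j ∷ r , id , avoids p inj₁ , avoids q inj₂)
        where
        avoids : ∀ {u v} (s : Walk G u v) → (∀ {z} → z ∈ vertices G s → Touches z) → Disjoint
          (edges G (j ∷ r)) (edges G s)
        avoids s touches (here refl , e∈s) = untouched (start∈ r) (touches (ends∈ s e∈s (joins-sym j)))
        avoids s touches (there e∈r , e∈s) = go r (λ z∈r → untouched z∈r) e∈r e∈s
          where
          go : ∀ {x y e} (r : Walk G x y) → (∀ {z} → z ∈ vertices G r → ¬ Touches z) →
            e ∈ edges G r → e ∈ edges G s → _
          go (j ∷ r) untouched (here refl) e∈s = untouched (here refl) (touches (ends∈ s e∈s j))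
          go (j ∷ r) untouched (there e∈r) e∈s = go r (untouched ∘ there) e∈r e∈s

    -- Replace the two walks by f after one of them, and by the detour r from its
    -- last contact with the two walks after a prefix of the other one.
    extend-fresh : ∀ {u v w f} → Joins G f v w → ((p , q , _) : TwoWalks u v) → f ∉ edges G p →
      f ∉ edges G q →
      (Σ (Walk G u w) λ r → f ∉ edges G r) → TwoWalks u w
    extend-fresh {f = f} j (p , q , p#q) f∉p f∉q (r , f∉r) with lastTouch p q r
    ... | inj₂ untouched = contradiction (inj₁ (start∈ p)) (untouched (start∈ r))
    ... | inj₁ (z , inj₁ z∈p , t , t⊆r , t#p , t#q) with prefix p z∈p
    ...   | p₁ , p₁⊆p = p₁ ++ʷ t , q ++ʷ edge j , disjoint
      where
      disjoint : EdgeDisjoint G (p₁ ++ʷ t) (q ++ʷ edge j)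
      disjoint (e∈ , e∈′) with ∈-++ʷ⁻ p₁ e∈ | ∈-++ʷ⁻ q e∈′
      ... | inj₁ e∈p₁ | inj₁ e∈q         = p#q (p₁⊆p e∈p₁ , e∈q)
      ... | inj₁ e∈p₁ | inj₂ (here refl) = f∉p (p₁⊆p e∈p₁)
      ... | inj₂ e∈t  | inj₁ e∈q         = t#q (e∈t , e∈q)
      ... | inj₂ e∈t  | inj₂ (here refl) = f∉r (t⊆r e∈t)
    extend-fresh {f = f} j (p , q , p#q) f∉p f∉q (r , f∉r) | inj₁ (z , inj₂ z∈q , t , t⊆r , t#p , t#q)
      with prefix q z∈q
    ...   | q₁ , q₁⊆q = p ++ʷ edge j , q₁ ++ʷ t , disjoint
      where
      disjoint : EdgeDisjoint G (p ++ʷ edge j) (q₁ ++ʷ t)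
      disjoint (e∈ , e∈′) with ∈-++ʷ⁻ p e∈ | ∈-++ʷ⁻ q₁ e∈′
      ... | inj₁ e∈p         | inj₁ e∈q₁ = p#q (e∈p , q₁⊆q e∈q₁)
      ... | inj₁ e∈p         | inj₂ e∈t  = t#p (e∈t , e∈p)
      ... | inj₂ (here refl) | inj₁ e∈q₁ = f∉q (q₁⊆q e∈q₁)
      ... | inj₂ (here refl) | inj₂ e∈t  = f∉r (t⊆r e∈t)

    extend-used : ∀ {u v w f} → Joins G f v w → ((p , q , _) : TwoWalks u v) → f ∈ edges G q →
      (Σ (Walk G u w) λ r → f ∉ edges G r) → TwoWalks u w
    extend-used j (p , q , p#q) f∈q detour with beforeFirst q f∈q
    ... | x , y , jf , q₁ , f∉q₁ , q₁⊆q with joins-ends j jf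
    ...   | inj₁ refl = extend-fresh j (p , q₁ , λ (e∈p , e∈q₁) → p#q (e∈p , q₁⊆q e∈q₁))
                          (λ f∈p → p#q (f∈p , f∈q)) f∉q₁ detour
    ...   | inj₂ refl = p ++ʷ edge j , q₁ , disjoint
      where
      disjoint : EdgeDisjoint G (p ++ʷ edge j) q₁
      disjoint (e∈ , e∈q₁) with ∈-++ʷ⁻ p e∈
      ... | inj₁ e∈p         = p#q (e∈p , q₁⊆q e∈q₁)
      ... | inj₂ (here refl) = f∉q₁ e∈q₁

    extend : ∀ {u v w f} → Joins G f v w → TwoWalks u v → (Σ (Walk G u w) λ r → f ∉ edges G r) →
      TwoWalks u w
    extend {f = f} j two@(p , q , p#q) detour with f ∈ᴱ? edges G p | f ∈ᴱ? edges G q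
    ... | yes f∈p | _       = extend-used j (swap two) f∈p detour
    ... | no _    | yes f∈q = extend-used j two f∈q detour
    ... | no f∉p  | no f∉q  = extend-fresh j two f∉p f∉q detour

  2≤λ : Bridgeless → ∀ {u v} → Walk G u v → u ≢ v → 2 ≤ λᴳ u v
  2≤λ bridgeless {u} {v} walk u≢v with follow walk ([] , [] , λ ())
    where
    follow : ∀ {x y} → Walk G x y → TwoWalks u x → TwoWalks u y
    follow []      two = two
    follow (_∷_ {e = e} {v = y} j r) two = follow r (extend j two (bridgeless e u y))
  ... | p , q , p#q = disjointWalks⇒≤λ u≢v (p ∷ q ∷ []) ((p#q ∷ []) ∷ [] ∷ [])

-- Cuts of size two

∣S∣≤1⇒unique : ∀ {n} (S : Subset n) → ∣ S ∣ ≤ 1 → ∀ {i j} → i ∈ˢ S → j ∈ˢ S → i ≡ j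
∣S∣≤1⇒unique S ∣S∣≤1 {i} {j} i∈S j∈S with i Finₚ.≟ j
... | yes i≡j = i≡j
... | no i≢j  = contradiction ∣S∣≤1 (ℕₚ.<⇒≱ (ℕₚ.≤-<-trans
  (ℕₚ.≤-<-trans z≤n (Subsetₚ.x∈p⇒∣p-x∣<∣p∣ (Subsetₚ.x∈p∧x≢y⇒x∈p-y j∈S (i≢j ∘ sym))))
    (Subsetₚ.x∈p⇒∣p-x∣<∣p∣ i∈S)))

module _ (G : Multigraph) where

  open import Data.Vec.Base using ([]; _∷_)
  open import Data.Vec.Relation.Unary.All using ([]; _∷_)
  open import Data.Vec.Relation.Unary.AllPairs using ([]; _∷_)

  ∖-walk : ∀ {S u v} → Walk (G ∖ S) u v → Σ (Walk G u v) λ p → ∀ {e} → e ∈ edges G p → e ∉ˢ S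
  ∖-walk []                          = [] , λ ()
  ∖-walk {S} (_∷_ {e = i} j p) with ∖-walk p
  ... | q , avoids = j ∷ q , λ
    { (here refl) → proj₂ (∈ₚ.∈-filter⁻ (λ e → ¬? (e Subsetₚ.∈? S)) {xs = allFin (size G)}
        (∈ₚ.∈-lookup i))
    ; (there e∈q) → avoids e∈q }

  ∖-edge : ∀ S e → e ∉ˢ S → ∃ λ i → lookup (remainingEdges G S) i ≡ e
  ∖-edge S e e∉S = index e∈ , sym (lookup-index e∈)
    where
    e∈ : e ∈ remainingEdges G S
    e∈ = ∈ₚ.∈-filter⁺ (λ e → ¬? (e Subsetₚ.∈? S)) (∈ₚ.∈-allFin e) e∉S

  reachable? : ∀ u v → Dec (∃[ p ] IsPath G {u} {v} p)
  reachable? u v = map′ (λ { (p ∷ [] , path ∷ [] , _) → p , path })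
                        (λ { (p , path) → p ∷ [] , path ∷ [] , [] ∷ [] })
                        (edgeDisjointPaths? G u v 1)

  reachable-extend : ∀ {u v w e} → Joins G e v w → ∃[ p ] IsPath G {u} {v} p → ∃[ p ] IsPath G {u} {w} p
  reachable-extend j (p , _) with walk⇒path G (_++ʷ_ G p (edge G j))
  ... | q , path , _ = q , path

  opaque
    disconnected⇒uncrossed-cut : ¬ Connected G →
      Σ (Vertex G → Bool) λ W → (∃ λ u → ∃ λ v → W u ≢ W v) × ∀ e → ¬ Crosses G W e
    disconnected⇒uncrossed-cut ¬connected
      with Finₚ.¬∀⟶∃¬ _ _ (λ u → Finₚ.all? (reachable? u)) ¬connected
    ... | u , ¬u with Finₚ.¬∀⟶∃¬ _ _ (reachable? u) ¬u
    ...   | v , ¬uv = does ∘ reachable? u , (u , v , separated) , λ e crosses → crosses (uncrossed e)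
      where
      separated : does (reachable? u u) ≢ does (reachable? u v)
      separated eq with trans (sym (dec-true (reachable? u u)
        (walk⇒path G [] .proj₁ , walk⇒path G [] .proj₂ .proj₁)))
                              (trans eq (dec-false (reachable? u v) ¬uv))
      ... | ()

      uncrossed : ∀ e → does (reachable? u (source G e)) ≡ does (reachable? u (target G e))
      uncrossed e = does-⇔ (mk⇔ (reachable-extend (inj₁ (refl , refl)))
        (reachable-extend (inj₂ (refl , refl))))
        (reachable? u (source G e)) (reachable? u (target G e))

  record TwoCut (e : Edge G) : Set where
    field
      side    : Vertex G → Bool
      partner : Edge G
      crosses : Crosses G side e
      only    : ∀ f → Crosses G side f → f ≡ e ⊎ f ≡ partner

module _ (G : Multigraph) .{{_ : NonTrivial (order G)}} where

  few⇒connected : ∀ S → ∣ S ∣ < edgeConnectivity G → Connected (G ∖ S)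
  few⇒connected S ∣S∣<ec with connected? (G ∖ S)
  ... | yes connected = connected
  ... | no disconnects = contradiction ∣S∣<ec (ℕₚ.≤⇒≯ (proj₂ (edgeConnectivity-least G) S disconnects))

  module _ (ec≡2 : edgeConnectivity G ≡ 2) where

    bridgeless : Bridgeless G
    bridgeless e u v with ∖-walk G (proj₁ (few⇒connected ⁅ e ⁆
      (subst₂ _<_ (sym (Subsetₚ.∣⁅x⁆∣≡1 e)) (sym ec≡2) (s≤s (s≤s z≤n))) u v))
    ... | p , avoids = p , λ e∈p → avoids e∈p (Subsetₚ.x∈⁅x⁆ e)

    someWalk : ∀ u v → Walk G u v
    someWalk u v = proj₁ (∖-walk G (proj₁ (few⇒connected ∅
      (subst₂ _<_ (sym (Subsetₚ.∣⊥∣≡0 (size G))) (sym ec≡2) (s≤s z≤n)) u v)))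

    two≤λ : ∀ {u v} → u ≢ v → 2 ≤ localEdgeConnectivity G u v
    two≤λ {u} {v} = 2≤λ G bridgeless (someWalk u v)

  private
    module _ (ec≡2 : edgeConnectivity G ≡ 2) (e : Edge G) (S : Subset (size (G ∖ ⁅ e ⁆)))
      (∣S∣≤1 : ∣ S ∣ ≤ 1)
      (W : Vertex G → Bool) {u v : Vertex G} (Wu≢Wv : W u ≢ W v)
      (uncrossed : ∀ i → ¬ Crosses (G ∖ ⁅ e ⁆ ∖ S) W i) where

      crossing⇒ : ∀ f → Crosses G W f → f ≡ e ⊎ ∃ λ i → i ∈ˢ S × lookup (remainingEdges G ⁅ e ⁆) i ≡ f
      crossing⇒ f Wf with f Finₚ.≟ e
      ... | yes f≡e = inj₁ f≡e
      ... | no f≢e with ∖-edge G ⁅ e ⁆ f (f≢e ∘ Subsetₚ.x∈⁅y⁆⇒x≡y e)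
      ...   | i , refl with i Subsetₚ.∈? S
      ...     | yes i∈S = inj₂ (i , i∈S , refl)
      ...     | no i∉S with ∖-edge (G ∖ ⁅ e ⁆) S i i∉S
      ...       | i′ , refl = contradiction Wf (uncrossed i′)

      assemble : ∀ f → (∀ g → Crosses G W g → g ≡ e ⊎ g ≡ f) → TwoCut G e
      assemble f only = record { side = W ; partner = f ; crosses = e-crosses ; only = only }
        where
        e-crosses : Crosses G W e
        e-crosses with W (source G e) Boolₚ.≟ W (target G e)
        ... | no We = We
        ... | yes e-uncrossed with bridgeless ec≡2 f u v
        ...   | p , f∉p with walk-crosses G {W = W} p Wu≢Wv
        ...     | g , g∈p , Wg with only g Wg
        ...       | inj₁ refl = contradiction e-uncrossed Wg
        ...       | inj₂ refl = contradiction g∈p f∉p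

      assembled : TwoCut G e
      assembled with Finₚ.any? (Subsetₚ._∈? S)
      ... | yes (i , i∈S) = assemble (lookup (remainingEdges G ⁅ e ⁆) i) λ g Wg → Sum.map₂
        (λ (i′ , i′∈S , eq) → trans (sym eq)
          (cong (lookup (remainingEdges G ⁅ e ⁆)) (∣S∣≤1⇒unique S ∣S∣≤1 i′∈S i∈S)))
        (crossing⇒ g Wg)
      ... | no S-empty = assemble e λ g Wg →
        Sum.map₂ (λ (i , i∈S , _) → contradiction (i , i∈S) S-empty) (crossing⇒ g Wg)

  opaque
    twoCut : MinimallyTwoEdgeConnected G → ∀ e → TwoCut G e
    twoCut (ec≡2 , minimal) e with proj₁ (edgeConnectivity-least (G ∖ ⁅ e ⁆))
    ... | S , ∣S∣≡ , disconnects with disconnected⇒uncrossed-cut (G ∖ ⁅ e ⁆ ∖ S) disconnects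
    ...   | W , (u , v , Wu≢Wv) , uncrossed =
      assembled ec≡2 e S (s≤s⁻¹ (subst (_< 2) (sym ∣S∣≡) (minimal e))) W Wu≢Wv uncrossed

-- Classes of vertices not separated by the chosen cuts

∑-product : ∀ {m n} (f : Fin m → ℕ) (g : Fin n → ℕ) → sum (λ i → sum λ j → f i * g j) ≡ sum f * sum g
∑-product f g = trans (sum-cong-≗ λ i → sym (*-distribˡ-sum (f i) g)) (sym (*-distribʳ-sum (sum g) f))

∑∑-distrib-+ : ∀ {m n} (f g : Fin m → Fin n → ℕ) →
  sum (λ i → sum λ j → f i j + g i j) ≡ sum (λ i → sum (f i)) + sum (λ i → sum (g i))
∑∑-distrib-+ f g = trans (sum-cong-≗ λ i → ∑-distrib-+ (f i) (g i)) (∑-distrib-+ (sum ∘ f) (sum ∘ g))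

∈-all⇒≤length : ∀ {m} (xs : List (Fin m)) → (∀ i → i ∈ xs) → m ≤ length xs
∈-all⇒≤length xs ∈xs = Finₚ.injective⇒≤ {f = λ i → index (∈xs i)} λ {i} {j} eq →
  trans (lookup-index (∈xs i)) (trans (cong (lookup xs) eq) (sym (lookup-index (∈xs j))))

module _ (G : Multigraph) where

  incident≡ : ∀ v e → 𝟙 (incident? G v e) ≡ 𝟙 (v Finₚ.≟ source G e) + 𝟙 (v Finₚ.≟ target G e)
  incident≡ v e with v Finₚ.≟ source G e | v Finₚ.≟ target G e
  ... | yes refl | yes eq = contradiction eq (loopless G e)
  ... | yes refl | no _   = 𝟙-yes (incident? G v e) (inj₁ refl)
  ... | no _     | yes eq = 𝟙-yes (incident? G v e) (inj₂ (sym eq))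
  ... | no v≢s   | no v≢t = 𝟙-no (incident? G v e) [ v≢s ∘ sym , v≢t ∘ sym ]′

  degree-sum : ∀ v → degree G v ≡ sum (λ e → 𝟙 (incident? G v e))
  degree-sum v = length-filter-tabulate (incident? G v) id

  degree≤size : ∀ v → degree G v ≤ size G
  degree≤size v = subst₂ _≤_ (sym (degree-sum v)) (trans (∑-const (size G) 1) (ℕₚ.*-identityʳ _))
    (∑-mono λ e → 𝟙≤1 (incident? G v e))

  private
    pointMass : ∀ {n} (w : Fin n → ℕ) x → sum (λ v → w v * 𝟙 (v Finₚ.≟ x)) ≡ w x
    pointMass w x = trans (∑-single (λ v → w v * 𝟙 (v Finₚ.≟ x)) x
        (λ v v≢x → trans (cong (w v *_) (𝟙-no (v Finₚ.≟ x) v≢x)) (ℕₚ.*-zeroʳ (w v))))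
      (trans (cong (w x *_) (𝟙-yes (x Finₚ.≟ x) refl)) (ℕₚ.*-identityʳ (w x)))

  weighted-handshake : (w : Vertex G → ℕ) →
    sum (λ v → w v * degree G v) ≡ sum (λ e → w (source G e) + w (target G e))
  weighted-handshake w = begin
    sum (λ v → w v * degree G v)
      ≡⟨ sum-cong-≗ (λ v → trans (cong (w v *_) (degree-sum v))
        (*-distribˡ-sum (w v) (λ e → 𝟙 (incident? G v e)))) ⟩
    sum (λ v → sum λ e → w v * 𝟙 (incident? G v e))
      ≡⟨ ∑-comm (λ v e → w v * 𝟙 (incident? G v e)) ⟩
    sum (λ e → sum λ v → w v * 𝟙 (incident? G v e))
      ≡⟨ sum-cong-≗ (λ e → trans (sum-cong-≗ λ v → trans (cong (w v *_) (incident≡ v e))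
           (ℕₚ.*-distribˡ-+ (w v) (𝟙 (v Finₚ.≟ source G e)) (𝟙 (v Finₚ.≟ target G e))))
           (trans (∑-distrib-+ (λ v → w v * 𝟙 (v Finₚ.≟ source G e))
             (λ v → w v * 𝟙 (v Finₚ.≟ target G e)))
             (cong₂ _+_ (pointMass w (source G e)) (pointMass w (target G e))))) ⟩
    sum (λ e → w (source G e) + w (target G e)) ∎
    where open ≡-Reasoning

  handshake : sum (degree G) ≡ 2 * size G
  handshake = trans (sum-cong-≗ λ v → sym (ℕₚ.+-identityʳ (degree G v)))
    (trans (weighted-handshake (λ _ → 1)) (trans (∑-const (size G) 2) (ℕₚ.*-comm (size G) 2)))

module Classes (G : Multigraph) (cut : ∀ e → TwoCut G e) where

  open module Cut e = TwoCut (cut e) using (side; partner; crosses; only)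

  infix 4 _~_ _~?_

  _~_ : Vertex G → Vertex G → Set
  u ~ v = ∀ e → side e u ≡ side e v

  _~?_ : ∀ u v → Dec (u ~ v)
  u ~? v = Finₚ.all? λ e → side e u Boolₚ.≟ side e v

  ~-refl : ∀ {u} → u ~ u
  ~-refl e = refl

  ~-sym : ∀ {u v} → u ~ v → v ~ u
  ~-sym u~v e = sym (u~v e)

  ~-trans : ∀ {u v w} → u ~ v → v ~ w → u ~ w
  ~-trans u~v v~w e = trans (u~v e) (v~w e)

  ends≁ : ∀ e → ¬ source G e ~ target G e
  ends≁ e ends~ = crosses e (ends~ e)

  ≁⇒λ≤2 : ∀ {u v} → ¬ u ~ v → localEdgeConnectivity G u v ≤ 2
  ≁⇒λ≤2 {u} {v} u≁v with Finₚ.¬∀⟶∃¬ _ _ (λ e → side e u Boolₚ.≟ side e v) u≁v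
  ... | e , separated = λ≤cut G (side e) (e ∷ partner e ∷ [])
    (λ f f-crosses → [ here , there ∘ here ]′ (only e f f-crosses)) separated

  SeparatedBy : List (Edge G) → Vertex G → Vertex G → Set
  SeparatedBy L u v = Any (λ e → side e u ≢ side e v) L

  separatedBy? : ∀ L u v → Dec (SeparatedBy L u v)
  separatedBy? L u v = any? (λ e → ¬? (side e u Boolₚ.≟ side e v)) L

  unseparated : ∀ {L u v} → ¬ SeparatedBy L u v → ∀ {e} → e ∈ L → side e u ≡ side e v
  unseparated {u = u} {v} ¬sep {e} e∈L with side e u Boolₚ.≟ side e v
  ... | yes eq = eq
  ... | no neq = contradiction (lose e∈L neq) ¬sep

  separated-sym : ∀ {L u v} → SeparatedBy L u v → SeparatedBy L v u
  separated-sym (here neq)  = here (neq ∘ sym)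
  separated-sym (there sep) = there (separated-sym sep)

  Separates : List (Edge G) → List (Vertex G) → Set
  Separates L R = ∀ {u v} → u ∈ R → v ∈ R → ¬ u ~ v → SeparatedBy L u v

  -- A new vertex is unseparated from at most one old class, so one more cut suffices.
  few-cuts-separate : ∀ r R → ∃ λ L → length L ≤ length R × Separates L (r ∷ R)
  few-cuts-separate r [] = [] , z≤n , λ { (here refl) (here refl) r≁r → contradiction ~-refl r≁r }
  few-cuts-separate r (r′ ∷ R) with few-cuts-separate r′ R
  ... | L , ∣L∣≤∣R∣ , separates with any? (λ x → ¬? (r ~? x) ×-dec ¬? (separatedBy? L r x)) (r′ ∷ R)
  ...   | no none = L , ℕₚ.m≤n⇒m≤1+n ∣L∣≤∣R∣ , λ
    { (here refl) (here refl) r≁r → contradiction ~-refl r≁r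
    ; (here refl) (there v∈) r≁v → new v∈ r≁v
    ; (there u∈) (here refl) u≁r → separated-sym (new u∈ (u≁r ∘ ~-sym))
    ; (there u∈) (there v∈) → separates u∈ v∈ }
    where
    new : ∀ {v} → v ∈ r′ ∷ R → ¬ r ~ v → SeparatedBy L r v
    new {v} v∈ r≁v with separatedBy? L r v
    ... | yes sep = sep
    ... | no ¬sep = contradiction (lose v∈ (r≁v , ¬sep)) none
  ...   | yes some with find some
  ...     | x , x∈ , r≁x , ¬sep with Finₚ.¬∀⟶∃¬ _ _ (λ e → side e r Boolₚ.≟ side e x) r≁x
  ...       | e , e-separates = e ∷ L , s≤s ∣L∣≤∣R∣ , λ
    { (here refl) (here refl) r≁r → contradiction ~-refl r≁r
    ; (here refl) (there v∈) r≁v → new v∈ r≁v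
    ; (there u∈) (here refl) u≁r → separated-sym (new u∈ (u≁r ∘ ~-sym))
    ; (there u∈) (there v∈) u≁v → there (separates u∈ v∈ u≁v) }
    where
    new : ∀ {v} → v ∈ r′ ∷ R → ¬ r ~ v → SeparatedBy (e ∷ L) r v
    new {v} v∈ r≁v with separatedBy? L r v | v ~? x
    ... | yes sep  | _       = there sep
    ... | no _     | yes v~x = here (e-separates ∘ λ eq → trans eq (v~x e))
    ... | no ¬sep′ | no v≁x with find (separates v∈ x∈ v≁x)
    ...   | f , f∈L , f-separates =
      contradiction (trans (sym (unseparated ¬sep′ f∈L)) (unseparated ¬sep f∈L)) f-separates

  cutEdges : List (Edge G) → List (Edge G)
  cutEdges []      = []
  cutEdges (e ∷ L) = e ∷ partner e ∷ cutEdges L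

  length-cutEdges : ∀ L → length (cutEdges L) ≡ 2 * length L
  length-cutEdges []      = refl
  length-cutEdges (_ ∷ L) = trans (cong (2 +_) (length-cutEdges L)) (sym (ℕₚ.*-suc 2 (length L)))

  crosses⇒∈cutEdges : ∀ {L} f → SeparatedBy L (source G f) (target G f) → f ∈ cutEdges L
  crosses⇒∈cutEdges f (here {e} f-crosses) = [ here , there ∘ here ]′ (only e f f-crosses)
  crosses⇒∈cutEdges f (there sep)      = there (there (crosses⇒∈cutEdges f sep))

  size≤2*representatives : ∀ r R → (∀ v → ∃ λ x → x ∈ r ∷ R × v ~ x) → size G ≤ 2 * length R
  size≤2*representatives r R covers with few-cuts-separate r R
  ... | L , ∣L∣≤∣R∣ , separates = ℕₚ.≤-trans
    (subst (size G ≤_) (length-cutEdges L) (∈-all⇒≤length (cutEdges L) λ f → crosses⇒∈cutEdges f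
      (separated f)))
    (ℕₚ.*-monoʳ-≤ 2 ∣L∣≤∣R∣)
    where
    separated : ∀ f → SeparatedBy L (source G f) (target G f)
    separated f with covers (source G f) | covers (target G f)
    ... | x , x∈ , s~x | y , y∈ , t~y with find
        (separates x∈ y∈ (λ x~y → ends≁ f (~-trans s~x (~-trans x~y (~-sym t~y)))))
    ...   | e , e∈L , e-separates = lose e∈L λ eq → e-separates (trans (sym (s~x e)) (trans eq (t~y e)))

  classSize : Vertex G → ℕ
  classSize u = sum λ v → 𝟙 (u ~? v)

  outside : Vertex G → List (Vertex G)
  outside u = filter (λ v → ¬? (u ~? v)) (allFin (order G))

  opaque
    largest : Vertex G → ∃ λ u → ∀ v → classSize v ≤ classSize u
    largest v₀ = argmax classSize v₀ (allFin (order G)) ,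
      λ v → All.lookup (f[xs]≤f[argmax] v₀ (allFin (order G))) (∈ₚ.∈-allFin v)

  classSize+outside : ∀ u → classSize u + length (outside u) ≡ order G
  classSize+outside u = begin
    classSize u + length (outside u)
      ≡⟨ cong (classSize u +_) (length-filter-tabulate (λ v → ¬? (u ~? v)) id) ⟩
    sum (λ v → 𝟙 (u ~? v)) + sum (λ v → 𝟙 (¬? (u ~? v)))
      ≡⟨ ∑-distrib-+ (λ v → 𝟙 (u ~? v)) (λ v → 𝟙 (¬? (u ~? v))) ⟨
    sum (λ v → 𝟙 (u ~? v) + 𝟙 (¬? (u ~? v)))
      ≡⟨ sum-cong-≗ (λ v → 𝟙-¬ (u ~? v)) ⟩
    sum {order G} (λ _ → 1)
      ≡⟨ trans (∑-const (order G) 1) (ℕₚ.*-identityʳ _) ⟩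
    order G ∎
    where open ≡-Reasoning

  size≤2*outside : ∀ u → size G ≤ 2 * length (outside u)
  size≤2*outside u = size≤2*representatives u (outside u) covers
    where
    covers : ∀ v → ∃ λ x → x ∈ u ∷ outside u × v ~ x
    covers v with u ~? v
    ... | yes u~v = u , here refl , ~-sym u~v
    ... | no u≁v  = v , there (∈ₚ.∈-filter⁺ (λ v → ¬? (u ~? v)) (∈ₚ.∈-allFin v) u≁v) , ~-refl

  size≤2*outside∸1 : ∀ {u a b} → ¬ u ~ a → a ≢ b → a ~ b → size G + 2 ≤ 2 * length (outside u)
  size≤2*outside∸1 {u} {a} {b} u≁a a≢b a~b = ℕₚ.≤-trans
    (ℕₚ.+-monoˡ-≤ 2 (size≤2*representatives u R covers))
    (subst (_≤ 2 * length (outside u)) (trans (ℕₚ.*-suc 2 (length R)) (ℕₚ.+-comm 2 _))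
      (ℕₚ.*-monoʳ-≤ 2 ∣R∣<))
    where
    keep? : ∀ v → Dec (¬ u ~ v × v ≢ a)
    keep? v = ¬? (u ~? v) ×-dec ¬? (v Finₚ.≟ a)

    R = filter keep? (allFin (order G))

    ∣R∣< : length R < length (outside u)
    ∣R∣< = begin-strict
      length R                                  ≡⟨ length-filter-tabulate keep? id ⟩
      sum (𝟙 ∘ keep?)                           <⟨ ℕₚ.n<1+n _ ⟩
      1 + sum (𝟙 ∘ keep?)                       ≡⟨ cong (_+ sum (𝟙 ∘ keep?)) at-a ⟨
      sum (λ v → 𝟙 (v Finₚ.≟ a)) + sum (𝟙 ∘ keep?) ≡⟨ ∑-distrib-+ (λ v → 𝟙 (v Finₚ.≟ a)) (𝟙 ∘ keep?) ⟨
      sum (λ v → 𝟙 (v Finₚ.≟ a) + 𝟙 (keep? v))  ≤⟨ ∑-mono pointwise ⟩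
      sum (λ v → 𝟙 (¬? (u ~? v)))               ≡⟨ length-filter-tabulate (λ v → ¬? (u ~? v)) id ⟨
      length (outside u)                        ∎
      where
      open ℕₚ.≤-Reasoning
      at-a : sum (λ v → 𝟙 (v Finₚ.≟ a)) ≡ 1
      at-a = trans (∑-single (λ v → 𝟙 (v Finₚ.≟ a)) a (λ v → 𝟙-no (v Finₚ.≟ a)))
        (𝟙-yes (a Finₚ.≟ a) refl)

      pointwise : ∀ v → 𝟙 (v Finₚ.≟ a) + 𝟙 (keep? v) ≤ 𝟙 (¬? (u ~? v))
      pointwise v = split (v Finₚ.≟ a)
        where
        split : (v≟a : Dec (v ≡ a)) → 𝟙 v≟a + 𝟙 (keep? v) ≤ 𝟙 (¬? (u ~? v))
        split (yes refl) = subst₂ (λ x y → 1 + x ≤ y) (sym (𝟙-no (keep? v) λ (_ , a≢a) → a≢a refl))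
          (sym (𝟙-yes (¬? (u ~? v)) u≁a)) ℕₚ.≤-refl
        split (no v≢a) = ℕₚ.≤-reflexive (𝟙-cong (keep? v) (¬? (u ~? v)) proj₁ (_, v≢a))

    covers : ∀ v → ∃ λ x → x ∈ u ∷ R × v ~ x
    covers v with u ~? v | v Finₚ.≟ a
    ... | yes u~v | _        = u , here refl , ~-sym u~v
    ... | no u≁v  | no v≢a   = v , there (∈ₚ.∈-filter⁺ keep? (∈ₚ.∈-allFin v) (u≁v , v≢a)) , ~-refl
    ... | no u≁v  | yes refl = b , there (∈ₚ.∈-filter⁺ keep? (∈ₚ.∈-allFin b)
        ((λ u~b → u≁a (~-trans u~b (~-sym a~b))) , a≢b ∘ sym)) , a~b

-- Sums of minima

∑∑-const : ∀ n c → sum {n} (λ _ → sum {n} λ _ → c) ≡ n * (n * c)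
∑∑-const n c = trans (sum-cong-≗ {n} λ _ → ∑-const n c) (∑-const n (n * c))

pairSum-2+ : ∀ {n} (s : Fin n → Fin n → ℕ) → (∀ u v → s u v ≡ s v u) →
  2 * pairSum (λ u v → 2 + s u v) + (n * 2 + sum (λ u → s u u)) ≡ n * (n * 2) + sum (λ u → sum (s u))
pairSum-2+ {n} s s-sym = begin
  2 * pairSum (λ u v → 2 + s u v) + (n * 2 + sum (λ u → s u u))
    ≡⟨ cong (2 * pairSum (λ u v → 2 + s u v) +_)
      (trans (cong (_+ sum (λ u → s u u)) (sym (∑-const n 2)))
         (sym (∑-distrib-+ (λ _ → 2) (λ u → s u u)))) ⟩
  2 * pairSum (λ u v → 2 + s u v) + sum (λ u → 2 + s u u)
    ≡⟨ 2*pairSum+diagonal (λ u v → 2 + s u v) (λ u v → cong (2 +_) (s-sym u v)) ⟩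
  sum (λ u → sum λ v → 2 + s u v)
    ≡⟨ ∑∑-distrib-+ (λ _ _ → 2) s ⟩
  sum {n} (λ _ → sum {n} λ _ → 2) + sum (λ u → sum (s u))
    ≡⟨ cong (_+ sum (λ u → sum (s u))) (∑∑-const n 2) ⟩
  n * (n * 2) + sum (λ u → sum (s u)) ∎
  where open ≡-Reasoning

2*⊓≤+ : ∀ x y → 2 * (x ⊓ y) ≤ x + y
2*⊓≤+ x y = ℕₚ.+-mono-≤ (ℕₚ.m⊓n≤m x y) (ℕₚ.≤-trans (ℕₚ.≤-reflexive (ℕₚ.+-identityʳ _)) (ℕₚ.m⊓n≤n x y))

∑∑-⊓≤ : ∀ {n} (s : Fin n → Fin n → ℕ) (x : Fin n → ℕ) p → (∀ u v → s u v ≡ s v u) →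
  (∀ u → sum (s u) ≤ p) →
  sum (λ u → sum λ v → s u v * (x u ⊓ x v)) ≤ p * sum x
∑∑-⊓≤ s x p s-sym row≤p = ℕₚ.*-cancelˡ-≤ 2 (begin
  2 * sum (λ u → sum λ v → s u v * (x u ⊓ x v))
    ≡⟨ trans (*-distribˡ-sum 2 (λ u → sum λ v → s u v * (x u ⊓ x v)))
         (sum-cong-≗ λ u → *-distribˡ-sum 2 (λ v → s u v * (x u ⊓ x v))) ⟩
  sum (λ u → sum λ v → 2 * (s u v * (x u ⊓ x v)))
    ≤⟨ ∑-mono (λ u → ∑-mono λ v → ℕₚ.≤-trans (ℕₚ.≤-reflexive (swap-factors (s u v) (x u ⊓ x v)))
         (ℕₚ.≤-trans (ℕₚ.*-monoʳ-≤ (s u v) (2*⊓≤+ (x u) (x v)))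
           (ℕₚ.≤-reflexive (expand (s u v) (x u) (x v))))) ⟩
  sum (λ u → sum λ v → x u * s u v + x v * s u v)
    ≡⟨ ∑∑-distrib-+ (λ u v → x u * s u v) (λ u v → x v * s u v) ⟩
  sum (λ u → sum λ v → x u * s u v) + sum (λ u → sum λ v → x v * s u v)
    ≡⟨ cong (sum (λ u → sum λ v → x u * s u v) +_)
         (trans (∑-comm (λ u v → x v * s u v))
           (sum-cong-≗ λ v → sum-cong-≗ λ u → cong (x v *_) (s-sym u v))) ⟩
  sum (λ u → sum λ v → x u * s u v) + sum (λ u → sum λ v → x u * s u v)
    ≤⟨ ℕₚ.+-mono-≤ half half ⟩
  p * sum x + p * sum x
    ≡⟨ cong (p * sum x +_) (ℕₚ.+-identityʳ _) ⟨
  2 * (p * sum x) ∎)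
  where
  open ℕₚ.≤-Reasoning
  swap-factors : ∀ c m → 2 * (c * m) ≡ c * (2 * m)
  swap-factors = solve-∀

  expand : ∀ c y z → c * (y + z) ≡ y * c + z * c
  expand = solve-∀

  half : sum (λ u → sum λ v → x u * s u v) ≤ p * sum x
  half = subst (sum (λ u → sum λ v → x u * s u v) ≤_) (sym (*-distribˡ-sum p x)) (∑-mono λ u →
    ℕₚ.≤-trans (ℕₚ.≤-reflexive (sym (*-distribˡ-sum (x u) (s u))))
      (ℕₚ.≤-trans (ℕₚ.*-monoʳ-≤ (x u) (row≤p u)) (ℕₚ.≤-reflexive (ℕₚ.*-comm (x u) p))))

-- The position of x relative to the threshold between q and q + 1, for a vertex
-- inside (χ = 1) or outside (χ = 0) the set under consideration.
data Level (q : ℕ) : (χ x : ℕ) → Set where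
  ignored : ∀ {x} → Level q 0 x
  above   : ∀ α → Level q 1 (suc (q + α))
  below   : ∀ {x} β → x + β ≡ q → Level q 1 x

level : ∀ {A : Set} q (a? : Dec A) x → Level q (𝟙 a?) x
level q (no _) x = ignored
level q (yes _) x with x ℕₚ.≤? q
... | yes x≤q = below (q ∸ x) (ℕₚ.m+[n∸m]≡n x≤q)
... | no x≰q  = subst (Level q 1) (ℕₚ.m+[n∸m]≡n (ℕₚ.≰⇒> x≰q)) (above (x ∸ suc q))

module _ {q : ℕ} where

  #above #below excess deficit : ∀ {χ x} → Level q χ x → ℕ
  #above ignored     = 0
  #above (above _)   = 1
  #above (below _ _) = 0
  #below ignored     = 0
  #below (above _)   = 0
  #below (below _ _) = 1
  excess ignored     = 0
  excess (above α)   = α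
  excess (below _ _) = 0
  deficit ignored     = 0
  deficit (above _)   = 0
  deficit (below β _) = β

  level-count : ∀ {χ x} (l : Level q χ x) → χ ≡ #above l + #below l
  level-count ignored     = refl
  level-count (above _)   = refl
  level-count (below _ _) = refl

  level-value : ∀ {χ x} (l : Level q χ x) → χ * x + deficit l ≡ q * χ + (#above l + excess l)
  level-value ignored = cong (_+ 0) (sym (ℕₚ.*-zeroʳ q))
  level-value (above α) = identity q α
    where
    identity : ∀ q α → 1 * suc (q + α) + 0 ≡ q * 1 + (1 + α)
    identity = solve-∀
  level-value (below {x} β refl) = identity x β
    where
    identity : ∀ x β → 1 * x + β ≡ (x + β) * 1 + 0
    identity = solve-∀

  gap : ∀ {χ x χ′ x′} → Level q χ x → Level q χ′ x′ → ℕ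
  gap l l′ = #above l * #below l′ + (excess l * #below l′ + #above l * deficit l′)

  ⊓-gap : ∀ {χ x χ′ x′} (l : Level q χ x) (l′ : Level q χ′ x′) →
    2 * (χ * χ′ * (x ⊓ x′)) + (gap l l′ + gap l′ l) ≤ χ * x * χ′ + χ * (χ′ * x′)
  ⊓-gap ignored     ignored     = z≤n
  ⊓-gap ignored     (above α) rewrite ℕₚ.*-zeroʳ α = z≤n
  ⊓-gap ignored     (below _ _) = z≤n
  ⊓-gap (above α)   ignored   rewrite ℕₚ.*-zeroʳ α = z≤n
  ⊓-gap (below _ _) ignored     = z≤n
  ⊓-gap {x = x} {x′ = x′} (above α) (above α′) = subst₂ _≤_ (identityˡ (x ⊓ x′) α α′)
    (identityʳ x x′) (2*⊓≤+ x x′)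
    where
    identityˡ : ∀ m α α′ → 2 * m ≡ 2 * (1 * m) + ((0 + (α * 0 + 0)) + (0 + (α′ * 0 + 0)))
    identityˡ = solve-∀
    identityʳ : ∀ y z → y + z ≡ 1 * y * 1 + 1 * (1 * z)
    identityʳ = solve-∀
  ⊓-gap {x = x} {x′ = x′} (below β _) (below β′ _) = subst₂ _≤_ (identityˡ (x ⊓ x′))
    (identityʳ x x′) (2*⊓≤+ x x′)
    where
    identityˡ : ∀ m → 2 * m ≡ 2 * (1 * m) + 0
    identityˡ = solve-∀
    identityʳ : ∀ y z → y + z ≡ 1 * y * 1 + 1 * (1 * z)
    identityʳ = solve-∀
  ⊓-gap {x = x} {x′ = x′} (above α) (below β refl) = ℕₚ.≤-trans
    (ℕₚ.+-monoˡ-≤ _ (ℕₚ.*-monoʳ-≤ 2 (ℕₚ.*-monoʳ-≤ 1 (ℕₚ.m⊓n≤n x x′))))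
      (ℕₚ.≤-reflexive (identity x′ α β))
    where
    identity : ∀ y α β → 2 * (1 * y) + (1 + (α * 1 + 1 * β) + 0) ≡ 1 * suc (y + β + α) * 1 + 1 * (1 * y)
    identity = solve-∀
  ⊓-gap {x = x} {x′ = x′} (below β refl) (above α) = ℕₚ.≤-trans
    (ℕₚ.+-monoˡ-≤ _ (ℕₚ.*-monoʳ-≤ 2 (ℕₚ.*-monoʳ-≤ 1 (ℕₚ.m⊓n≤m x x′)))) (ℕₚ.≤-reflexive (identity x α β))
    where
    identity : ∀ y α β → 2 * (1 * y) + (0 + (1 + (α * 1 + 1 * β))) ≡ 1 * y * 1 + 1 *
      (1 * suc (y + β + α))
    identity = solve-∀

  level-tight : ∀ {x} (l : Level q 1 x) → excess l ≡ 0 → deficit l ≡ 0 → q ≤ x × x ≤ suc q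
  level-tight (above _)      refl _    = ℕₚ.m≤n⇒m≤1+n (ℕₚ.m≤m+n q 0) , ℕₚ.≤-reflexive
    (cong suc (ℕₚ.+-identityʳ q))
  level-tight (below {x} _ refl) _ refl = ℕₚ.≤-reflexive (ℕₚ.+-identityʳ x) , ℕₚ.m≤n⇒m≤1+n
    (ℕₚ.m≤m+n x 0)

record Threshold (p X Q q : ℕ) (Near : Set) : Set where
  field
    a b α β   : ℕ
    card≡     : p ≡ a + b
    weight≡   : X + β ≡ q * p + (a + α)
    minSum≤   : Q + (a * b + (α * b + a * β)) ≤ p * X
    tight     : α ≡ 0 → β ≡ 0 → Near

module _ {n} {C : Pred (Fin n) 0ℓ} (C? : Decidable C) (x : Fin n → ℕ) where

  card weight minSum : ℕ
  card   = sum λ u → 𝟙 (C? u)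
  weight = sum λ u → 𝟙 (C? u) * x u
  minSum = sum λ u → sum λ v → 𝟙 (C? u) * 𝟙 (C? v) * (x u ⊓ x v)

  threshold : ∀ q → Threshold card weight minSum q (∀ u → C u → q ≤ x u × x u ≤ suc q)
  threshold q = record
    { a = sum (#above ∘ l) ; b = sum (#below ∘ l) ; α = sum (excess ∘ l) ; β = sum (deficit ∘ l)
    ; card≡ = trans (sum-cong-≗ (level-count ∘ l)) (∑-distrib-+ (#above ∘ l) (#below ∘ l))
    ; weight≡ = begin
        weight + sum (deficit ∘ l)
          ≡⟨ ∑-distrib-+ (λ u → 𝟙 (C? u) * x u) (deficit ∘ l) ⟨
        sum (λ u → 𝟙 (C? u) * x u + deficit (l u))
          ≡⟨ sum-cong-≗ (level-value ∘ l) ⟩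
        sum (λ u → q * 𝟙 (C? u) + (#above (l u) + excess (l u)))
          ≡⟨ ∑-distrib-+ (λ u → q * 𝟙 (C? u)) (λ u → #above (l u) + excess (l u)) ⟩
        sum (λ u → q * 𝟙 (C? u)) + sum (λ u → #above (l u) + excess (l u))
          ≡⟨ cong₂ _+_ (sym (*-distribˡ-sum q (𝟙 ∘ C?))) (∑-distrib-+ (#above ∘ l) (excess ∘ l)) ⟩
        q * card + (sum (#above ∘ l) + sum (excess ∘ l)) ∎
    ; minSum≤ = ℕₚ.*-cancelˡ-≤ 2 doubled
    ; tight = λ α≡0 β≡0 u u∈C → level-tight (subst (λ χ → Level q χ (x u)) (𝟙-yes (C? u) u∈C) (l u))
        (trans (excess-subst (𝟙-yes (C? u) u∈C) (l u)) (∑≡0⇒ (excess ∘ l) α≡0 u))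
        (trans (deficit-subst (𝟙-yes (C? u) u∈C) (l u)) (∑≡0⇒ (deficit ∘ l) β≡0 u))
    }
    where
    open ≡-Reasoning
    l : ∀ u → Level q (𝟙 (C? u)) (x u)
    l u = level q (C? u) (x u)

    excess-subst : ∀ {χ χ′ y} (eq : χ ≡ χ′) (l : Level q χ y) → excess
      (subst (λ χ → Level q χ y) eq l) ≡ excess l
    excess-subst refl l = refl

    deficit-subst : ∀ {χ χ′ y} (eq : χ ≡ χ′) (l : Level q χ y) → deficit
      (subst (λ χ → Level q χ y) eq l) ≡ deficit l
    deficit-subst refl l = refl

    gaps : ℕ
    gaps = sum (#above ∘ l) * sum (#below ∘ l) +
           (sum (excess ∘ l) * sum (#below ∘ l) + sum (#above ∘ l) * sum (deficit ∘ l))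

    ∑gap : sum (λ u → sum λ v → gap (l u) (l v)) ≡ gaps
    ∑gap = trans (∑∑-distrib-+ (λ u v → #above (l u) * #below (l v)) _)
      (cong₂ _+_ (∑-product (#above ∘ l) (#below ∘ l))
        (trans (∑∑-distrib-+ (λ u v → excess (l u) * #below (l v))
          (λ u v → #above (l u) * deficit (l v)))
          (cong₂ _+_ (∑-product (excess ∘ l) (#below ∘ l)) (∑-product (#above ∘ l) (deficit ∘ l)))))

    doubled : 2 * (minSum + gaps) ≤ 2 * (card * weight)
    doubled = subst₂ _≤_ lhs rhs (∑-mono λ u → ∑-mono λ v → ⊓-gap (l u) (l v))
      where
      M : Fin n → Fin n → ℕ
      M u v = 𝟙 (C? u) * 𝟙 (C? v) * (x u ⊓ x v)

      lhs : sum (λ u → sum λ v → 2 * M u v + (gap (l u) (l v) + gap (l v) (l u))) ≡ 2 * (minSum + gaps)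
      lhs = begin
        sum (λ u → sum λ v → 2 * M u v + (gap (l u) (l v) + gap (l v) (l u)))
          ≡⟨ ∑∑-distrib-+ (λ u v → 2 * M u v) (λ u v → gap (l u) (l v) + gap (l v) (l u)) ⟩
        sum (λ u → sum λ v → 2 * M u v) + sum (λ u → sum λ v → gap (l u) (l v) + gap (l v) (l u))
          ≡⟨ cong₂ _+_
               (sym (trans (*-distribˡ-sum 2 (λ u → sum (M u)))
                 (sum-cong-≗ λ u → *-distribˡ-sum 2 (M u))))
               (trans (∑∑-distrib-+ (λ u v → gap (l u) (l v)) (λ u v → gap (l v) (l u)))
                 (cong₂ _+_ ∑gap (trans (∑-comm (λ u v → gap (l v) (l u))) ∑gap))) ⟩
        2 * minSum + (gaps + gaps)
          ≡⟨ regroup minSum gaps ⟩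
        2 * (minSum + gaps) ∎
        where
        regroup : ∀ m g → 2 * m + (g + g) ≡ 2 * (m + g)
        regroup = solve-∀

      rhs : sum (λ u → sum λ v → 𝟙 (C? u) * x u * 𝟙 (C? v) + 𝟙 (C? u) * (𝟙 (C? v) * x v)) ≡ 2 *
        (card * weight)
      rhs = begin
        sum (λ u → sum λ v → 𝟙 (C? u) * x u * 𝟙 (C? v) + 𝟙 (C? u) * (𝟙 (C? v) * x v))
          ≡⟨ ∑∑-distrib-+ (λ u v → 𝟙 (C? u) * x u * 𝟙 (C? v)) (λ u v → 𝟙 (C? u) * (𝟙 (C? v) * x v)) ⟩
        _ ≡⟨ cong₂ _+_ (∑-product (λ u → 𝟙 (C? u) * x u) (𝟙 ∘ C?))
          (∑-product (𝟙 ∘ C?) (λ v → 𝟙 (C? v) * x v)) ⟩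
        weight * card + card * weight
          ≡⟨ regroup weight card ⟩
        2 * (card * weight) ∎
        where
        regroup : ∀ w c → w * c + c * w ≡ 2 * (c * w)
        regroup = solve-∀

-- The extremal problem for sums of minima

-- The inequality l ≤ r as the hypothesis a ≤ b plus a slack c, with both sides
-- moved so that no subtraction occurs (it is then a semiring identity).
≤-certificate : ∀ {a b l r} c → a ≤ b → l + b + c ≡ r + a → l ≤ r
≤-certificate {a} {b} {l} {r} c a≤b eq = ℕₚ.+-cancelʳ-≤ b l r
  (ℕₚ.≤-trans (ℕₚ.m≤m+n (l + b) c) (ℕₚ.≤-trans (ℕₚ.≤-reflexive eq) (ℕₚ.+-monoʳ-≤ r a≤b)))

infixl 6 _⊕_
infixr 6.5 _⊗_

_⊕_ : ∀ {a b c d} → a ≤ b → c ≤ d → a + c ≤ b + d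
_⊕_ = ℕₚ.+-mono-≤

_⊗_ : ∀ c {a b} → a ≤ b → c * a ≤ c * b
c ⊗ a≤b = ℕₚ.*-monoʳ-≤ c a≤b

square-mono : ∀ {m n} → m ≤ n → m * m + n ≤ n * n + m
square-mono {m} m≤n with ℕₚ.m≤n⇒∃[o]m+o≡n m≤n
... | zero  , refl = ℕₚ.≤-reflexive (solve (m ∷ []))
... | suc o , refl = ≤-certificate (2 * m * suc o + o * suc o) (ℕₚ.≤-refl {0}) (solve (m ∷ o ∷ []))

square-mono-< : ∀ {m n} → 2 ≤ n → m < n → m * m + n < n * n + m
square-mono-< {zero} {suc (suc n)} _ _ = ≤-certificate (1 + 3 * n + n * n) (ℕₚ.≤-refl {0})
  (solve (n ∷ []))
square-mono-< {zero} {suc zero} (s≤s ()) _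
square-mono-< {suc m} _ m<n with ℕₚ.m≤n⇒∃[o]m+o≡n m<n
... | o , refl = ≤-certificate (2 * m + 1 + o * o + 2 * m * o + 3 * o) (ℕₚ.≤-refl {0})
    (solve (m ∷ o ∷ []))

m+n≤2w⇒m*n≤w*w : ∀ m n w → m + n ≤ 2 * w → m * n ≤ w * w
m+n≤2w⇒m*n≤w*w m n w m+n≤2w with ℕₚ.≤-total m w
... | inj₁ m≤w with ℕₚ.m≤n⇒∃[o]m+o≡n m≤w
...   | d , refl = ℕₚ.≤-trans (ℕₚ.*-monoʳ-≤ m n≤m+2d)
          difference-of-squares
  where
  difference-of-squares : m * (m + 2 * d) ≤ (m + d) * (m + d)
  difference-of-squares = ≤-certificate (d * d) (ℕₚ.≤-refl {0}) (solve (m ∷ d ∷ []))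

  n≤m+2d : n ≤ m + 2 * d
  n≤m+2d = ≤-certificate 0 m+n≤2w (solve (m ∷ n ∷ d ∷ []))
m+n≤2w⇒m*n≤w*w m n w m+n≤2w | inj₂ w≤m with ℕₚ.m≤n⇒∃[o]m+o≡n w≤m
...   | d , refl with ℕₚ.m≤n⇒∃[o]m+o≡n (n+d≤w)
  where
  n+d≤w : n + d ≤ w
  n+d≤w = ≤-certificate 0 m+n≤2w (solve (w ∷ n ∷ d ∷ []))
...     | e , refl = ≤-certificate (n * e + (d + e) * (d + e)) (ℕₚ.≤-refl {0}) (solve (n ∷ d ∷ e ∷ []))

record Extremal (p X Q : ℕ) : Set where
  field
    smooth : Q ≤ p * X
    ceiling  : ∀ q s → X ≤ q * p + s → Q + (s + q * p) ≤ X + (q * p * p + s * s)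
    slack  : ∀ q s → 2 ≤ s → X < q * p + s → Q + (s + q * p) < X + (q * p * p + s * s)

module Extremality {p X Q : ℕ} {Near : ℕ → Set} (threshold : ∀ q → Threshold p X Q q (Near q)) where

  private
    minSum≤card*weight : Q ≤ p * X
    minSum≤card*weight = ℕₚ.≤-trans (ℕₚ.m≤m+n Q _) (Threshold.minSum≤ (threshold 0))

    below-threshold : ∀ q → X ≤ q * p → Q + q * p ≤ X + q * p * p
    below-threshold q X≤qp = go p X≤qp minSum≤card*weight
      where
      go : ∀ p → X ≤ q * p → Q ≤ p * X → Q + q * p ≤ X + q * p * p
      go zero    X≤qp Q≤pX = ≤-certificate X Q≤pX (solve (X ∷ Q ∷ q ∷ []))
      go (suc p) X≤qp Q≤pX = ≤-certificate 0 (Q≤pX ⊕ p ⊗ X≤qp) (solve (X ∷ Q ∷ q ∷ p ∷ []))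

    cancel-deficit : ∀ c σ β a δ → c + σ + β ≡ c + (a + (β + δ)) → σ ≡ a + δ
    cancel-deficit c σ β a δ eq = ℕₚ.+-cancelˡ-≡ (c + β) σ (a + δ)
      (trans (left c σ β) (trans eq (right c a β δ)))
      where
      left : ∀ c σ β → c + β + σ ≡ c + σ + β
      left = solve-∀
      right : ∀ c a β δ → c + (a + (β + δ)) ≡ c + β + (a + δ)
      right = solve-∀

    cancel-excess : ∀ c σ α a δ → c + σ + (α + δ) ≡ c + (a + α) → σ + δ ≡ a
    cancel-excess c σ α a δ eq = ℕₚ.+-cancelˡ-≡ (c + α) (σ + δ) a
      (trans (left c σ α δ) (trans eq (right c a α)))
      where
      left : ∀ c σ α δ → c + α + (σ + δ) ≡ c + σ + (α + δ)
      left = solve-∀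
      right : ∀ c a α → c + (a + α) ≡ c + α + a
      right = solve-∀

  -- Since A = {x > q} and B = {x ≤ q} have a and b elements, the sum of |x u - x v| over
  -- unordered pairs is at least ab + bα + aβ, which exceeds σ (p - σ) by aα + bβ + (α - β)².
  above-threshold : ∀ q σ → X ≡ q * p + σ → let open Threshold (threshold q) in
    ∃ λ δ → (α ≡ β + δ ⊎ β ≡ α + δ) ×
      Q + (σ + q * p) + (a * α + b * β + δ * δ) ≤ X + (q * p * p + σ * σ)
  above-threshold q σ X≡ = go p X card≡ X≡ weight≡ minSum≤
    where
    open Threshold (threshold q)
    go : ∀ {a b α β} p X → p ≡ a + b → X ≡ q * p + σ → X + β ≡ q * p + (a + α) →
      Q + (a * b + (α * b + a * β)) ≤ p * X →
      ∃ λ δ → (α ≡ β + δ ⊎ β ≡ α + δ) × Q + (σ + q * p) + (a * α + b * β + δ * δ) ≤ X +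
        (q * p * p + σ * σ)
    go {a} {b} {α} {β} _ _ refl refl weight≡ minSum≤ with ℕₚ.≤-total β α
    ... | inj₁ β≤α with ℕₚ.m≤n⇒∃[o]m+o≡n β≤α
    ...   | δ , refl with cancel-deficit (q * (a + b)) σ β a δ weight≡
    ...     | refl = δ , inj₁ refl , ≤-certificate 0 minSum≤ (solve (Q ∷ q ∷ a ∷ b ∷ β ∷ δ ∷ []))
    go {a} {b} {α} {β} _ _ refl refl weight≡ minSum≤ | inj₂ α≤β with ℕₚ.m≤n⇒∃[o]m+o≡n α≤β
    ...   | δ , refl with cancel-excess (q * (a + b)) σ α a δ weight≡
    ...     | refl = δ , inj₂ refl , ≤-certificate 0 minSum≤ (solve (Q ∷ q ∷ σ ∷ b ∷ α ∷ δ ∷ []))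

  private
    above-threshold-≤ : ∀ q σ → X ≡ q * p + σ → Q + (σ + q * p) ≤ X + (q * p * p + σ * σ)
    above-threshold-≤ q σ X≡ = ℕₚ.≤-trans (ℕₚ.m≤m+n _ _) (proj₂ (proj₂ (above-threshold q σ X≡)))

    n≤n*n : ∀ n → n ≤ n * n
    n≤n*n zero    = z≤n
    n≤n*n (suc n) = ℕₚ.m≤m+n (suc n) _

    n<n*n : ∀ {n} → 2 ≤ n → n < n * n
    n<n*n {suc (suc n)} _ = ≤-certificate (1 + 3 * n + n * n) (ℕₚ.≤-refl {0}) (solve (n ∷ []))
    n<n*n {suc zero} (s≤s ())

  extremal : Extremal p X Q
  extremal = record { smooth = minSum≤card*weight ; ceiling = ceiling ; slack = slack }
    where
    ceiling : ∀ q s → X ≤ q * p + s → Q + (s + q * p) ≤ X + (q * p * p + s * s)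
    ceiling q s X≤ with ℕₚ.≤-total X (q * p)
    ... | inj₁ X≤qp = ≤-certificate 0 (below-threshold q X≤qp ⊕ n≤n*n s)
        (solve (Q ∷ X ∷ p ∷ q ∷ s ∷ []))
    ... | inj₂ qp≤X with ℕₚ.m≤n⇒∃[o]m+o≡n qp≤X
    ...   | σ , eq = ≤-certificate 0
      (above-threshold-≤ q σ (sym eq) ⊕ square-mono
        (ℕₚ.+-cancelˡ-≤ (q * p) σ s (subst (_≤ q * p + s) (sym eq) X≤)))
      (solve (Q ∷ X ∷ p ∷ q ∷ s ∷ σ ∷ []))

    slack : ∀ q s → 2 ≤ s → X < q * p + s → Q + (s + q * p) < X + (q * p * p + s * s)
    slack q s 2≤s X< with ℕₚ.≤-total X (q * p)
    ... | inj₁ X≤qp = ≤-certificate 0 (below-threshold q X≤qp ⊕ n<n*n 2≤s)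
        (solve (Q ∷ X ∷ p ∷ q ∷ s ∷ []))
    ... | inj₂ qp≤X with ℕₚ.m≤n⇒∃[o]m+o≡n qp≤X
    ...   | σ , eq = ≤-certificate 0
      (above-threshold-≤ q σ (sym eq) ⊕ square-mono-< 2≤s
        (ℕₚ.+-cancelˡ-< (q * p) σ s (subst (_< q * p + s) (sym eq) X<)))
      (solve (Q ∷ X ∷ p ∷ q ∷ s ∷ σ ∷ []))

  extremal⇒near : ∀ q s → 1 ≤ p → X ≡ q * p + s → X + (q * p * p + s * s) ≤ Q + (s + q * p) → Near q
  extremal⇒near q s 1≤p X≡ max with above-threshold q s X≡
  ... | δ , α≷β , ineq = tight (proj₁ zeros) (proj₂ zeros)
    where
    open Threshold (threshold q)
    positive : 1 ≤ a + b
    positive = subst (1 ≤_) card≡ 1≤p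

    residue≡0 : a * α + b * β + δ * δ ≡ 0
    residue≡0 = ℕₚ.n≤0⇒n≡0 (ℕₚ.+-cancelˡ-≤ (Q + (s + q * p)) _ 0
      (ℕₚ.≤-trans ineq (ℕₚ.≤-trans max (ℕₚ.≤-reflexive (sym (ℕₚ.+-identityʳ _))))))

    vanish : ∀ a b α β → 1 ≤ a + b → (α ≡ β + δ ⊎ β ≡ α + δ) → a * α + b * β + δ * δ ≡ 0 → α ≡ 0 × β ≡ 0
    vanish a b α β pos α≷β eq with ℕₚ.m*n≡0⇒m≡0∨n≡0 δ (ℕₚ.m+n≡0⇒n≡0 (a * α + b * β) eq)
    ... | δ≡0 = equal-vanish a b α β pos (α≡β (Sum.reduce δ≡0) α≷β) (ℕₚ.m+n≡0⇒m≡0 (a * α + b * β) eq)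
      where
      α≡β : δ ≡ 0 → (α ≡ β + δ ⊎ β ≡ α + δ) → α ≡ β
      α≡β refl (inj₁ eq) = trans eq (ℕₚ.+-identityʳ β)
      α≡β refl (inj₂ eq) = sym (trans eq (ℕₚ.+-identityʳ α))

      equal-vanish : ∀ a b α β → 1 ≤ a + b → α ≡ β → a * α + b * β ≡ 0 → α ≡ 0 × β ≡ 0
      equal-vanish (suc a) b       α α _ refl eq with ℕₚ.m+n≡0⇒m≡0 α (ℕₚ.m+n≡0⇒m≡0 (suc a * α) eq)
      ... | refl = refl , refl
      equal-vanish zero    (suc b) α α _ refl eq with ℕₚ.m+n≡0⇒m≡0 α eq
      ... | refl = refl , refl

    zeros : α ≡ 0 × β ≡ 0
    zeros = vanish a b α β positive α≷β residue≡0

module _ {p X Q : ℕ} (E : Extremal (suc p) X Q) where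
  open Extremal E

  smooth-bound : ∀ w → X + 4 * suc p ≤ w → Q + p * (X + 4 * suc p) ≤ suc p * X + p * w
  smooth-bound w X≤ = smooth ⊕ p ⊗ X≤

-- The claimed maximum of Q - X, which is twice the excess over connectivity 2, is τ - 4 k.
-- Good p q s: the extremal configurations have p vertices and weight q p + s.
data Outcome (Good : ℕ → ℕ → ℕ → Set) (k τ p X Q : ℕ) : Set where
  strict : Q + 4 * k < X + τ → Outcome Good k τ p X Q
  exact  : ∀ q s → Good p q s → X ≡ q * p + s → τ + (s + q * p) ≡ q * p * p + s * s + 4 * k →
    Outcome Good k τ p X Q

outcome⇒≤ : ∀ {Good k τ p X Q} → Extremal p X Q → Outcome Good k τ p X Q → Q + 4 * k ≤ X + τ
outcome⇒≤ E (strict lt) = ℕₚ.<⇒≤ lt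
outcome⇒≤ {k = k} {τ} {p} {X} {Q} E (exact q s _ X≡ value) =
  ≤-certificate 0 (Extremal.ceiling E q s (ℕₚ.≤-reflexive X≡) ⊕ ℕₚ.≤-reflexive (sym value))
    (solve (Q ∷ X ∷ q ∷ s ∷ p ∷ k ∷ τ ∷ []))

exact-or-slack : ∀ {Good k τ p X Q} → Extremal p X Q → ∀ q s → 2 ≤ s → Good p q s → X ≤ q * p + s →
  τ + (s + q * p) ≡ q * p * p + s * s + 4 * k → Outcome Good k τ p X Q
exact-or-slack {k = k} {τ} {p} {X} {Q} E q s 2≤s good X≤ value with ℕₚ.m≤n⇒m<n∨m≡n X≤
... | inj₁ X< = strict (≤-certificate 0 (Extremal.slack E q s 2≤s X< ⊕ ℕₚ.≤-reflexive (sym value))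
                  (solve (Q ∷ X ∷ q ∷ s ∷ p ∷ k ∷ τ ∷ [])))
... | inj₂ X≡ = exact q s good X≡ value

Good₀ Good₁ Good₂ Good₃ : ℕ → ℕ → ℕ → ℕ → Set
Good₀ k p q s = p ≡ k × q ≡ 4 × s ≡ 0
Good₁ k p q s = p ≡ k × q ≡ 4 × s ≡ 2
Good₂ k p q s = (p ≡ k × q ≡ 4 × s ≡ 4) ⊎ (p ≡ k + 1 × q ≡ 3 × s + 3 ≡ k)
Good₃ k p q s = p ≡ k + 1 × q ≡ 3 × s + 1 ≡ k

-- i and j measure how far p is from its extremal values. Near means that the ceiling with
-- threshold 3 or 4 suffices: for instance, for n = 4 k + 1 and p = k - i it falls short of the
-- claimed maximum by 4 i (2 k - 17 i - 7). Far means that the smooth bound does.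
strict₀-next : ∀ {Good} m {X Q} → Extremal (suc (8 + m + 0)) X Q →
  X + 4 * (suc (8 + m + 0)) ≤ 2 * (4 * (8 + m) + 0) →
  Outcome Good (8 + m) (4 * (8 + m) * (8 + m)) (suc (8 + m + 0)) X Q
strict₀-next m {X} {Q} E X≤ =
  strict (≤-certificate (7 + 8 * m) (Extremal.ceiling E 3 (1 + m)
    (≤-certificate 0 X≤ (solve (X ∷ m ∷ [])))) (solve (Q ∷ X ∷ m ∷ [])))

strict₀-above : ∀ {Good} k i {X Q} → Extremal (suc (k + suc i)) X Q →
  X + 4 * (suc (k + suc i)) ≤ 2 * (4 * k + 0) →
  Outcome Good k (4 * k * k) (suc (k + suc i)) X Q
strict₀-above k i {X} {Q} E X≤ =
  strict (≤-certificate (7 + 12 * i + 4 * i * i) (smooth-bound E _ X≤) (solve (Q ∷ X ∷ k ∷ i ∷ [])))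

strict₀-below : ∀ {Good} p i {X Q} → Extremal (suc p) X Q →
  X + 4 * suc p ≤ 2 * (4 * (suc (suc p + i)) + 0) →
  Outcome Good (suc (suc p + i)) (4 * (suc (suc p + i)) * (suc (suc p + i))) (suc p) X Q
strict₀-below p i {X} {Q} E X≤ =
  strict (≤-certificate (7 + 12 * i + 4 * i * i) (smooth-bound E _ X≤) (solve (Q ∷ X ∷ i ∷ p ∷ [])))

strict₁-above-0 : ∀ {Good} m {X Q} → Extremal (suc (30 + m + 0)) X Q →
  X + 4 * (suc (30 + m + 0)) ≤ 2 * (4 * (30 + m) + 1) →
  Outcome Good (30 + m) (4 * (30 + m) * (30 + m) + 2) (suc (30 + m + 0)) X Q
strict₁-above-0 m {X} {Q} E X≤ =
  strict (≤-certificate (91 + 4 * m) (Extremal.ceiling E 3 (25 + m)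
    (≤-certificate 0 X≤ (solve (X ∷ m ∷ [])))) (solve (Q ∷ X ∷ m ∷ [])))

strict₁-above-1 : ∀ {Good} m {X Q} → Extremal (suc (30 + m + 1)) X Q →
  X + 4 * (suc (30 + m + 1)) ≤ 2 * (4 * (30 + m) + 1) →
  Outcome Good (30 + m) (4 * (30 + m) * (30 + m) + 2) (suc (30 + m + 1)) X Q
strict₁-above-1 m {X} {Q} E X≤ =
  strict (≤-certificate (199 + 12 * m) (Extremal.ceiling E 3 (18 + m)
    (≤-certificate 0 X≤ (solve (X ∷ m ∷ [])))) (solve (Q ∷ X ∷ m ∷ [])))

strict₁-above-2 : ∀ {Good} m {X Q} → Extremal (suc (30 + m + 2)) X Q →
  X + 4 * (suc (30 + m + 2)) ≤ 2 * (4 * (30 + m) + 1) →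
  Outcome Good (30 + m) (4 * (30 + m) * (30 + m) + 2) (suc (30 + m + 2)) X Q
strict₁-above-2 m {X} {Q} E X≤ =
  strict (≤-certificate (203 + 20 * m) (Extremal.ceiling E 3 (11 + m)
    (≤-certificate 0 X≤ (solve (X ∷ m ∷ [])))) (solve (Q ∷ X ∷ m ∷ [])))

strict₁-above-3 : ∀ {Good} m {X Q} → Extremal (suc (30 + m + 3)) X Q →
  X + 4 * (suc (30 + m + 3)) ≤ 2 * (4 * (30 + m) + 1) →
  Outcome Good (30 + m) (4 * (30 + m) * (30 + m) + 2) (suc (30 + m + 3)) X Q
strict₁-above-3 m {X} {Q} E X≤ =
  strict (≤-certificate (103 + 28 * m) (Extremal.ceiling E 3 (4 + m)
    (≤-certificate 0 X≤ (solve (X ∷ m ∷ [])))) (solve (Q ∷ X ∷ m ∷ [])))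

strict₁-above-near : ∀ {Good} j s {X Q} → Extremal (suc (suc (7 * (4 + j) + 4) + s + (4 + j))) X Q →
  X + 4 * (suc (suc (7 * (4 + j) + 4) + s + (4 + j))) ≤ 2 * (4 * (suc (7 * (4 + j) + 4) + s) + 1) →
  Outcome Good (suc (7 * (4 + j) + 4) + s) (4 * (suc (7 * (4 + j) + 4) + s) *
    (suc (7 * (4 + j) + 4) + s) + 2) (suc (suc (7 * (4 + j) + 4) + s + (4 + j))) X Q
strict₁-above-near j s {X} {Q} E X≤ =
  strict (≤-certificate (7 + 20 * j + 36 * s + 4 * j * j + 8 * j * s)
    (Extremal.ceiling E 3 s (≤-certificate 0 X≤ (solve (X ∷ j ∷ s ∷ [])))) (solve (Q ∷ X ∷ j ∷ s ∷ [])))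

strict₁-above-far : ∀ {Good} k j {X Q} → Extremal (suc (k + (4 + j))) X Q →
  X + 4 * (suc (k + (4 + j))) ≤ 2 * (4 * k + 1) →
  k ≤ 7 * (4 + j) + 4 →
  Outcome Good k (4 * k * k + 2) (suc (k + (4 + j))) X Q
strict₁-above-far k j {X} {Q} E X≤ k≤ =
  strict (≤-certificate (9 + 20 * j + 4 * j * j) (smooth-bound E _ X≤ ⊕ 2 ⊗ k≤)
    (solve (Q ∷ X ∷ k ∷ j ∷ [])))

strict₁-below-near : ∀ {Good} p i {X Q} → Extremal p X Q →
  X + 4 * p ≤ 2 * (4 * (suc (p + i)) + 1) →
  17 * suc i + 7 < 2 * suc (p + i) →
  Outcome Good (suc (p + i)) (4 * (suc (p + i)) * (suc (p + i)) + 2) p X Q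
strict₁-below-near p i {X} {Q} E X≤ k≥ =
  strict (≤-certificate (3 + 4 * i) (Extremal.ceiling E 4 (2 + 8 * suc i)
    (≤-certificate 0 X≤ (solve (X ∷ i ∷ p ∷ []))) ⊕ 4 * suc i ⊗ k≥) (solve (Q ∷ X ∷ i ∷ p ∷ [])))

strict₁-below-far : ∀ {Good} p j {X Q} → Extremal (suc p) X Q →
  X + 4 * suc p ≤ 2 * (4 * (suc (suc p + (3 + j))) + 1) →
  2 * suc (suc p + (3 + j)) ≤ 17 * (4 + j) + 7 →
  Outcome Good (suc (suc p + (3 + j))) (4 * (suc (suc p + (3 + j))) * (suc (suc p + (3 + j))) + 2)
    (suc p) X Q
strict₁-below-far p j {X} {Q} E X≤ k≤ =
  strict (≤-certificate (16 + 21 * j + 4 * j * j) (smooth-bound E _ X≤ ⊕ k≤)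
    (solve (Q ∷ X ∷ j ∷ p ∷ [])))

strict₂-above-near : ∀ {Good} i s {X Q} → Extremal (suc (suc (7 * suc i + 2) + s + suc i)) X Q →
  X + 4 * (suc (suc (7 * suc i + 2) + s + suc i)) ≤ 2 * (4 * (suc (7 * suc i + 2) + s) + 2) →
  13 * suc i + 14 ≤ 2 * (suc (7 * suc i + 2) + s) →
  Outcome Good (suc (7 * suc i + 2) + s) (4 * (suc (7 * suc i + 2) + s) *
    (suc (7 * suc i + 2) + s) + 12) (suc (suc (7 * suc i + 2) + s + suc i)) X Q
strict₂-above-near i s {X} {Q} E X≤ k≥ =
  strict (≤-certificate (3 + 4 * i) (Extremal.ceiling E 3 s
    (≤-certificate 0 X≤ (solve (X ∷ i ∷ s ∷ []))) ⊕ 4 * suc i ⊗ k≥) (solve (Q ∷ X ∷ i ∷ s ∷ [])))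

strict₂-above-far : ∀ {Good} k j {X Q} → Extremal (suc (k + suc (9 + j))) X Q →
  X + 4 * (suc (k + suc (9 + j))) ≤ 2 * (4 * k + 2) →
  k ≤ 7 * suc (9 + j) + 2 →
  Outcome Good k (4 * k * k + 12) (suc (k + suc (9 + j))) X Q
strict₂-above-far k j {X} {Q} E X≤ k≤ =
  strict (≤-certificate (123 + 52 * j + 4 * j * j) (smooth-bound E _ X≤ ⊕ 4 ⊗ k≤)
    (solve (Q ∷ X ∷ k ∷ j ∷ [])))

strict₂-below-near : ∀ {Good} p i {X Q} → Extremal p X Q →
  X + 4 * p ≤ 2 * (4 * (suc (p + i)) + 2) →
  17 * suc i + 15 < 2 * suc (p + i) →
  Outcome Good (suc (p + i)) (4 * (suc (p + i)) * (suc (p + i)) + 12) p X Q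
strict₂-below-near p i {X} {Q} E X≤ k≥ =
  strict (≤-certificate (3 + 4 * i) (Extremal.ceiling E 4 (4 + 8 * suc i)
    (≤-certificate 0 X≤ (solve (X ∷ i ∷ p ∷ []))) ⊕ 4 * suc i ⊗ k≥) (solve (Q ∷ X ∷ i ∷ p ∷ [])))

strict₂-below-far : ∀ {Good} p j {X Q} → Extremal (suc p) X Q →
  X + 4 * suc p ≤ 2 * (4 * (suc (suc p + (7 + j))) + 2) →
  2 * suc (suc p + (7 + j)) ≤ 17 * (8 + j) + 15 →
  Outcome Good (suc (suc p + (7 + j))) (4 * (suc (suc p + (7 + j))) * (suc (suc p + (7 + j))) + 12)
    (suc p) X Q
strict₂-below-far p j {X} {Q} E X≤ k≤ =
  strict (≤-certificate (33 + 38 * j + 4 * j * j) (smooth-bound E _ X≤ ⊕ 2 ⊗ k≤)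
    (solve (Q ∷ X ∷ j ∷ p ∷ [])))

strict₃-above-near : ∀ {Good} i s {X Q} → Extremal (suc (suc (suc (7 * suc i) + s) + i)) X Q →
  X + 4 * (suc (suc (suc (7 * suc i) + s) + i)) ≤ 2 * (4 * (suc (7 * suc i) + s) + 3) →
  13 * suc i + 7 ≤ 2 * (suc (7 * suc i) + s) →
  Outcome Good (suc (7 * suc i) + s) (4 * (suc (7 * suc i) + s) * (suc (7 * suc i) + s) + 4 *
    (suc (7 * suc i) + s) + 2) (suc (suc (suc (7 * suc i) + s) + i)) X Q
strict₃-above-near i s {X} {Q} E X≤ k≥ =
  strict (≤-certificate (3 + 4 * i) (Extremal.ceiling E 3 s
    (≤-certificate 0 X≤ (solve (X ∷ i ∷ s ∷ []))) ⊕ 4 * suc i ⊗ k≥) (solve (Q ∷ X ∷ i ∷ s ∷ [])))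

strict₃-above-far : ∀ {Good} k j {X Q} → Extremal (suc (suc k + (4 + j))) X Q →
  X + 4 * (suc (suc k + (4 + j))) ≤ 2 * (4 * k + 3) →
  k ≤ 7 * (5 + j) →
  Outcome Good k (4 * k * k + 4 * k + 2) (suc (suc k + (4 + j))) X Q
strict₃-above-far k j {X} {Q} E X≤ k≤ =
  strict (≤-certificate (21 + 24 * j + 4 * j * j) (smooth-bound E _ X≤ ⊕ 2 ⊗ k≤)
    (solve (Q ∷ X ∷ k ∷ j ∷ [])))

strict₃-below-far : ∀ {Good} p i {X Q} → Extremal (suc p) X Q →
  X + 4 * suc p ≤ 2 * (4 * (suc p + i) + 3) →
  2 * (suc p + i) ≤ 4 * i * i + 10 * i + 7 →
  Outcome Good (suc p + i) (4 * (suc p + i) * (suc p + i) + 4 * (suc p + i) + 2) (suc p) X Q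
strict₃-below-far p i {X} {Q} E X≤ k≤ =
  strict (≤-certificate 0 (smooth-bound E _ X≤ ⊕ k≤) (solve (Q ∷ X ∷ i ∷ p ∷ [])))

strict₃-below-0 : ∀ {Good} p {X Q} → Extremal p X Q →
  X + 4 * p ≤ 2 * (4 * (p + 0) + 3) →
  60 ≤ 2 * (p + 0) →
  Outcome Good (p + 0) (4 * (p + 0) * (p + 0) + 4 * (p + 0) + 2) p X Q
strict₃-below-0 p {X} {Q} E X≤ k≥ =
  strict (≤-certificate 91 (Extremal.ceiling E 4 6 (≤-certificate 0 X≤ (solve (X ∷ p ∷ []))) ⊕
    2 ⊗ k≥) (solve (Q ∷ X ∷ p ∷ [])))

strict₃-below-1 : ∀ {Good} p {X Q} → Extremal p X Q →
  X + 4 * p ≤ 2 * (4 * (p + 1) + 3) →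
  60 ≤ 2 * (p + 1) →
  Outcome Good (p + 1) (4 * (p + 1) * (p + 1) + 4 * (p + 1) + 2) p X Q
strict₃-below-1 p {X} {Q} E X≤ k≥ =
  strict (≤-certificate 171 (Extremal.ceiling E 4 14 (≤-certificate 0 X≤ (solve (X ∷ p ∷ []))) ⊕
    6 ⊗ k≥) (solve (Q ∷ X ∷ p ∷ [])))

strict₃-below-2 : ∀ {Good} p {X Q} → Extremal p X Q →
  X + 4 * p ≤ 2 * (4 * (p + 2) + 3) →
  60 ≤ 2 * (p + 2) →
  Outcome Good (p + 2) (4 * (p + 2) * (p + 2) + 4 * (p + 2) + 2) p X Q
strict₃-below-2 p {X} {Q} E X≤ k≥ =
  strict (≤-certificate 115 (Extremal.ceiling E 4 22 (≤-certificate 0 X≤ (solve (X ∷ p ∷ []))) ⊕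
    10 ⊗ k≥) (solve (Q ∷ X ∷ p ∷ [])))

strict₃-below-near : ∀ {Good} p j {X Q} → Extremal p X Q →
  X + 4 * p ≤ 2 * (4 * (p + (3 + j)) + 3) →
  4 * (3 + j) * (3 + j) + 10 * (3 + j) + 7 < 2 * (p + (3 + j)) →
  Outcome Good (p + (3 + j)) (4 * (p + (3 + j)) * (p + (3 + j)) + 4 * (p + (3 + j)) + 2) p X Q
strict₃-below-near p j {X} {Q} E X≤ k≥ =
  strict (≤-certificate (119 + 272 * j + 124 * j * j + 16 * j * j * j)
    (Extremal.ceiling E 4 (6 + 8 * (3 + j)) (≤-certificate 0 X≤ (solve (X ∷ j ∷ p ∷ []))) ⊕
    (4 * (3 + j) + 2) ⊗ k≥) (solve (Q ∷ X ∷ j ∷ p ∷ [])))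

private

  bounded-below : ∀ {c i} → ¬ i < c → ∃ λ j → c + j ≡ i
  bounded-below i≮c = ℕₚ.m≤n⇒∃[o]m+o≡n (ℕₚ.≮⇒≥ i≮c)

  too-small : ∀ N a b c {i x} → False (N ℕₚ.≤? a * c + b) → N ≤ x → x ≤ a * suc i + b → ¬ i < c
  too-small N a b c N≰ N≤x x≤ i<c =
    toWitnessFalse N≰ (ℕₚ.≤-trans N≤x (ℕₚ.≤-trans x≤ (a ⊗ i<c ⊕ ℕₚ.≤-refl {b})))

  2≤2+ : ∀ {n} → 2 ≤ 2 + n
  2≤2+ = s≤s (s≤s z≤n)

-- Away from the extremal values of p the smooth bound Q ≤ p X suffices; near them the
-- integrality loss in `Extremal.ceiling`, with threshold 3 or 4, decides.
outcome₀ : ∀ k {p X Q} → 8 ≤ k → 1 ≤ p → Extremal p X Q → X + 4 * p ≤ 2 * (4 * k + 0) →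
  Outcome (Good₀ k) k (4 * k * k) p X Q
outcome₀ k {p} 8≤k 1≤p E X≤ with compare p k
outcome₀ _ {suc p} 8≤k _ E X≤ | less _ i = strict₀-below p i E X≤
outcome₀ _ {suc p} {X} {Q} 8≤k _ E X≤ | equal _ with ℕₚ.m≤n⇒m<n∨m≡n {X} {4 * suc p}
  (≤-certificate 0 X≤ (solve (X ∷ p ∷ [])))
... | inj₂ X≡ = exact 4 0 (refl , refl , refl) (trans X≡ (sym (ℕₚ.+-identityʳ _))) (solve (p ∷ []))
outcome₀ _ {suc zero} (s≤s ()) _ E X≤ | equal _ | inj₁ X<
outcome₀ _ {suc (suc p)} {X} {Q} 8≤k _ E X≤ | equal _ | inj₁ X< =
  strict (≤-certificate p (Extremal.smooth E ⊕ suc p ⊗ X<) (solve (X ∷ Q ∷ p ∷ [])))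
outcome₀ k 8≤k _ E X≤ | greater _ (suc i) = strict₀-above k i E X≤
outcome₀ k 8≤k _ E X≤ | greater _ zero with ℕₚ.m≤n⇒∃[o]m+o≡n 8≤k
... | m , refl = strict₀-next m E X≤

outcome₁ : ∀ k {p X Q} → 30 ≤ k → 1 ≤ p → Extremal p X Q → X + 4 * p ≤ 2 * (4 * k + 1) →
  Outcome (Good₁ k) k (4 * k * k + 2) p X Q
outcome₁ k {p} 30≤k 1≤p E X≤ with compare p k
outcome₁ k {suc p} {X} 30≤k 1≤p E X≤ | equal _ =
  exact-or-slack E 4 2 2≤2+ (refl , refl , refl) (≤-certificate 0 X≤ (solve (X ∷ p ∷ [])))
    (solve (p ∷ []))
outcome₁ _ {suc p} 30≤k 1≤p E X≤ | less _ i with 2 * suc (suc p + i) ℕₚ.≤? 17 * suc i + 7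
... | no k> = strict₁-below-near (suc p) i E X≤ (ℕₚ.≰⇒> k>)
... | yes k≤ with bounded-below (too-small 60 17 7 3 {i} _ (2 ⊗ 30≤k) k≤)
...   | j , refl = strict₁-below-far p j E X≤ k≤
outcome₁ k 30≤k 1≤p E X≤ | greater _ i = beyond i E X≤ (ℕₚ.m≤n⇒∃[o]m+o≡n 30≤k)
  where
  beyond : ∀ i {X Q} → Extremal (suc (k + i)) X Q → X + 4 * suc (k + i) ≤ 2 * (4 * k + 1) →
    (∃ λ m → 30 + m ≡ k) → Outcome (Good₁ k) k (4 * k * k + 2) (suc (k + i)) X Q
  beyond 0 E X≤ (m , refl) = strict₁-above-0 m E X≤
  beyond 1 E X≤ (m , refl) = strict₁-above-1 m E X≤
  beyond 2 E X≤ (m , refl) = strict₁-above-2 m E X≤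
  beyond 3 E X≤ (m , refl) = strict₁-above-3 m E X≤
  beyond (suc (suc (suc (suc j)))) E X≤ _ with k ℕₚ.≤? 7 * (4 + j) + 4
  ... | yes k≤ = strict₁-above-far k j E X≤ k≤
  ... | no k> with ℕₚ.m≤n⇒∃[o]m+o≡n (ℕₚ.≰⇒> k>)
  ...   | s , refl = strict₁-above-near j s E X≤

outcome₂ : ∀ k {p X Q} → 68 ≤ k → 1 ≤ p → Extremal p X Q → X + 4 * p ≤ 2 * (4 * k + 2) →
  Outcome (Good₂ k) k (4 * k * k + 12) p X Q
outcome₂ k {p} 68≤k 1≤p E X≤ with compare p k
outcome₂ k {suc p} {X} 68≤k 1≤p E X≤ | equal _ =
  exact-or-slack E 4 4 2≤2+ (inj₁ (refl , refl , refl)) (≤-certificate 0 X≤ (solve (X ∷ p ∷ [])))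
    (solve (p ∷ []))
outcome₂ _ {suc p} 68≤k 1≤p E X≤ | less _ i with 2 * suc (suc p + i) ℕₚ.≤? 17 * suc i + 15
... | no k> = strict₂-below-near (suc p) i E X≤ (ℕₚ.≰⇒> k>)
... | yes k≤ with bounded-below (too-small 136 17 15 7 {i} _ (2 ⊗ 68≤k) k≤)
...   | j , refl = strict₂-below-far p j E X≤ k≤
outcome₂ k {p} {X} 68≤k 1≤p E X≤ | greater _ zero with ℕₚ.m≤n⇒∃[o]m+o≡n
  (ℕₚ.≤-trans (ℕₚ.m≤m+n 3 65) 68≤k)
... | s , refl = exact-or-slack E 3 s (ℕₚ.≤-trans (ℕₚ.m≤m+n 2 63) (ℕₚ.+-cancelˡ-≤ 3 65 s 68≤k))
  (inj₂ (trans (cong suc (ℕₚ.+-identityʳ (3 + s))) (ℕₚ.+-comm 1 (3 + s)) , refl , ℕₚ.+-comm s 3))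
  (≤-certificate 0 X≤ (solve (X ∷ s ∷ []))) (solve (s ∷ []))
outcome₂ k {p} {X} 68≤k 1≤p E X≤ | greater _ (suc i) with k ℕₚ.≤? 7 * suc i + 2
... | yes k≤ with bounded-below (too-small 68 7 2 9 {i} _ 68≤k k≤)
...   | j , refl = strict₂-above-far k j E X≤ k≤
outcome₂ k {p} {X} 68≤k 1≤p E X≤ | greater _ (suc i) | no k> with ℕₚ.m≤n⇒∃[o]m+o≡n (ℕₚ.≰⇒> k>)
...   | s , refl = strict₂-above-near i s E X≤ large
  where
  large : 13 * suc i + 14 ≤ 2 * (suc (7 * suc i + 2) + s)
  large with i ℕₚ.<? 7
  ... | yes i<7 = ℕₚ.≤-trans (13 ⊗ i<7 ⊕ ℕₚ.≤-refl {14}) (ℕₚ.≤-trans (ℕₚ.m≤m+n 105 31) (2 ⊗ 68≤k))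
  ... | no i≮7 with bounded-below i≮7
  ...   | j , refl = ≤-certificate (j + 2 * s) (ℕₚ.≤-refl {0}) (solve (j ∷ s ∷ []))

outcome₃ : ∀ k {p X Q} → 30 ≤ k → 1 ≤ p → Extremal p X Q → X + 4 * p ≤ 2 * (4 * k + 3) →
  Outcome (Good₃ k) k (4 * k * k + 4 * k + 2) p X Q
outcome₃ k {p} 30≤k 1≤p E X≤ with compare p (suc k)
outcome₃ k {p} {X} 30≤k 1≤p E X≤ | equal _ with ℕₚ.m≤n⇒∃[o]m+o≡n (ℕₚ.≤-trans (ℕₚ.m≤m+n 1 29) 30≤k)
... | s , refl = exact-or-slack E 3 s (ℕₚ.≤-trans (ℕₚ.m≤m+n 2 27) (ℕₚ.+-cancelˡ-≤ 1 29 s 30≤k))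
  (ℕₚ.+-comm 1 (1 + s) , refl , ℕₚ.+-comm s 1)
  (≤-certificate 0 X≤ (solve (X ∷ s ∷ []))) (solve (s ∷ []))
outcome₃ _ {suc p} 30≤k 1≤p E X≤ | less _ i with 2 * (suc p + i) ℕₚ.≤? 4 * i * i + 10 * i + 7
... | yes k≤ = strict₃-below-far p i E X≤ k≤
... | no k> = near i E X≤ (2 ⊗ 30≤k) (ℕₚ.≰⇒> k>)
  where
  near : ∀ i {X Q} → Extremal (suc p) X Q → X + 4 * suc p ≤ 2 * (4 * (suc p + i) + 3) →
    60 ≤ 2 * (suc p + i) → 4 * i * i + 10 * i + 7 < 2 * (suc p + i) →
    Outcome (Good₃ (suc p + i)) (suc p + i) (4 * (suc p + i) * (suc p + i) + 4 * (suc p + i) + 2)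
      (suc p) X Q
  near 0 E X≤ k≥ _ = strict₃-below-0 (suc p) E X≤ k≥
  near 1 E X≤ k≥ _ = strict₃-below-1 (suc p) E X≤ k≥
  near 2 E X≤ k≥ _ = strict₃-below-2 (suc p) E X≤ k≥
  near (suc (suc (suc j))) E X≤ _ k> = strict₃-below-near (suc p) j E X≤ k>
outcome₃ k {p} {X} 30≤k 1≤p E X≤ | greater _ i with k ℕₚ.≤? 7 * suc i
... | yes k≤ with bounded-below (too-small 30 7 0 4 {i} _ 30≤k (ℕₚ.≤-trans k≤ (ℕₚ.m≤m+n _ 0)))
...   | j , refl = strict₃-above-far k j E X≤ k≤
outcome₃ k {p} {X} 30≤k 1≤p E X≤ | greater _ i | no k> with ℕₚ.m≤n⇒∃[o]m+o≡n (ℕₚ.≰⇒> k>)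
...   | s , refl = strict₃-above-near i s E X≤ large
  where
  large : 13 * suc i + 7 ≤ 2 * (suc (7 * suc i) + s)
  large with i ℕₚ.<? 4
  ... | yes i<4 = ℕₚ.≤-trans (13 ⊗ i<4 ⊕ ℕₚ.≤-refl {7}) (ℕₚ.≤-trans (ℕₚ.m≤m+n 59 1) (2 ⊗ 30≤k))
  ... | no i≮4 with bounded-below i≮4
  ...   | j , refl = ≤-certificate (j + 2 * s) (ℕₚ.≤-refl {0}) (solve (j ∷ s ∷ []))

4pX≤w*w : ∀ p {X w} → X + 4 * suc p ≤ 2 * w + 4 → 4 * (p * X) ≤ w * w
4pX≤w*w p {X} {w} X≤ = subst (_≤ w * w) (ℕₚ.*-assoc 4 p X)
  (m+n≤2w⇒m*n≤w*w (4 * p) X w (≤-certificate 0 X≤ (solve (p ∷ X ∷ w ∷ []))))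

smooth⇒4Q≤ : ∀ {p X Q} w → 1 ≤ p → Q ≤ p * X → X + 4 * p ≤ 2 * w + 4 → 4 * Q ≤ 4 * X + w * w
smooth⇒4Q≤ {suc p} {X} {Q} w _ Q≤pX X≤ = ≤-certificate 0 (4 ⊗ Q≤pX ⊕ 4pX≤w*w p {X} {w} X≤)
  (solve (X ∷ Q ∷ p ∷ w ∷ []))

module _ {k p X Q : ℕ} (2≤k : 2 ≤ k) (1≤p : 1 ≤ p) (Q≤pX : Q ≤ p * X) where
  private
    doubled : ∀ ℓ k → X + 4 * p + 4 ≤ 2 * (4 * (2 + k) + ℓ) → 4 * Q ≤ 4 * X + (4 * (1 + k) + ℓ) *
      (4 * (1 + k) + ℓ)
    doubled ℓ k X≤ = smooth⇒4Q≤ (4 * (1 + k) + ℓ) 1≤p Q≤pX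
      (≤-certificate 0 X≤ (solve (X ∷ p ∷ k ∷ ℓ ∷ [])))

  loose-strict₀ : X + 4 * p + 4 ≤ 2 * (4 * k + 0) → Q + 4 * k < X + 4 * k * k
  loose-strict₀ X≤ with ℕₚ.m≤n⇒∃[o]m+o≡n 2≤k
  ... | j , refl = ℕₚ.*-cancelˡ-< 4 (Q + 4 * (2 + j)) (X + (4 * (2 + j) * (2 + j)))
    (≤-certificate (15 + 16 * j) (doubled 0 j X≤) (solve (Q ∷ X ∷ j ∷ [])))

  loose-strict₁ : X + 4 * p + 4 ≤ 2 * (4 * k + 1) → Q + 4 * k < X + (4 * k * k + 2)
  loose-strict₁ X≤ with ℕₚ.m≤n⇒∃[o]m+o≡n 2≤k
  ... | j , refl = ℕₚ.*-cancelˡ-< 4 (Q + 4 * (2 + j)) (X + (4 * (2 + j) * (2 + j) + 2))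
    (≤-certificate (14 + 8 * j) (doubled 1 j X≤) (solve (Q ∷ X ∷ j ∷ [])))

  loose-strict₂ : X + 4 * p + 4 ≤ 2 * (4 * k + 2) → Q + 4 * k < X + (4 * k * k + 12)
  loose-strict₂ X≤ with ℕₚ.m≤n⇒∃[o]m+o≡n 2≤k
  ... | j , refl = ℕₚ.*-cancelˡ-< 4 (Q + 4 * (2 + j)) (X + (4 * (2 + j) * (2 + j) + 12))
    (≤-certificate 43 (doubled 2 j X≤) (solve (Q ∷ X ∷ j ∷ [])))

  loose-strict₃ : X + 4 * p + 4 ≤ 2 * (4 * k + 3) → Q + 4 * k < X + (4 * k * k + 4 * k + 2)
  loose-strict₃ X≤ with ℕₚ.m≤n⇒∃[o]m+o≡n 2≤k
  ... | j , refl = ℕₚ.*-cancelˡ-< 4 (Q + 4 * (2 + j)) (X + (4 * (2 + j) * (2 + j) + 4 * (2 + j) + 2))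
    (≤-certificate (22 + 8 * j) (doubled 3 j X≤) (solve (Q ∷ X ∷ j ∷ [])))

-- Bounds on the total connectivity

another : ∀ {n} → 1 < n → (u : Fin n) → ∃ λ v → u ≢ v
another (s≤s (s≤s _)) u = punchIn u zero , Finₚ.punchInᵢ≢i u zero ∘ sym

module Analysis (G : Multigraph) .{{_ : NonTrivial (order G)}} (minimal : MinimallyTwoEdgeConnected G) where

  open Classes G (twoCut G minimal) public

  private
    n = order G
    λᴳ = localEdgeConnectivity G

  2≤degree : ∀ u → 2 ≤ degree G u
  2≤degree u with another (nonTrivial⇒n>1 n) u
  ... | v , u≢v = ℕₚ.≤-trans (two≤λ G (proj₁ minimal) u≢v) (λ≤degreeˡ G u≢v)

  surplus : Vertex G → ℕ
  surplus u = degree G u ∸ 2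

  degree≡ : ∀ u → degree G u ≡ 2 + surplus u
  degree≡ u = sym (ℕₚ.m+[n∸m]≡n (2≤degree u))

  share : Vertex G → Vertex G → ℕ
  share u v = 𝟙 (u ~? v) * (surplus u ⊓ surplus v)

  share-sym : ∀ u v → share u v ≡ share v u
  share-sym u v = cong₂ _*_ (𝟙-cong (u ~? v) (v ~? u) ~-sym ~-sym) (ℕₚ.⊓-comm (surplus u) (surplus v))

  share-refl : ∀ u → share u u ≡ surplus u
  share-refl u = trans (cong₂ _*_ (𝟙-yes (u ~? u) ~-refl) (ℕₚ.⊓-idem (surplus u))) (ℕₚ.+-identityʳ _)

  λ≤2+share : ∀ u v → u ≢ v → λᴳ u v ≤ 2 + share u v
  λ≤2+share u v u≢v with u ~? v
  ... | no u≁v = ≁⇒λ≤2 u≁v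
  ... | yes _  = subst (λᴳ u v ≤_) (trans (cong₂ _⊓_ (degree≡ u) (degree≡ v))
      (cong (2 +_) (sym (ℕₚ.+-identityʳ _))))
    (ℕₚ.⊓-glb (λ≤degreeˡ G u≢v) (λ≤degreeʳ G u≢v))

  total X Q : ℕ
  total = pairSum λ u v → 2 + share u v
  X     = sum surplus
  Q     = sum λ u → sum (share u)

  total-identity : 2 * total + (n * 2 + X) ≡ n * (n * 2) + Q
  total-identity = subst (λ d → 2 * total + (n * 2 + d) ≡ n * (n * 2) + Q) (sum-cong-≗ share-refl)
    (pairSum-2+ share share-sym)

  2n+X≡2*size : n * 2 + X ≡ 2 * size G
  2n+X≡2*size = trans (trans (cong (_+ X) (sym (∑-const n 2))) (sym (∑-distrib-+ (λ _ → 2) surplus)))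
    (trans (sum-cong-≗ (sym ∘ degree≡)) (handshake G))

  someVertex : Vertex G
  someVertex = Fin.fromℕ< (ℕₚ.<-trans (s≤s z≤n) (nonTrivial⇒n>1 n))

  u₀ : Vertex G
  u₀ = proj₁ (largest someVertex)

  C? : ∀ v → Dec (u₀ ~ v)
  C? v = u₀ ~? v

  p o : ℕ
  p = classSize u₀
  o = length (outside u₀)

  p+o≡n : p + o ≡ n
  p+o≡n = classSize+outside u₀

  1≤p : 1 ≤ p
  1≤p = subst (_≤ p) (𝟙-yes (C? u₀) ~-refl) (∑-term (𝟙 ∘ C?) u₀)

  Q≤pX : Q ≤ p * X
  Q≤pX = ∑∑-⊓≤ (λ u v → 𝟙 (u ~? v)) surplus p (λ u v → 𝟙-cong (u ~? v) (v ~? u) ~-sym ~-sym)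
    (proj₂ (largest someVertex))

  private
    size⇒X : ∀ c → size G + 2 * c ≤ 2 * o → X + 4 * p + 4 * c ≤ 2 * n
    size⇒X c size≤ = ≤-certificate 0 (2 ⊗ size≤ ⊕ ℕₚ.≤-reflexive 2n+X≡2*size ⊕ 4 ⊗ ℕₚ.≤-reflexive p+o≡n)
      (identity X p c n (size G) o)
      where
      identity : ∀ X p c n m o → X + 4 * p + 4 * c + (2 * (2 * o) + 2 * m + 4 * n) + 0 ≡
                                 2 * n + (2 * (m + 2 * c) + (n * 2 + X) + 4 * (p + o))
      identity = solve-∀

  X+4p≤2n : X + 4 * p ≤ 2 * n
  X+4p≤2n = subst (_≤ 2 * n) (ℕₚ.+-identityʳ _)
    (size⇒X 0 (subst (_≤ 2 * o) (sym (ℕₚ.+-identityʳ _)) (size≤2*outside u₀)))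

  Loose : Set
  Loose = ∃ λ a → ∃ λ b → ¬ u₀ ~ a × a ≢ b × a ~ b

  loose? : Dec Loose
  loose? = Finₚ.any? λ a → Finₚ.any? λ b → ¬? (C? a) ×-dec ¬? (a Finₚ.≟ b) ×-dec a ~? b

  loose⇒X+4p+4≤2n : Loose → X + 4 * p + 4 ≤ 2 * n
  loose⇒X+4p+4≤2n (a , b , u₀≁a , a≢b , a~b) = size⇒X 1 (size≤2*outside∸1 u₀≁a a≢b a~b)

  Xᶜ Qᶜ : ℕ
  Xᶜ = weight C? surplus
  Qᶜ = minSum C? surplus

  Xᶜ≤X : Xᶜ ≤ X
  Xᶜ≤X = ∑-mono λ u → ℕₚ.≤-trans (ℕₚ.*-monoˡ-≤ (surplus u) (𝟙≤1 (C? u)))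
    (ℕₚ.≤-reflexive (ℕₚ.*-identityˡ _))

  -- When all classes but that of u₀ are singletons, the rows of share outside it are diagonal.
  Q+Xᶜ≤Qᶜ+X : ¬ Loose → Q + Xᶜ ≤ Qᶜ + X
  Q+Xᶜ≤Qᶜ+X ¬loose = subst₂ _≤_ (∑-distrib-+ (sum ∘ share) (λ u → 𝟙 (C? u) * surplus u))
    (∑-distrib-+ (λ u → sum λ v → 𝟙 (C? u) * 𝟙 (C? v) * (surplus u ⊓ surplus v)) surplus) (∑-mono row)
    where
    row : ∀ u → sum (share u) + 𝟙 (C? u) * surplus u ≤
                sum (λ v → 𝟙 (C? u) * 𝟙 (C? v) * (surplus u ⊓ surplus v)) + surplus u
    row u with C? u
    ... | yes u₀~u = ℕₚ.≤-reflexive (cong₂ _+_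
      (sum-cong-≗ λ v → cong (_* (surplus u ⊓ surplus v))
        (trans (𝟙-cong (u ~? v) (C? v) (~-trans u₀~u) (~-trans (~-sym u₀~u))) (sym (ℕₚ.+-identityʳ _))))
      (ℕₚ.+-identityʳ _))
    ... | no u₀≁u = ℕₚ.≤-trans (ℕₚ.≤-reflexive (trans (ℕₚ.+-identityʳ _)
        (trans (∑-single (share u) u λ v v≢u →
            cong (_* (surplus u ⊓ surplus v))
              (𝟙-no (u ~? v) λ u~v → ¬loose (u , v , u₀≁u , v≢u ∘ sym , u~v)))
          (share-refl u)))) (ℕₚ.m≤n+m _ _)

  open Extremality (threshold C? surplus) public using (extremal; extremal⇒near)

module Bounds (G : Multigraph) .{{_ : NonTrivial (order G)}} (minimal : MinimallyTwoEdgeConnected G) where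

  open Analysis G minimal

  private
    n = order G
    λᴳ = localEdgeConnectivity G

  S : ℕ
  S = pairSum λᴳ

  S≤total : S ≤ total
  S≤total = pairSum-mono λ≤2+share

  8S≤ : 8 * S + 8 * n ≤ 8 * (n * n) + (n ∸ 2) * (n ∸ 2)
  8S≤ = combine n (n ∸ 2) S total X Q p 1≤p (ℕₚ.m+[n∸m]≡n (nonTrivial⇒n>1 n)) S≤total total-identity
    X+4p≤2n Q≤pX
    where
    combine : ∀ n w S P X Q p → 1 ≤ p → 2 + w ≡ n → S ≤ P → 2 * P + (n * 2 + X) ≡ n * (n * 2) + Q →
      X + 4 * p ≤ 2 * n → Q ≤ p * X → 8 * S + 8 * n ≤ 8 * (n * n) + w * w
    combine n w S P X Q p 1≤p refl S≤P identity X≤ Q≤pX = ≤-certificate 0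
      (8 ⊗ S≤P ⊕ ℕₚ.≤-reflexive (cong (4 *_) identity) ⊕ smooth⇒4Q≤ w 1≤p Q≤pX
        (≤-certificate 0 X≤ (solve (X ∷ p ∷ w ∷ []))))
      (solve (S ∷ P ∷ X ∷ Q ∷ w ∷ []))

  record Tight (q : ℕ) : Set where
    field
      degree-outside : ∀ v → ¬ u₀ ~ v → degree G v ≡ 2
      degree-inside  : ∀ v → u₀ ~ v → 2 + q ≤ degree G v × degree G v ≤ 3 + q
      λ≡min          : ∀ u v → u₀ ~ u → u₀ ~ v → u ≢ v → λᴳ u v ≡ degree G u ⊓ degree G v
      size≡          : size G ≡ 2 * o

  module Residue
    (k ℓ τ : ℕ) (n≡ : n ≡ 4 * k + ℓ) (Good : ℕ → ℕ → ℕ → Set)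
    (outcome : Xᶜ + 4 * p ≤ 2 * (4 * k + ℓ) → Outcome Good k τ p Xᶜ Qᶜ)
    (loose-strict : X + 4 * p + 4 ≤ 2 * (4 * k + ℓ) → Q + 4 * k < X + τ)
    (balanced : ∀ {q s} → Good p q s → q * p + s + 4 * p ≡ 2 * (4 * k + ℓ)) where

    private
      compactOutcome : Outcome Good k τ p Xᶜ Qᶜ
      compactOutcome = outcome (ℕₚ.≤-trans (ℕₚ.+-monoˡ-≤ (4 * p) Xᶜ≤X)
        (subst (λ x → X + 4 * p ≤ 2 * x) n≡ X+4p≤2n))

      loose-strict′ : Loose → Q + 4 * k < X + τ
      loose-strict′ loose = loose-strict (subst (λ x → X + 4 * p + 4 ≤ 2 * x) n≡
        (loose⇒X+4p+4≤2n loose))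

      compact-≤ : ∀ {Q Qᶜ X Xᶜ K} → Q + Xᶜ ≤ Qᶜ + X → Qᶜ + K ≤ Xᶜ + τ → Q + K ≤ X + τ
      compact-≤ {Q} {Qᶜ} {X} {Xᶜ} {K} Q≤ Qᶜ≤ = ≤-certificate 0 (Q≤ ⊕ Qᶜ≤) (identity Q Qᶜ X Xᶜ K τ)
        where
        identity : ∀ Q Qᶜ X Xᶜ K τ → Q + K + (Qᶜ + X + (Xᶜ + τ)) + 0 ≡ X + τ + (Q + Xᶜ + (Qᶜ + K))
        identity = solve-∀

      Q≤ : Q + 4 * k ≤ X + τ
      Q≤ with loose?
      ... | yes loose = ℕₚ.<⇒≤ (loose-strict′ loose)
      ... | no ¬loose = compact-≤ (Q+Xᶜ≤Qᶜ+X ¬loose) (outcome⇒≤ extremal compactOutcome)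

      total≤ : 2 * total + n * 2 + 4 * k ≤ n * (n * 2) + τ
      total≤ = ≤-certificate 0 (ℕₚ.≤-reflexive total-identity ⊕ Q≤) (identity total n X Q k τ)
        where
        identity : ∀ P n X Q k τ → 2 * P + n * 2 + 4 * k + (n * (n * 2) + Q + (X + τ)) + 0 ≡
                                   n * (n * 2) + τ + (2 * P + (n * 2 + X) + (Q + 4 * k))
        identity = solve-∀

    2S≤ : 2 * S + n * 2 + 4 * k ≤ n * (n * 2) + τ
    2S≤ = ℕₚ.≤-trans (ℕₚ.+-monoˡ-≤ (4 * k) (ℕₚ.+-monoˡ-≤ (n * 2) (ℕₚ.*-monoʳ-≤ 2 S≤total))) total≤

    module _ (max : n * (n * 2) + τ ≤ 2 * S + n * 2 + 4 * k) where

      private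
        total≤S : total ≤ S
        total≤S = ℕₚ.*-cancelˡ-≤ 2 (ℕₚ.+-cancelʳ-≤
          (n * 2) _ _ (ℕₚ.+-cancelʳ-≤ (4 * k) _ _ (ℕₚ.≤-trans total≤ max)))

        Q≥ : X + τ ≤ Q + 4 * k
        Q≥ = ≤-certificate 0 (max ⊕ 2 ⊗ S≤total ⊕ ℕₚ.≤-reflexive total-identity)
          (identity S total n X Q k τ)
          where
          identity : ∀ S P n X Q k τ → X + τ + (2 * S + n * 2 + 4 * k + 2 * P + (n * (n * 2) + Q)) + 0 ≡
                     Q + 4 * k + (n * (n * 2) + τ + 2 * S + (2 * P + (n * 2 + X)))
          identity = solve-∀

        ¬loose : ¬ Loose
        ¬loose loose = ℕₚ.<⇒≱ (loose-strict′ loose) Q≥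

        Qᶜ≥ : Xᶜ + τ ≤ Qᶜ + 4 * k
        Qᶜ≥ = ≤-certificate 0 (Q≥ ⊕ Q+Xᶜ≤Qᶜ+X ¬loose) (identity Q Qᶜ X Xᶜ k τ)
          where
          identity : ∀ Q Qᶜ X Xᶜ k τ → Xᶜ + τ + (Q + 4 * k + (Qᶜ + X)) + 0 ≡ Qᶜ + 4 * k +
            (X + τ + (Q + Xᶜ))
          identity = solve-∀

        exactly : ∃ λ q → ∃ λ s → Good p q s × Xᶜ ≡ q * p + s × τ + (s + q * p) ≡
          q * p * p + s * s + 4 * k
        exactly with compactOutcome
        ... | strict Q<                = contradiction Qᶜ≥ (ℕₚ.<⇒≱ Q<)
        ... | exact q s good X≡ value = q , s , good , X≡ , value

        λ≡2+share : ∀ u v → u Fin.< v → λᴳ u v ≡ 2 + share u v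
        λ≡2+share = pairSum-tight λ≤2+share total≤S

        2+share≡min : ∀ {u v} → u ~ v → 2 + share u v ≡ degree G u ⊓ degree G v
        2+share≡min {u} {v} u~v = trans (cong (λ c → 2 + c * (surplus u ⊓ surplus v))
          (𝟙-yes (u ~? v) u~v))
          (trans (cong (2 +_) (ℕₚ.+-identityʳ _)) (sym (cong₂ _⊓_ (degree≡ u) (degree≡ v))))

      q s : ℕ
      q = proj₁ exactly
      s = proj₁ (proj₂ exactly)

      good : Good p q s
      good = proj₁ (proj₂ (proj₂ exactly))

      private
        Xᶜ≡ : Xᶜ ≡ q * p + s
        Xᶜ≡ = proj₁ (proj₂ (proj₂ (proj₂ exactly)))

        2n≡ : Xᶜ + 4 * p ≡ 2 * n
        2n≡ = trans (cong (_+ 4 * p) Xᶜ≡) (trans (balanced good) (cong (2 *_) (sym n≡)))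

        X≤Xᶜ : X ≤ Xᶜ
        X≤Xᶜ = ℕₚ.+-cancelʳ-≤ (4 * p) _ _ (ℕₚ.≤-trans X+4p≤2n (ℕₚ.≤-reflexive (sym 2n≡)))

        X≡Xᶜ : X ≡ Xᶜ
        X≡Xᶜ = ℕₚ.≤-antisym X≤Xᶜ Xᶜ≤X

      tight : Tight q
      tight = record
        { degree-outside = λ v u₀≁v → trans (degree≡ v) (cong (2 +_)
            (trans (sym (∑-mono-tight {f = λ u → 𝟙 (C? u) * surplus u} {g = surplus}
                     (λ u → ℕₚ.≤-trans (ℕₚ.*-monoˡ-≤ (surplus u) (𝟙≤1 (C? u)))
                       (ℕₚ.≤-reflexive (ℕₚ.*-identityˡ _))) X≤Xᶜ v))
                   (cong (_* surplus v) (𝟙-no (C? v) u₀≁v))))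
        ; degree-inside = λ v u₀~v → let (q≤x , x≤1+q) = near v u₀~v in
            subst (2 + q ≤_) (sym (degree≡ v)) (s≤s (s≤s q≤x)) , subst (_≤ 3 + q) (sym (degree≡ v))
              (s≤s (s≤s x≤1+q))
        ; λ≡min = λ u v u₀~u u₀~v → λ≡min u v (~-trans (~-sym u₀~u) u₀~v)
        ; size≡ = ℕₚ.*-cancelˡ-≡ (size G) (2 * o) 2 (ℕₚ.+-cancelʳ-≡ (4 * p) _ _ doubled)
        }
        where
        near : ∀ v → u₀ ~ v → q ≤ surplus v × surplus v ≤ suc q
        near = extremal⇒near q s 1≤p Xᶜ≡ (≤-certificate 0
          (Qᶜ≥ ⊕ ℕₚ.≤-reflexive (sym (proj₂ (proj₂ (proj₂ (proj₂ exactly))))))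
            (identity q s p Xᶜ Qᶜ k τ))
          where
          identity : ∀ q s p X Q k τ → X + (q * p * p + s * s) + (Q + 4 * k + (τ + (s + q * p))) + 0 ≡
                                       Q + (s + q * p) + (X + τ + (q * p * p + s * s + 4 * k))
          identity = solve-∀

        λ≡min : ∀ u v → u ~ v → u ≢ v → λᴳ u v ≡ degree G u ⊓ degree G v
        λ≡min u v u~v u≢v with Finₚ.<-cmp u v
        ... | tri< u<v _ _ = trans (λ≡2+share u v u<v) (2+share≡min u~v)
        ... | tri≈ _ u≡v _ = contradiction u≡v u≢v
        ... | tri> _ _ v<u = trans (ℕₚ.≤-antisym (λ-sym-≤ G u≢v) (λ-sym-≤ G (u≢v ∘ sym)))
          (trans (λ≡2+share v u v<u) (trans (2+share≡min (~-sym u~v))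
            (ℕₚ.⊓-comm (degree G v) (degree G u))))

        doubled : 2 * size G + 4 * p ≡ 2 * (2 * o) + 4 * p
        doubled = trans (cong (_+ 4 * p) (sym 2n+X≡2*size)) (trans (identity₁ n X p)
          (trans (cong (n * 2 +_) (trans (cong (_+ 4 * p) X≡Xᶜ) 2n≡))
            (trans (identity₂ n) (trans (cong (4 *_) (sym p+o≡n)) (identity₃ p o)))))
          where
          identity₁ : ∀ n X p → n * 2 + X + 4 * p ≡ n * 2 + (X + 4 * p)
          identity₁ = solve-∀
          identity₂ : ∀ n → n * 2 + 2 * n ≡ 4 * n
          identity₂ = solve-∀
          identity₃ : ∀ p o → 4 * (p + o) ≡ 2 * (2 * o) + 4 * p
          identity₃ = solve-∀

-- Isomorphism and subdivision

translate-λ : ∀ (G K : Multigraph) {u v x y} → u ≢ v → x ≢ y →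
  (f : Walk G u v → Walk K x y) (trace : Edge K → Edge G → Set) →
  (∀ p {e′} → e′ ∈ edges K (f p) → ∃ λ e → e ∈ edges G p × trace e′ e) →
  (∀ {e′ e₁ e₂} → trace e′ e₁ → trace e′ e₂ → e₁ ≡ e₂) →
  localEdgeConnectivity G u v ≤ localEdgeConnectivity K x y
translate-λ G K u≢v x≢y f trace traceable functional with proj₁ (localEdgeConnectivity-greatest G u≢v)
... | ps , _ , disjoint = disjointWalks⇒≤λ K x≢y (Vec.map f ps)
  (VAllPairsₚ.map⁺ (VAllPairs.map (λ {p} {q} p#q {_} (e∈p , e∈q) → clash p#q (traceable p e∈p)
    (traceable q e∈q)) disjoint))
  where
  clash : ∀ {p q e′} → EdgeDisjoint G p q → (∃ λ e → e ∈ edges G p × trace e′ e) → ¬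
    (∃ λ e → e ∈ edges G q × trace e′ e)
  clash p#q (_ , e∈p , t) (_ , e∈q , t′) with functional t t′
  ... | refl = p#q (e∈p , e∈q)

joins-ends-≡ : ∀ (G : Multigraph) {e a b c d} → Joins G e a b → a ≡ c → b ≡ d → Joins G e c d
joins-ends-≡ G j refl refl = j

module _ {G K : Multigraph} (iso : G ≅ K) where
  open _≅_ iso

  private
    module V = Inverse vertexBijection
    module E = Inverse edgeBijection

  onVertex-injective : ∀ {u v} → onVertex u ≡ onVertex v → u ≡ v
  onVertex-injective eq = trans (sym (V.strictlyInverseʳ _))
    (trans (cong V.from eq) (V.strictlyInverseʳ _))

  onEdge-injective : ∀ {e f} → onEdge e ≡ onEdge f → e ≡ f
  onEdge-injective eq = trans (sym (E.strictlyInverseʳ _))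
    (trans (cong E.from eq) (E.strictlyInverseʳ _))

  iso-joins : ∀ {e u v} → Joins G e u v → Joins K (onEdge e) (onVertex u) (onVertex v)
  iso-joins (inj₁ (refl , refl)) = incidence _
  iso-joins (inj₂ (refl , refl)) = joins-sym K (incidence _)

  iso-walk : ∀ {u v} → Walk G u v → Walk K (onVertex u) (onVertex v)
  iso-walk []      = []
  iso-walk (j ∷ p) = iso-joins j ∷ iso-walk p

  iso-λ : ∀ {u v} → u ≢ v → localEdgeConnectivity G u v ≤ localEdgeConnectivity K (onVertex u)
    (onVertex v)
  iso-λ u≢v = translate-λ G K u≢v (u≢v ∘ onVertex-injective) iso-walk (λ e′ e → e′ ≡ onEdge e) traceable
    (λ eq eq′ → onEdge-injective (trans (sym eq) eq′))
    where
    traceable : ∀ {u v} (p : Walk G u v) {e′} → e′ ∈ edges K (iso-walk p) → ∃ λ e → e ∈ edges G p ×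
      e′ ≡ onEdge e
    traceable (_∷_ {e = e} j p) (here refl) = e , here refl , refl
    traceable (j ∷ p) (there e′∈) with traceable p e′∈
    ... | e , e∈p , eq = e , there e∈p , eq

  ≅-sym : K ≅ G
  ≅-sym = record
    { vertexBijection = Symmetry.↔-sym vertexBijection
    ; edgeBijection   = Symmetry.↔-sym edgeBijection
    ; incidence       = λ e → pull-back (subst
        (λ e′ → Joins K e′ (onVertex (source G (E.from e))) (onVertex (target G (E.from e))))
                                         (E.strictlyInverseˡ e) (incidence (E.from e)))
    }
    where
    pull-back : ∀ {e} → Joins K e (onVertex (source G (E.from e))) (onVertex (target G (E.from e))) →
      Joins G (E.from e) (V.from (source K e)) (V.from (target K e))
    pull-back (inj₁ (s , t)) = inj₁ (sym (trans (cong V.from s) (V.strictlyInverseʳ _)) , sym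
      (trans (cong V.from t) (V.strictlyInverseʳ _)))
    pull-back (inj₂ (s , t)) = inj₂ (sym (trans (cong V.from t) (V.strictlyInverseʳ _)) , sym
      (trans (cong V.from s) (V.strictlyInverseʳ _)))

  iso-degree : ∀ v → degree G v ≡ degree K (onVertex v)
  iso-degree v = trans (degree-sum G v) (trans
    (sum-cong-≗ λ e → 𝟙-cong (incident? G v e) (incident? K (onVertex v) (onEdge e)) (push e) (pull e))
    (trans (sym (sum-permute (λ e → 𝟙 (incident? K (onVertex v) e)) edgeBijection))
      (sym (degree-sum K (onVertex v)))))
    where
    push : ∀ e → Incident G v e → Incident K (onVertex v) (onEdge e)
    push e (inj₁ refl) with incidence e
    ... | inj₁ (s , _) = inj₁ s
    ... | inj₂ (_ , t) = inj₂ t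
    push e (inj₂ refl) with incidence e
    ... | inj₁ (_ , t) = inj₂ t
    ... | inj₂ (s , _) = inj₁ s

    pull : ∀ e → Incident K (onVertex v) (onEdge e) → Incident G v e
    pull e (inj₁ eq) with incidence e
    ... | inj₁ (s , _) = inj₁ (onVertex-injective (trans (sym s) eq))
    ... | inj₂ (s , _) = inj₂ (onVertex-injective (trans (sym s) eq))
    pull e (inj₂ eq) with incidence e
    ... | inj₁ (_ , t) = inj₂ (onVertex-injective (trans (sym t) eq))
    ... | inj₂ (_ , t) = inj₁ (onVertex-injective (trans (sym t) eq))

module Subdivision (H : Multigraph) where

  private
    n = order H
    m = size H
    K = subdivide H

  old : Vertex H → Vertex K
  old v = v ↑ˡ m

  new : Edge H → Vertex K
  new e = n ↑ʳ e

  sourceHalf targetHalf : Edge H → Edge K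
  sourceHalf e = e ↑ˡ m
  targetHalf e = m ↑ʳ e

  old-injective : ∀ {u v} → old u ≡ old v → u ≡ v
  old-injective = Finₚ.↑ˡ-injective m _ _

  new-injective : ∀ {e f} → new e ≡ new f → e ≡ f
  new-injective = Finₚ.↑ʳ-injective n _ _

  old≢new : ∀ {v e} → old v ≢ new e
  old≢new {v} {e} eq with trans (sym (Finₚ.splitAt-↑ˡ n v m))
    (trans (cong (splitAt n) eq) (Finₚ.splitAt-↑ʳ n m e))
  ... | ()

  source-sourceHalf : ∀ e → source K (sourceHalf e) ≡ old (source H e)
  source-sourceHalf e = cong [ old ∘ source H , old ∘ target H ]′ (Finₚ.splitAt-↑ˡ m e m)

  target-sourceHalf : ∀ e → target K (sourceHalf e) ≡ new e
  target-sourceHalf e = cong [ new , new ]′ (Finₚ.splitAt-↑ˡ m e m)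

  source-targetHalf : ∀ e → source K (targetHalf e) ≡ old (target H e)
  source-targetHalf e = cong [ old ∘ source H , old ∘ target H ]′ (Finₚ.splitAt-↑ʳ m m e)

  target-targetHalf : ∀ e → target K (targetHalf e) ≡ new e
  target-targetHalf e = cong [ new , new ]′ (Finₚ.splitAt-↑ʳ m m e)

  sourceHalf-joins : ∀ e → Joins K (sourceHalf e) (old (source H e)) (new e)
  sourceHalf-joins e = inj₁ (source-sourceHalf e , target-sourceHalf e)

  targetHalf-joins : ∀ e → Joins K (targetHalf e) (old (target H e)) (new e)
  targetHalf-joins e = inj₁ (source-targetHalf e , target-targetHalf e)

  data Half : Edge K → Edge H → Vertex H → Set where
    isSource : ∀ e → Half (sourceHalf e) e (source H e)
    isTarget : ∀ e → Half (targetHalf e) e (target H e)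

  half : ∀ f → ∃ λ e → ∃ λ a → Half f e a
  half f with splitAt m f | Finₚ.join-splitAt m m f
  ... | inj₁ e | refl = e , _ , isSource e
  ... | inj₂ e | refl = e , _ , isTarget e

  half-joins : ∀ {f e a} → Half f e a → Joins K f (old a) (new e)
  half-joins (isSource e) = sourceHalf-joins e
  half-joins (isTarget e) = targetHalf-joins e

  trace-edge : ∀ {f e e′ a a′} → Half f e a → Half f e′ a′ → e ≡ e′
  trace-edge h h′ with joins-ends K (half-joins h) (joins-sym K (half-joins h′))
  ... | inj₁ eq = contradiction (sym eq) old≢new
  ... | inj₂ eq = sym (new-injective eq)

  refine : ∀ {u v} → Walk H u v → Walk K (old u) (old v)
  refine []                             = []
  refine (_∷_ {e = e} (inj₁ (refl , refl)) p) = sourceHalf-joins e ∷ joins-sym K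
    (targetHalf-joins e) ∷ refine p
  refine (_∷_ {e = e} (inj₂ (refl , refl)) p) = targetHalf-joins e ∷ joins-sym K
    (sourceHalf-joins e) ∷ refine p

  λ-refine : ∀ {u v} → u ≢ v → localEdgeConnectivity H u v ≤ localEdgeConnectivity K (old u) (old v)
  λ-refine u≢v = translate-λ H K u≢v (u≢v ∘ old-injective) refine (λ f e → ∃ λ a → Half f e a) traceable
    (λ (_ , h) (_ , h′) → trace-edge h h′)
    where
    traceable : ∀ {u v} (p : Walk H u v) {f} → f ∈ edges K (refine p) → ∃ λ e → e ∈ edges H p ×
      ∃ λ a → Half f e a
    traceable (inj₁ (refl , refl) ∷ p) (here refl)         = _ , here refl , _ , isSource _
    traceable (inj₁ (refl , refl) ∷ p) (there (here refl)) = _ , here refl , _ , isTarget _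
    traceable (inj₁ (refl , refl) ∷ p) (there (there f∈))  with traceable p f∈
    ... | e , e∈p , h = e , there e∈p , h
    traceable (inj₂ (refl , refl) ∷ p) (here refl)         = _ , here refl , _ , isTarget _
    traceable (inj₂ (refl , refl) ∷ p) (there (here refl)) = _ , here refl , _ , isSource _
    traceable (inj₂ (refl , refl) ∷ p) (there (there f∈))  with traceable p f∈
    ... | e , e∈p , h = e , there e∈p , h

  from-old : ∀ {f a y} → Joins K f (old a) y → ∃ λ e → Half f e a × y ≡ new e
  from-old {f} j with half f
  ... | e , b , h with joins-ends K (half-joins h) j | joins-ends K (half-joins h) (joins-sym K j)
  ...   | inj₂ eq | _       = contradiction eq old≢new
  ...   | inj₁ eq | inj₂ y≡ rewrite old-injective eq = e , h , y≡
  ...   | inj₁ eq | inj₁ y≡ = contradiction (trans y≡ (sym eq)) (ends-distinct j)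
    where
    ends-distinct : ∀ {x y} → Joins K f x y → y ≢ x
    ends-distinct (inj₁ (refl , refl)) eq = loopless K f (sym eq)
    ends-distinct (inj₂ (refl , refl)) eq = loopless K f eq

  from-new : ∀ {f e y} → Joins K f (new e) y → ∃ λ a → Half f e a × y ≡ old a
  from-new {f} j with half f
  ... | e , b , h with joins-ends K (half-joins h) j | joins-ends K (half-joins h) (joins-sym K j)
  ...   | inj₁ eq | _       = contradiction (sym eq) old≢new
  ...   | inj₂ eq | inj₁ y≡ rewrite new-injective eq = b , h , y≡
  ...   | inj₂ eq | inj₂ y≡ = contradiction (trans y≡ (sym eq)) (ends-distinct j)
    where
    ends-distinct : ∀ {x y} → Joins K f x y → y ≢ x
    ends-distinct (inj₁ (refl , refl)) eq = loopless K f (sym eq)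
    ends-distinct (inj₂ (refl , refl)) eq = loopless K f eq

  -- A walk that enters new e through one half and leaves through the same half is shortened.
  coarsen : ∀ {x v} (p : Walk K x (old v)) → ∀ {u} → x ≡ old u →
    Σ (Walk H u v) λ q → ∀ {e} → e ∈ edges H q → sourceHalf e ∈ edges K p
  coarsen [] {u} eq rewrite old-injective eq = [] , λ ()
  coarsen (j ∷ []) refl with from-old j
  ... | e , _ , eq = contradiction eq old≢new
  coarsen (j ∷ j′ ∷ p) {u} refl with from-old j
  ... | e , h , refl with from-new j′
  ...   | a , h′ , refl with coarsen p refl
  ...     | q , q⊆ = join h h′ q q⊆
    where
    join : ∀ {f f′ e u a v} {L : List (Edge K)} → Half f e u → Half f′ e a → (q : Walk H a v) →
      (∀ {e} → e ∈ edges H q → sourceHalf e ∈ L) →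
      Σ (Walk H u v) λ q → ∀ {e} → e ∈ edges H q → sourceHalf e ∈ f ∷ f′ ∷ L
    join (isSource e) (isSource e) q q⊆ = q , there ∘ there ∘ q⊆
    join (isTarget e) (isTarget e) q q⊆ = q , there ∘ there ∘ q⊆
    join (isSource e) (isTarget e) q q⊆ = inj₁
      (refl , refl) ∷ q , λ { (here refl) → here refl ; (there e∈q) → there (there (q⊆ e∈q)) }
    join (isTarget e) (isSource e) q q⊆ = inj₂
      (refl , refl) ∷ q , λ { (here refl) → there (here refl) ; (there e∈q) → there (there (q⊆ e∈q)) }

  λ-coarsen : ∀ {u v} → u ≢ v → localEdgeConnectivity K (old u) (old v) ≤ localEdgeConnectivity H u v
  λ-coarsen u≢v = translate-λ K H (u≢v ∘ old-injective) u≢v (λ p → proj₁ (coarsen p refl))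
    (λ e f → f ≡ sourceHalf e)
    (λ p e∈ → _ , proj₂ (coarsen p refl) e∈ , refl) (λ eq eq′ → trans eq (sym eq′))

  degree-old : ∀ v → degree K (old v) ≡ degree H v
  degree-old v = begin
    degree K (old v)
      ≡⟨ degree-sum K (old v) ⟩
    sum (λ f → 𝟙 (incident? K (old v) f))
      ≡⟨ ∑-split m (λ f → 𝟙 (incident? K (old v) f)) ⟩
    sum (λ e → 𝟙 (incident? K (old v) (sourceHalf e))) + sum
      (λ e → 𝟙 (incident? K (old v) (targetHalf e)))
      ≡⟨ cong₂ _+_ (sum-cong-≗ λ e → at (isSource e)) (sum-cong-≗ λ e → at (isTarget e)) ⟩
    sum (λ e → 𝟙 (v Finₚ.≟ source H e)) + sum (λ e → 𝟙 (v Finₚ.≟ target H e))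
      ≡⟨ ∑-distrib-+ (λ e → 𝟙 (v Finₚ.≟ source H e)) (λ e → 𝟙 (v Finₚ.≟ target H e)) ⟨
    sum (λ e → 𝟙 (v Finₚ.≟ source H e) + 𝟙 (v Finₚ.≟ target H e))
      ≡⟨ sum-cong-≗ (λ e → sym (incident≡ H v e)) ⟩
    sum (λ e → 𝟙 (incident? H v e))
      ≡⟨ degree-sum H v ⟨
    degree H v ∎
    where
    open ≡-Reasoning
    at : ∀ {f e a} → Half f e a → 𝟙 (incident? K (old v) f) ≡ 𝟙 (v Finₚ.≟ a)
    at {f} {e} {a} h = 𝟙-cong (incident? K (old v) f) (v Finₚ.≟ a) (to (half-joins h))
      (from (half-joins h))
      where
      to : Joins K f (old a) (new e) → Incident K (old v) f → v ≡ a
      to (inj₁ (s , _)) (inj₁ eq) = old-injective (trans (sym eq) s)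
      to (inj₁ (_ , t)) (inj₂ eq) = contradiction (trans (sym eq) t) old≢new
      to (inj₂ (s , _)) (inj₁ eq) = contradiction (trans (sym eq) s) old≢new
      to (inj₂ (_ , t)) (inj₂ eq) = old-injective (trans (sym eq) t)
      from : Joins K f (old a) (new e) → v ≡ a → Incident K (old v) f
      from (inj₁ (s , _)) refl = inj₁ s
      from (inj₂ (_ , t)) refl = inj₂ t

fromInjection : ∀ {m n} (f : Fin m → Fin n) → (∀ {i j} → f i ≡ f j → i ≡ j) →
  (∀ y → ∃ λ x → f x ≡ y) → Fin m ↔ Fin n
fromInjection f injective surjective = ⤖⇒↔ (mk⤖ (injective , strictlySurjective⇒surjective surjective))

module _ {n} {P : Pred (Fin n) 0ℓ} (P? : Decidable P) where

  members : List (Fin n)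
  members = filter P? (allFin n)

  member : ∀ i → P (lookup members i)
  member i = proj₂ (∈ₚ.∈-filter⁻ P? {xs = allFin n} (∈ₚ.∈-lookup i))

  members-unique : Unique members
  members-unique = Uniqueₚ.filter⁺ P? (Uniqueₚ.allFin⁺ n)

  position : ∀ v → P v → ∃ λ i → lookup members i ≡ v
  position v Pv = index v∈ , sym (lookup-index v∈)
    where
    v∈ : v ∈ members
    v∈ = ∈ₚ.∈-filter⁺ P? (∈ₚ.∈-allFin v) Pv

lookup-injective : ∀ {A : Set} {xs : List A} → Unique xs → ∀ {i j} → lookup xs i ≡ lookup xs j → i ≡ j
lookup-injective (_ AllPairs.∷ _)      {zero}  {zero}  _  = refl
lookup-injective (x# AllPairs.∷ _)     {zero}  {suc j} eq = contradiction eq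
  (All.lookup x# (∈ₚ.∈-lookup j))
lookup-injective (x# AllPairs.∷ _)     {suc i} {zero}  eq = contradiction (sym eq)
  (All.lookup x# (∈ₚ.∈-lookup i))
lookup-injective (_ AllPairs.∷ unique) {suc i} {suc j} eq = cong suc (lookup-injective unique eq)

length≡2 : ∀ {A : Set} (xs : List A) → length xs ≡ 2 → ∃ λ a → ∃ λ b → xs ≡ a ∷ b ∷ []
length≡2 (a ∷ b ∷ []) refl = a , b , refl

module _ (G : Multigraph) where

  incident-joins : ∀ {v e} → Incident G v e → ∃ λ u → Joins G e v u
  incident-joins (inj₁ refl) = _ , inj₁ (refl , refl)
  incident-joins (inj₂ refl) = _ , inj₂ (refl , refl)

  joins-incident : ∀ {e u v} → Joins G e u v → Incident G u e
  joins-incident (inj₁ (s , _)) = inj₁ s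
  joins-incident (inj₂ (_ , t)) = inj₂ t

  record TwoEdges (v : Vertex G) : Set where
    field
      first second : Edge G
      distinct     : first ≢ second
      at-first     : Incident G v first
      at-second    : Incident G v second
      exhaustive   : ∀ e → Incident G v e → e ≡ first ⊎ e ≡ second

  twoEdges : ∀ v → degree G v ≡ 2 → TwoEdges v
  twoEdges v deg≡2 with length≡2 (members (incident? G v)) deg≡2
  ... | a , b , eq = record
    { first = a ; second = b
    ; distinct   = a≢b (subst Unique eq (members-unique (incident? G v)))
    ; at-first   = incident (subst (a ∈_) (sym eq) (here refl))
    ; at-second  = incident (subst (b ∈_) (sym eq) (there (here refl)))
    ; exhaustive = λ e i → split (subst (e ∈_) eq (∈ₚ.∈-filter⁺ (incident? G v) (∈ₚ.∈-allFin e) i))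
    }
    where
    a≢b : Unique (a ∷ b ∷ []) → a ≢ b
    a≢b ((a≢b All.∷ _) AllPairs.∷ _) = a≢b

    incident : ∀ {e} → e ∈ members (incident? G v) → Incident G v e
    incident e∈ = proj₂ (∈ₚ.∈-filter⁻ (incident? G v) {xs = allFin (size G)} e∈)

    split : ∀ {e} → e ∈ a ∷ b ∷ [] → e ≡ a ⊎ e ≡ b
    split (here eq)         = inj₁ eq
    split (there (here eq)) = inj₂ eq

  -- Two parallel edges to a vertex of degree 2 carry no path between other vertices.
  parallel⇒2+λ≤degree : ∀ {c w e f} → degree G w ≡ 2 → Joins G e c w → Joins G f c w → e ≢ f →
    ∀ {v} → v ≢ c → v ≢ w → 2 + localEdgeConnectivity G c v ≤ degree G c
  parallel⇒2+λ≤degree {c} {w} {e} {f} deg≡2 je jf e≢f {v} v≢c v≢w =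
    ℕₚ.≤-trans (ℕₚ.+-monoʳ-≤ 2 (λ≤cut G W L crosses⇒∈L separated)) counted
    where
    near? : ∀ x → Dec (x ≡ c ⊎ x ≡ w)
    near? x = (x Finₚ.≟ c) ⊎-dec (x Finₚ.≟ w)

    W : Vertex G → Bool
    W x = does (near? x)

    L? : ∀ g → Dec (Incident G c g × g ≢ e × g ≢ f)
    L? g = incident? G c g ×-dec ¬? (g Finₚ.≟ e) ×-dec ¬? (g Finₚ.≟ f)

    L : List (Edge G)
    L = filter L? (allFin (size G))

    separated : W c ≢ W v
    separated eq with trans (sym (dec-true (near? c) (inj₁ refl)))
      (trans eq (dec-false (near? v) [ v≢c , v≢w ]′))
    ... | ()

    uncrossed : ∀ {g} → Joins G g c w → ¬ Crosses G W g
    uncrossed j crosses with trans (dec-true (near? c) (inj₁ refl))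
      (sym (dec-true (near? w) (inj₂ refl)))
    uncrossed (inj₁ (refl , refl)) crosses | eq = crosses eq
    uncrossed (inj₂ (refl , refl)) crosses | eq = crosses (sym eq)

    open TwoEdges (twoEdges w deg≡2) using (exhaustive)

    at-w : ∀ {g} → Incident G w g → g ≡ e ⊎ g ≡ f
    at-w {g} i with exhaustive _ (joins-incident (joins-sym G je))
                  | exhaustive _ (joins-incident (joins-sym G jf)) | exhaustive g i
    ... | inj₁ refl | inj₁ refl | _         = contradiction refl e≢f
    ... | inj₂ refl | inj₂ refl | _         = contradiction refl e≢f
    ... | inj₁ refl | inj₂ refl | g≡        = g≡
    ... | inj₂ refl | inj₁ refl | g≡        = Sum.swap g≡

    ends-near : ∀ g → Crosses G W g → Incident G c g ⊎ Incident G w g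
    ends-near g crosses with near? (source G g) | near? (target G g)
    ... | yes (inj₁ s) | _            = inj₁ (inj₁ s)
    ... | yes (inj₂ s) | _            = inj₂ (inj₁ s)
    ... | no _         | yes (inj₁ t) = inj₁ (inj₂ t)
    ... | no _         | yes (inj₂ t) = inj₂ (inj₂ t)
    ... | no ¬s        | no ¬t        = contradiction
      (trans (dec-false (near? (source G g)) ¬s) (sym (dec-false (near? (target G g)) ¬t))) crosses

    crosses⇒∈L : ∀ g → Crosses G W g → g ∈ L
    crosses⇒∈L g crosses with ends-near g crosses
    ... | inj₁ i = ∈ₚ.∈-filter⁺ L? (∈ₚ.∈-allFin g)
        (i , (λ { refl → uncrossed je crosses }) , λ { refl → uncrossed jf crosses })
    ... | inj₂ i with at-w i
    ...   | inj₁ refl = contradiction crosses (uncrossed je)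
    ...   | inj₂ refl = contradiction crosses (uncrossed jf)

    counted : 2 + length L ≤ degree G c
    counted = begin
      2 + length L
        ≡⟨ cong₂ _+_ (sym (cong₂ _+_ (mass e) (mass f))) (length-filter-tabulate L? id) ⟩
      sum (λ g → 𝟙 (g Finₚ.≟ e)) + sum (λ g → 𝟙 (g Finₚ.≟ f)) + sum (𝟙 ∘ L?)
        ≡⟨ cong (_+ sum (𝟙 ∘ L?)) (∑-distrib-+ (λ g → 𝟙 (g Finₚ.≟ e)) (λ g → 𝟙 (g Finₚ.≟ f))) ⟨
      sum (λ g → 𝟙 (g Finₚ.≟ e) + 𝟙 (g Finₚ.≟ f)) + sum (𝟙 ∘ L?)
        ≡⟨ ∑-distrib-+ (λ g → 𝟙 (g Finₚ.≟ e) + 𝟙 (g Finₚ.≟ f)) (𝟙 ∘ L?) ⟨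
      sum (λ g → 𝟙 (g Finₚ.≟ e) + 𝟙 (g Finₚ.≟ f) + 𝟙 (L? g))
        ≤⟨ ∑-mono (λ g → pointwise g (g Finₚ.≟ e) (g Finₚ.≟ f)) ⟩
      sum (λ g → 𝟙 (incident? G c g))
        ≡⟨ degree-sum G c ⟨
      degree G c ∎
      where
      open ℕₚ.≤-Reasoning
      mass : ∀ e → sum (λ g → 𝟙 (g Finₚ.≟ e)) ≡ 1
      mass e = trans (∑-single (λ g → 𝟙 (g Finₚ.≟ e)) e (λ g → 𝟙-no (g Finₚ.≟ e)))
        (𝟙-yes (e Finₚ.≟ e) refl)

      pointwise : ∀ g (e? : Dec (g ≡ e)) (f? : Dec (g ≡ f)) → 𝟙 e? + 𝟙 f? + 𝟙 (L? g) ≤ 𝟙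
        (incident? G c g)
      pointwise g (yes refl) (yes refl) = contradiction refl e≢f
      pointwise g (yes refl) (no _) = ℕₚ.≤-reflexive
        (trans (cong suc (𝟙-no (L? g) λ (_ , g≢e , _) → g≢e refl))
        (sym (𝟙-yes (incident? G c g) (joins-incident je))))
      pointwise g (no _) (yes refl) = ℕₚ.≤-reflexive
        (trans (cong suc (𝟙-no (L? g) λ (_ , _ , g≢f) → g≢f refl))
        (sym (𝟙-yes (incident? G c g) (joins-incident jf))))
      pointwise g (no g≢e) (no g≢f) = ℕₚ.≤-reflexive
        (𝟙-cong (L? g) (incident? G c g) proj₁ (_, g≢e , g≢f))

-- The inverse of subdivision: the vertices outside C become edges.
module Unsubdivide (G : Multigraph) {C : Pred (Vertex G) 0ℓ} (C? : Decidable C)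
  (degree-outside : ∀ v → ¬ C v → degree G v ≡ 2)
  (bipartite : ∀ e → ∃ λ c → ∃ λ w → C c × ¬ C w × Joins G e c w)
  (simple : ∀ {c w e f} → C c → ¬ C w → Joins G e c w → Joins G f c w → e ≡ f) where

  private
    ¬C? : Decidable (¬_ ∘ C)
    ¬C? v = ¬? (C? v)

    p m : ℕ
    p = length (members C?)
    m = length (members ¬C?)

    inside : Fin p → Vertex G
    inside = lookup (members C?)

    outside : Fin m → Vertex G
    outside = lookup (members ¬C?)

    at : ∀ j → TwoEdges G (outside j)
    at j = twoEdges G (outside j) (degree-outside (outside j) (member ¬C? j))

    open module At j = TwoEdges (at j)

    inner outer : Edge G → Vertex G
    inner e = proj₁ (bipartite e)
    outer e = proj₁ (proj₂ (bipartite e))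

    inner∈ : ∀ e → C (inner e)
    inner∈ e = proj₁ (proj₂ (proj₂ (bipartite e)))

    outer∉ : ∀ e → ¬ C (outer e)
    outer∉ e = proj₁ (proj₂ (proj₂ (proj₂ (bipartite e))))

    inner-outer : ∀ e → Joins G e (inner e) (outer e)
    inner-outer e = proj₂ (proj₂ (proj₂ (proj₂ (bipartite e))))

    outer-unique : ∀ {e w} → ¬ C w → Incident G w e → outer e ≡ w
    outer-unique {e} {w} w∉ i with incident-joins G i
    ... | _ , j with joins-ends G (inner-outer e) j
    ...   | inj₁ refl = contradiction (inner∈ e) w∉
    ...   | inj₂ refl = refl

    outer-first : ∀ j → outer (first j) ≡ outside j
    outer-first j = outer-unique (member ¬C? j) (at-first j)

    outer-second : ∀ j → outer (second j) ≡ outside j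
    outer-second j = outer-unique (member ¬C? j) (at-second j)

    pos : Edge G → Fin p
    pos e = proj₁ (position C? (inner e) (inner∈ e))

    inside-pos : ∀ e → inside (pos e) ≡ inner e
    inside-pos e = proj₂ (position C? (inner e) (inner∈ e))

  H : Multigraph
  H = record
    { order    = p
    ; size     = m
    ; source   = pos ∘ first
    ; target   = pos ∘ second
    ; loopless = λ j eq → distinct j (simple (inner∈ (first j)) (member ¬C? j)
        (joins-ends-≡ G (inner-outer (first j)) refl (outer-first j))
        (joins-ends-≡ G (inner-outer (second j))
          (trans (sym (inside-pos (second j)))
            (trans (cong inside (sym eq)) (inside-pos (first j)))) (outer-second j)))
    }

  private
    K = subdivide H
    open Subdivision H

    inside-injective : ∀ {i j} → inside i ≡ inside j → i ≡ j
    inside-injective = lookup-injective (members-unique C?)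

    outside-injective : ∀ {i j} → outside i ≡ outside j → i ≡ j
    outside-injective = lookup-injective (members-unique ¬C?)

    vertexOf : Vertex K → Vertex G
    vertexOf = [ inside , outside ]′ ∘ splitAt p

    edgeOf : Edge K → Edge G
    edgeOf = [ first , second ]′ ∘ splitAt m

    vertexOf-old : ∀ i → vertexOf (old i) ≡ inside i
    vertexOf-old i = cong [ inside , outside ]′ (Finₚ.splitAt-↑ˡ p i m)

    vertexOf-new : ∀ j → vertexOf (new j) ≡ outside j
    vertexOf-new j = cong [ inside , outside ]′ (Finₚ.splitAt-↑ʳ p m j)

    edgeOf-sourceHalf : ∀ j → edgeOf (sourceHalf j) ≡ first j
    edgeOf-sourceHalf j = cong [ first , second ]′ (Finₚ.splitAt-↑ˡ m j m)

    edgeOf-targetHalf : ∀ j → edgeOf (targetHalf j) ≡ second j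
    edgeOf-targetHalf j = cong [ first , second ]′ (Finₚ.splitAt-↑ʳ m m j)

    vertexOf-injective : ∀ {x y} → vertexOf x ≡ vertexOf y → x ≡ y
    vertexOf-injective {x} {y} eq with splitAt p x | Finₚ.join-splitAt p m x | splitAt p
      y | Finₚ.join-splitAt p m y
    ... | inj₁ i | refl | inj₁ j | refl = cong old (inside-injective eq)
    ... | inj₂ i | refl | inj₂ j | refl = cong new (outside-injective eq)
    ... | inj₁ i | _    | inj₂ j | _    = contradiction (subst C eq (member C? i)) (member ¬C? j)
    ... | inj₂ i | _    | inj₁ j | _    = contradiction (subst C (sym eq) (member C? j)) (member ¬C? i)

    vertexOf-surjective : ∀ v → ∃ λ x → vertexOf x ≡ v
    vertexOf-surjective v with C? v
    ... | yes v∈ with position C? v v∈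
    ...   | i , eq = old i , trans (vertexOf-old i) eq
    vertexOf-surjective v | no v∉ with position ¬C? v v∉
    ...   | j , eq = new j , trans (vertexOf-new j) eq

    same-outer : ∀ {i j} → outer (first i) ≡ outer (second j) → i ≡ j
    same-outer {i} {j} eq = outside-injective (trans (sym (outer-first i)) (trans eq (outer-second j)))

    edgeOf-injective : ∀ {x y} → edgeOf x ≡ edgeOf y → x ≡ y
    edgeOf-injective {x} {y} eq with splitAt m x | Finₚ.join-splitAt m m x | splitAt m
      y | Finₚ.join-splitAt m m y
    ... | inj₁ i | refl | inj₁ j | refl = cong sourceHalf
        (outside-injective (trans (sym (outer-first i)) (trans (cong outer eq) (outer-first j))))
    ... | inj₂ i | refl | inj₂ j | refl = cong targetHalf
        (outside-injective (trans (sym (outer-second i)) (trans (cong outer eq) (outer-second j))))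
    ... | inj₁ i | _    | inj₂ j | _    with same-outer {i} {j} (cong outer eq)
    ...   | refl = contradiction eq (distinct i)
    edgeOf-injective {x} {y} eq | inj₂ i | _ | inj₁ j | _ with same-outer {j} {i} (cong outer (sym eq))
    ...   | refl = contradiction (sym eq) (distinct i)

    edgeOf-surjective : ∀ e → ∃ λ x → edgeOf x ≡ e
    edgeOf-surjective e with position ¬C? (outer e) (outer∉ e)
    ... | j , eq with exhaustive j e (subst (λ w → Incident G w e) (sym eq)
        (joins-incident G (joins-sym G (inner-outer e))))
    ...   | inj₁ refl = sourceHalf j , edgeOf-sourceHalf j
    ...   | inj₂ refl = targetHalf j , edgeOf-targetHalf j

    K≅G : K ≅ G
    K≅G = record
      { vertexBijection = fromInjection vertexOf vertexOf-injective vertexOf-surjective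
      ; edgeBijection   = fromInjection edgeOf edgeOf-injective edgeOf-surjective
      ; incidence       = λ f → incidence (half f .proj₂ .proj₂)
      }
      where
      joined : ∀ {f g j} → edgeOf f ≡ g → (outer-g : outer g ≡ outside j) → source K f ≡ old
        (pos g) → target K f ≡ new j →
        Joins G (edgeOf f) (vertexOf (source K f)) (vertexOf (target K f))
      joined {g = g} {j} refl outer-g s t = joins-ends-≡ G (inner-outer g)
        (sym (trans (cong vertexOf s) (trans (vertexOf-old (pos g)) (inside-pos g))))
        (trans outer-g (sym (trans (cong vertexOf t) (vertexOf-new j))))

      incidence : ∀ {f e a} → Half f e a → Joins G (edgeOf f) (vertexOf (source K f))
        (vertexOf (target K f))
      incidence (isSource j) = joined {g = first j} {j} (edgeOf-sourceHalf j) (outer-first j)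
        (source-sourceHalf j) (target-sourceHalf j)
      incidence (isTarget j) = joined {g = second j} {j} (edgeOf-targetHalf j) (outer-second j)
        (source-targetHalf j) (target-targetHalf j)

  G≅subdivideH : G ≅ subdivide H
  G≅subdivideH = ≅-sym K≅G

  representative : Vertex H → Vertex G
  representative = inside

  representative∈ : ∀ h → C (representative h)
  representative∈ = member C?

  representative-injective : ∀ {h h′} → representative h ≡ representative h′ → h ≡ h′
  representative-injective = inside-injective

  onVertex-representative : ∀ h → _≅_.onVertex G≅subdivideH (representative h) ≡ old h
  onVertex-representative h = trans (cong (_≅_.onVertex G≅subdivideH) (sym (vertexOf-old h)))
    (Inverse.strictlyInverseʳ (_≅_.vertexBijection K≅G) (old h))

  degree-representative : ∀ h → degree G (representative h) ≡ degree H h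
  degree-representative h = trans (iso-degree G≅subdivideH (representative h))
    (trans (cong (degree (subdivide H)) (onVertex-representative h)) (degree-old h))

  λ-representative : ∀ {h h′} → h ≢ h′ →
    localEdgeConnectivity G (representative h) (representative h′) ≤ localEdgeConnectivity H h h′
  λ-representative {h} {h′} h≢h′ = ℕₚ.≤-trans (iso-λ G≅subdivideH (h≢h′ ∘ representative-injective))
    (subst₂ (λ x y → localEdgeConnectivity (subdivide H) x y ≤ localEdgeConnectivity H h h′)
      (sym (onVertex-representative h)) (sym (onVertex-representative h′)) (λ-coarsen h≢h′))

DegreesIn : ℕ → Multigraph → Set
DegreesIn d H = ∀ v → d ≤ degree H v × degree H v ≤ suc d

degreesIn⇒nearlyRegular : ∀ {d} H → Vertex H → DegreesIn d H → NearlyRegular H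
degreesIn⇒nearlyRegular {d} H v deg = ℕₚ.m≤n+o⇒m∸n≤o (maxDegree H) (minDegree H) (ℕₚ.≤-trans
  (max≤v⁺ {xs = degrees H} z≤n (Allₚ.map⁺ (All.tabulate λ {u} _ → proj₂ (deg u))))
  (ℕₚ.≤-trans (ℕₚ.≤-reflexive (ℕₚ.+-comm 1 d)) (ℕₚ.+-monoˡ-≤ 1
    (v≤min⁺ {xs = degrees H} (ℕₚ.≤-trans (proj₁ (deg v)) (degree≤size H v))
      (Allₚ.map⁺ (All.tabulate λ {u} _ → proj₁ (deg u)))))))

nearlyRegular⇒degreesIn : ∀ H → NearlyRegular H → DegreesIn (minDegree H) H
nearlyRegular⇒degreesIn H near v = All.lookup (min≤xs (size H) (degrees H)) deg∈ ,
  ℕₚ.≤-trans (All.lookup (xs≤max 0 (degrees H)) deg∈)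
    (ℕₚ.≤-trans (ℕₚ.m≤n+m∸n (maxDegree H) (minDegree H))
      (ℕₚ.≤-trans (ℕₚ.+-monoʳ-≤ (minDegree H) near) (ℕₚ.≤-reflexive (ℕₚ.+-comm (minDegree H) 1))))
  where
  deg∈ : degree H v ∈ degrees H
  deg∈ = ∈ₚ.∈-map⁺ (degree H) (∈ₚ.∈-allFin v)

quotient-unique : ∀ p {d D a A} → p * d + a ≡ p * D + A → a ≤ p → 1 ≤ A → A < p → d ≡ D × a ≡ A
quotient-unique p {d} {D} {a} {A} eq a≤p 1≤A A<p with ℕₚ.<-cmp d D
... | tri≈ _ refl _ = refl , ℕₚ.+-cancelˡ-≡ (p * d) a A eq
... | tri< d<D _ _ = contradiction eq (ℕₚ.<⇒≢ (ℕₚ.≤-<-trans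
  (ℕₚ.≤-trans (ℕₚ.+-monoʳ-≤ (p * d) a≤p) (ℕₚ.≤-reflexive
    (trans (ℕₚ.+-comm (p * d) p) (sym (ℕₚ.*-suc p d)))))
  (ℕₚ.≤-<-trans (ℕₚ.*-monoʳ-≤ p d<D) (ℕₚ.m<m+n (p * D) 1≤A))))
... | tri> _ _ D<d = contradiction (sym eq) (ℕₚ.<⇒≢ (ℕₚ.<-≤-trans (ℕₚ.+-monoʳ-< (p * D) A<p)
  (ℕₚ.≤-trans (ℕₚ.≤-reflexive (trans (ℕₚ.+-comm (p * D) p) (sym (ℕₚ.*-suc p D))))
    (ℕₚ.≤-trans (ℕₚ.*-monoʳ-≤ p D<d) (ℕₚ.m≤m+n (p * d) a)))))

module Reconstruction (G : Multigraph) .{{_ : NonTrivial (order G)}} (minimal : MinimallyTwoEdgeConnected G)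
  {q : ℕ} (tight : Bounds.Tight G minimal q) (2≤p : 2 ≤ Analysis.p G minimal) where

  open Analysis G minimal
  open Bounds G minimal
  open Tight tight

  private
    outsideEnds : Edge G → ℕ
    outsideEnds e = 𝟙 (¬? (C? (source G e))) + 𝟙 (¬? (C? (target G e)))

    ∑outsideEnds : sum outsideEnds ≡ size G
    ∑outsideEnds = begin
      sum outsideEnds
        ≡⟨ weighted-handshake G (λ v → 𝟙 (¬? (C? v))) ⟨
      sum (λ v → 𝟙 (¬? (C? v)) * degree G v)
        ≡⟨ sum-cong-≗ two ⟩
      sum (λ v → 2 * 𝟙 (¬? (C? v)))
        ≡⟨ *-distribˡ-sum 2 (λ v → 𝟙 (¬? (C? v))) ⟨
      2 * sum (λ v → 𝟙 (¬? (C? v)))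
        ≡⟨ cong (2 *_) (length-filter-tabulate (λ v → ¬? (C? v)) id) ⟨
      2 * o
        ≡⟨ size≡ ⟨
      size G ∎
      where
      open ≡-Reasoning
      two : ∀ v → 𝟙 (¬? (C? v)) * degree G v ≡ 2 * 𝟙 (¬? (C? v))
      two v with C? v
      ... | yes _   = refl
      ... | no u₀≁v = trans (ℕₚ.+-identityʳ _) (degree-outside v u₀≁v)

    1≤outsideEnds : ∀ e → 1 ≤ outsideEnds e
    1≤outsideEnds e with C? (source G e) | C? (target G e)
    ... | no _  | _     = s≤s z≤n
    ... | yes _ | no _  = s≤s z≤n
    ... | yes s | yes t = contradiction (~-trans (~-sym s) t) (ends≁ e)

    outsideEnds≡1 : ∀ e → 1 ≡ outsideEnds e
    outsideEnds≡1 = ∑-mono-tight 1≤outsideEnds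
      (ℕₚ.≤-reflexive (trans ∑outsideEnds (sym (trans (∑-const (size G) 1) (ℕₚ.*-identityʳ _)))))

    bipartite : ∀ e → ∃ λ c → ∃ λ w → u₀ ~ c × ¬ u₀ ~ w × Joins G e c w
    bipartite e with C? (source G e) | C? (target G e) | outsideEnds≡1 e
    ... | yes s | no t  | _ = _ , _ , s , t , inj₁ (refl , refl)
    ... | no s  | yes t | _ = _ , _ , t , s , inj₂ (refl , refl)

    anotherInside : ∀ c → u₀ ~ c → ∃ λ v → u₀ ~ v × v ≢ c
    anotherInside c u₀~c with Finₚ.any? (λ v → C? v ×-dec ¬? (v Finₚ.≟ c))
    ... | yes v = v
    ... | no none = contradiction p≤1 (ℕₚ.<⇒≱ 2≤p)
      where
      p≤1 : p ≤ 1
      p≤1 = ℕₚ.≤-trans (ℕₚ.≤-reflexive (∑-single (𝟙 ∘ C?) c λ v v≢c → 𝟙-no (C? v) λ u₀~v → none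
        (v , u₀~v , v≢c)))
        (𝟙≤1 (C? c))

    simple : ∀ {c w e f} → u₀ ~ c → ¬ u₀ ~ w → Joins G e c w → Joins G f c w → e ≡ f
    simple {c} {w} {e} {f} u₀~c u₀≁w je jf with e Finₚ.≟ f
    ... | yes e≡f = e≡f
    ... | no e≢f with anotherInside c u₀~c
    ...   | v , u₀~v , v≢c = contradiction (ℕₚ.≤-trans (ℕₚ.≤-trans (ℕₚ.+-monoʳ-≤ 2 ceiling)
              (subst (λ l → 2 + l ≤ degree G c) (λ≡min c v u₀~c u₀~v (v≢c ∘ sym))
                (parallel⇒2+λ≤degree G (degree-outside w u₀≁w) je jf e≢f v≢c λ { refl → u₀≁w u₀~v })))
              (ℕₚ.m≤n+m∸n (degree G c) 1)) (ℕₚ.<-irrefl refl)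
      where
      ceiling : degree G c ∸ 1 ≤ degree G c ⊓ degree G v
      ceiling = ℕₚ.⊓-glb (ℕₚ.m∸n≤m (degree G c) 1) (ℕₚ.≤-trans
        (ℕₚ.∸-monoˡ-≤ 1 (proj₂ (degree-inside c u₀~c))) (proj₁ (degree-inside v u₀~v)))

  open Unsubdivide G C? degree-outside bipartite simple public

  degreesIn : DegreesIn (2 + q) H
  degreesIn h = subst (λ d → 2 + q ≤ d × d ≤ 3 + q) (degree-representative h)
    (degree-inside (representative h) (representative∈ h))

  ideal : IdeallyEdgeConnected H
  ideal h h′ h≢h′ = ℕₚ.≤-antisym (ℕₚ.⊓-glb (λ≤degreeˡ H h≢h′) (λ≤degreeʳ H h≢h′))
    (subst (_≤ localEdgeConnectivity H h h′)
      (trans (λ≡min _ _ (representative∈ h) (representative∈ h′) (h≢h′ ∘ representative-injective))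
        (cong₂ _⊓_ (degree-representative h) (degree-representative h′)))
      (λ-representative h≢h′))

  order≡ : order H ≡ p
  order≡ = length-filter-tabulate C? id

  nearlyRegular : NearlyRegular H
  nearlyRegular = degreesIn⇒nearlyRegular H (Fin.cast (sym order≡) (Fin.fromℕ< 2≤p)) degreesIn

subdivided-order : ∀ {G} H → G ≅ subdivide H → order G ≡ order H + size H
subdivided-order H iso = ↔⇒≡ (_≅_.vertexBijection iso)

module SubdivisionCount (G : Multigraph) .{{_ : NonTrivial (order G)}} (minimal : MinimallyTwoEdgeConnected G)
  (H : Multigraph) (ideal : IdeallyEdgeConnected H) (iso : G ≅ subdivide H) where

  open _≅_ iso
  open Subdivision H
  open Bounds G minimal using (S)

  private
    p m : ℕ
    p = order H
    m = size H

    K = subdivide H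

    lower : Vertex H ⊎ Edge H → Vertex H ⊎ Edge H → ℕ
    lower (inj₁ a) (inj₁ b) = degree H a ⊓ degree H b
    lower (inj₁ _) (inj₂ _) = 2
    lower (inj₂ _) _        = 2

    lower-sym : ∀ x y → lower x y ≡ lower y x
    lower-sym (inj₁ a) (inj₁ b) = ℕₚ.⊓-comm (degree H a) (degree H b)
    lower-sym (inj₁ _) (inj₂ _) = refl
    lower-sym (inj₂ _) (inj₁ _) = refl
    lower-sym (inj₂ _) (inj₂ _) = refl

    kind : Vertex G → Vertex H ⊎ Edge H
    kind u = splitAt p (onVertex u)

    onVertex-kind : ∀ {u a} → kind u ≡ inj₁ a → onVertex u ≡ old a
    onVertex-kind {u} eq = trans (sym (Finₚ.join-splitAt p m (onVertex u))) (cong (Fin.join p m) eq)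

    lower≤λ : ∀ u v → u ≢ v → lower (kind u) (kind v) ≤ localEdgeConnectivity G u v
    lower≤λ u v u≢v = go (kind u) (kind v) refl refl
      where
      back : K ≅ G
      back = ≅-sym iso

      go : ∀ x y → kind u ≡ x → kind v ≡ y → lower x y ≤ localEdgeConnectivity G u v
      go (inj₁ _) (inj₂ _) _ _ = two≤λ G (proj₁ minimal) u≢v
      go (inj₂ _) _        _ _ = two≤λ G (proj₁ minimal) u≢v
      go (inj₁ a) (inj₁ b) eqa eqb = ℕₚ.≤-trans (ℕₚ.≤-reflexive (sym (ideal a b a≢b)))
        (ℕₚ.≤-trans (λ-refine a≢b) (subst₂ (λ x y → localEdgeConnectivity K (old a) (old b) ≤
          localEdgeConnectivity G x y)
          (return eqa) (return eqb) (iso-λ back (a≢b ∘ old-injective))))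
        where
        a≢b : a ≢ b
        a≢b refl = u≢v (onVertex-injective iso
          (trans (onVertex-kind {u} eqa) (sym (onVertex-kind {v} eqb))))

        return : ∀ {w c} → kind w ≡ inj₁ c → _≅_.onVertex back (old c) ≡ w
        return {w} eq = trans (cong (_≅_.onVertex back) (sym (onVertex-kind {w} eq)))
          (Inverse.strictlyInverseʳ vertexBijection w)

    ∑-kind : ∀ (f : Vertex H ⊎ Edge H → ℕ) → sum (f ∘ kind) ≡ sum (f ∘ inj₁) + sum (f ∘ inj₂)
    ∑-kind f = trans (sym (sum-permute (f ∘ splitAt p) vertexBijection))
      (trans (∑-split p (f ∘ splitAt p))
      (cong₂ _+_ (sum-cong-≗ λ a → cong f (Finₚ.splitAt-↑ˡ p a m))
        (sum-cong-≗ λ e → cong f (Finₚ.splitAt-↑ʳ p m e))))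

    degreeMin : ℕ
    degreeMin = sum λ a → sum λ b → degree H a ⊓ degree H b

    ∑∑lower : sum (λ u → sum λ v → lower (kind u) (kind v)) ≡ degreeMin + p * (m * 2) + m *
      (p * 2 + m * 2)
    ∑∑lower = trans (sum-cong-≗ λ u → ∑-kind (lower (kind u)))
      (trans (∑-kind λ x → sum (λ a → lower x (inj₁ a)) + sum (λ e → lower x (inj₂ e)))
        (cong₂ _+_
          (trans (∑-distrib-+ (λ a → sum λ b → degree H a ⊓ degree H b) (λ _ → sum {m} λ _ → 2))
            (cong (degreeMin +_) (trans (sum-cong-≗ {p} λ _ → ∑-const m 2) (∑-const p (m * 2)))))
          (trans (sum-cong-≗ {m} λ _ → cong₂ _+_ (∑-const p 2) (∑-const m 2))
            (∑-const m (p * 2 + m * 2)))))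

    ∑diagonal : sum (λ u → lower (kind u) (kind u)) ≡ 2 * m + m * 2
    ∑diagonal = trans (∑-kind λ x → lower x x) (cong₂ _+_
      (trans (sum-cong-≗ λ a → ℕₚ.⊓-idem (degree H a)) (handshake H)) (∑-const m 2))

    S≥ : degreeMin + p * (m * 2) + m * (p * 2 + m * 2) ≤ 2 * S + (2 * m + m * 2)
    S≥ = subst₂ _≤_ (trans (2*pairSum+diagonal (λ u v → lower (kind u) (kind v))
      (λ u v → lower-sym (kind u) (kind v))) ∑∑lower)
      (cong (2 * S +_) ∑diagonal) (ℕₚ.+-monoˡ-≤ (sum λ u → lower (kind u) (kind u))
        (ℕₚ.*-monoʳ-≤ 2 (pairSum-mono lower≤λ)))

  module _ {d : ℕ} (degreesIn : DegreesIn d H) where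

    private
      ε : Vertex H → ℕ
      ε a = degree H a ∸ d

      degree≡ : ∀ a → degree H a ≡ d + ε a
      degree≡ a = sym (ℕₚ.m+[n∸m]≡n (proj₁ (degreesIn a)))

      ε≤1 : ∀ a → ε a ≤ 1
      ε≤1 a = ℕₚ.m≤n+o⇒m∸n≤o (degree H a) d (ℕₚ.≤-trans (proj₂ (degreesIn a))
        (ℕₚ.≤-reflexive (ℕₚ.+-comm 1 d)))

      ⊓≡* : ∀ x y → x ≤ 1 → y ≤ 1 → x ⊓ y ≡ x * y
      ⊓≡* zero       y          _ _ = refl
      ⊓≡* (suc zero) zero       _ _ = refl
      ⊓≡* (suc zero) (suc zero) _ _ = refl
      ⊓≡* (suc zero) (suc (suc _)) _ (s≤s ())
      ⊓≡* (suc (suc _)) _ (s≤s ()) _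

      a : ℕ
      a = sum ε

      degreeMin≡ : degreeMin ≡ p * (p * d) + a * a
      degreeMin≡ = trans (sum-cong-≗ λ x → sum-cong-≗ λ y → trans (cong₂ _⊓_ (degree≡ x) (degree≡ y))
          (trans (sym (ℕₚ.+-distribˡ-⊓ d (ε x) (ε y))) (cong (d +_) (⊓≡* (ε x) (ε y) (ε≤1 x) (ε≤1 y)))))
        (trans (∑∑-distrib-+ (λ _ _ → d) (λ x y → ε x * ε y))
          (cong₂ _+_ (∑∑-const p d) (∑-product ε ε)))

    highDegree : ℕ
    highDegree = a

    high≤order : highDegree ≤ p
    high≤order = ℕₚ.≤-trans (∑-mono ε≤1) (ℕₚ.≤-reflexive (trans (∑-const p 1) (ℕₚ.*-identityʳ p)))

    degree-total : p * d + highDegree ≡ 2 * m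
    degree-total = trans (cong (_+ a) (sym (∑-const p d))) (trans (sym (∑-distrib-+ (λ _ → d) ε))
      (trans (sum-cong-≗ (sym ∘ degree≡)) (handshake H)))

    regular : highDegree ≡ 0 → Regular d H
    regular a≡0 v = trans (degree≡ v) (trans (cong (d +_) (∑≡0⇒ ε a≡0 v)) (ℕₚ.+-identityʳ d))

    attains : ∀ {n k τ} → n ≡ p + m → p * (p * 2) + τ + 2 * m ≡ p *
      (p * d) + highDegree * highDegree + 2 * p + 4 * k →
      n * (n * 2) + τ ≤ 2 * S + n * 2 + 4 * k
    attains {k = k} {τ} refl value = combine p m S degreeMin k τ
      (p * (p * d) + a * a) S≥ value degreeMin≡
      where
      combine : ∀ p m S M k τ v → M + p * (m * 2) + m * (p * 2 + m * 2) ≤ 2 * S + (2 * m + m * 2) →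
        p * (p * 2) + τ + 2 * m ≡ v + 2 * p + 4 * k → M ≡ v →
        (p + m) * ((p + m) * 2) + τ ≤ 2 * S + (p + m) * 2 + 4 * k
      combine p m S M k τ v S≥ value refl = ≤-certificate 0 (S≥ ⊕ ℕₚ.≤-reflexive value)
        (identity p m S M k τ)
        where
        identity : ∀ p m S M k τ →
          (p + m) * ((p + m) * 2) + τ + (2 * S + (2 * m + m * 2) + (M + 2 * p + 4 * k)) + 0 ≡
          2 * S + (p + m) * 2 + 4 * k + (M + p * (m * 2) + m * (p * 2 + m * 2) +
            (p * (p * 2) + τ + 2 * m))
        identity = solve-∀

    attains-at : ∀ {n k τ} D A → 1 ≤ A → A < p → p * D + A ≡ 2 * m → n ≡ p + m →
      p * (p * 2) + τ + 2 * m ≡ p * (p * D) + A * A + 2 * p + 4 * k → n * (n * 2) + τ ≤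
        2 * S + n * 2 + 4 * k
    attains-at {k = k} {τ} D A 1≤A A<p total n≡ value
      with quotient-unique p (trans degree-total (sym total)) high≤order 1≤A A<p
    ... | d≡D , a≡A = attains {k = k} n≡ (trans value
      (cong₂ (λ x y → p * (p * x) + y * y + 2 * p + 4 * k) (sym d≡D) (sym a≡A)))

-- Imported here because +_ would clash with sections of the natural addition above.
open import Data.Integer.Base as ℤ using (ℤ; +_)
import Data.Integer.Properties as ℤₚ
import Data.Integer.Tactic.RingSolver as ℤ-Solver
open import Data.Nat.Combinatorics using (_C_; nCk+nC[k+1]≡[n+1]C[k+1]; nC1≡n)
open import Data.Rational.Base as ℚ using (ℚ)
import Data.Rational.Properties as ℚₚ
open import Data.Rational.Unnormalised.Base as ℚᵘ using (mkℚᵘ; *≡*; *≤*)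
import Data.Rational.Unnormalised.Properties as ℚᵘₚ

-- Rational bounds

toℚᵘ-/ : ∀ i d → ℚ.toℚᵘ (i ℚ./ suc d) ℚᵘ.≃ mkℚᵘ i d
toℚᵘ-/ i d = ℚₚ.toℚᵘ-fromℚᵘ (mkℚᵘ i d)

/-mono-≤ : ∀ {i j} d .{{_ : NonZero d}} → i ℤ.≤ j → i ℚ./ d ℚ.≤ j ℚ./ d
/-mono-≤ {i} {j} (suc d) i≤j = ℚₚ.toℚᵘ-cancel-≤ (ℚᵘₚ.≤-respˡ-≃ (ℚᵘₚ.≃-sym (toℚᵘ-/ i d))
  (ℚᵘₚ.≤-respʳ-≃ (ℚᵘₚ.≃-sym (toℚᵘ-/ j d)) (*≤* (ℤₚ.*-monoʳ-≤-nonNeg (+ suc d) i≤j))))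

/-injective : ∀ {i j} d .{{_ : NonZero d}} → i ℚ./ d ≡ j ℚ./ d → i ≡ j
/-injective {i} {j} (suc d) eq with ℚᵘₚ.≃-trans (ℚᵘₚ.≃-sym (toℚᵘ-/ i d))
  (ℚᵘₚ.≃-trans (ℚₚ.toℚᵘ-cong eq) (toℚᵘ-/ j d))
... | *≡* eq′ = ℤₚ.*-cancelʳ-≡ i j (+ suc d) eq′

/-cross : ∀ {i j} d e .{{_ : NonZero d}} .{{_ : NonZero e}} → i ℤ.* + e ≡ j ℤ.* + d → i ℚ./ d ≡ j ℚ./ e
/-cross {i} {j} (suc d) (suc e) eq = ℚₚ.fromℚᵘ-cong {mkℚᵘ i d} {mkℚᵘ j e} (*≡* eq)

2+/ : ∀ i d .{{_ : NonZero d}} → + 2 ℚ./ 1 ℚ.+ i ℚ./ d ≡ (+ (2 * d) ℤ.+ i) ℚ./ d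
2+/ i (suc d) = ℚₚ.toℚᵘ-injective (ℚᵘₚ.≃-trans (ℚₚ.toℚᵘ-homo-+ (+ 2 ℚ./ 1) (i ℚ./ suc d))
  (ℚᵘₚ.≃-trans (ℚᵘₚ.+-cong (toℚᵘ-/ (+ 2) 0) (toℚᵘ-/ i d))
    (ℚᵘₚ.≃-trans (*≡* (cong₂ ℤ._*_ numerator (cong +_ (sym (ℕₚ.+-identityʳ (suc d))))))
      (ℚᵘₚ.≃-sym (toℚᵘ-/ (+ (2 * suc d) ℤ.+ i) d)))))
  where
  numerator : + 2 ℤ.* + suc d ℤ.+ i ℤ.* + 1 ≡ + (2 * suc d) ℤ.+ i
  numerator = cong₂ ℤ._+_ (sym (ℤₚ.pos-* 2 (suc d))) (ℤₚ.*-identityʳ i)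

2*[nC2] : ∀ n → 2 * (suc n C 2) ≡ suc n * n
2*[nC2] zero    = refl
2*[nC2] (suc n) = trans (cong (2 *_) (trans (sym (nCk+nC[k+1]≡[n+1]C[k+1] (suc n) 1))
  (cong (_+ suc n C 2) (nC1≡n (suc n)))))
  (trans (ℕₚ.*-distribˡ-+ 2 (suc n) (suc n C 2))
    (trans (cong (λ x → 2 * suc n + x) (2*[nC2] n)) (identity n)))
  where
  identity : ∀ n → 2 * suc n + suc n * n ≡ suc (suc n) * suc n
  identity = solve-∀

module _ (n : ℕ) .{{_ : NonTrivial n}} (S c : ℕ) where

  private
    instance
      _ = nC2≢0 n
      _ = 4n[n∸1]≢0 n

    average : ℚ
    average = + S ℚ./ (n C 2)

    4n[n∸1]≡ : ∀ n → 1 < n → 4 * n * (n ∸ 1) ≡ 8 * (n C 2)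
    4n[n∸1]≡ (suc n) _ = trans (ℕₚ.*-assoc 4 (suc n) n)
      (trans (cong (4 *_) (sym (2*[nC2] n))) (sym (ℕₚ.*-assoc 4 2 (suc n C 2))))

    average≡ : average ≡ + (8 * S) ℚ./ (4 * n * (n ∸ 1))
    average≡ = /-cross {+ S} {+ (8 * S)} (n C 2) (4 * n * (n ∸ 1))
      (trans (sym (ℤₚ.pos-* S (4 * n * (n ∸ 1))))
      (trans (cong +_ (trans (cong (S *_) (4n[n∸1]≡ n (nonTrivial⇒n>1 n))) (identity S (n C 2))))
        (ℤₚ.pos-* (8 * S) (n C 2))))
      where
      identity : ∀ S m → S * (8 * m) ≡ 8 * S * m
      identity = solve-∀

    bound≡ : bound n (+ c) ≡ + (2 * (4 * n * (n ∸ 1)) + c) ℚ./ (4 * n * (n ∸ 1))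
    bound≡ = 2+/ (+ c) (4 * n * (n ∸ 1))

    shifted : ∀ n → 1 < n → 2 * (4 * n * (n ∸ 1)) + c + 8 * n ≡ 8 * (n * n) + c
    shifted (suc n) _ = identity n c
      where
      identity : ∀ n c → 2 * (4 * suc n * n) + c + 8 * suc n ≡ 8 * (suc n * suc n) + c
      identity = solve-∀

    shift : 2 * (4 * n * (n ∸ 1)) + c + 8 * n ≡ 8 * (n * n) + c
    shift = shifted n (nonTrivial⇒n>1 n)

  average≤bound : 8 * S + 8 * n ≤ 8 * (n * n) + c → average ℚ.≤ bound n (+ c)
  average≤bound S≤ = subst₂ ℚ._≤_ (sym average≡) (sym bound≡)
    (/-mono-≤ {+ (8 * S)} {+ (2 * (4 * n * (n ∸ 1)) + c)} (4 * n * (n ∸ 1))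
    (ℤ.+≤+ (ℕₚ.+-cancelʳ-≤ (8 * n) (8 * S) (2 * (4 * n * (n ∸ 1)) + c)
      (ℕₚ.≤-trans S≤ (ℕₚ.≤-reflexive (sym shift))))))

  average≡bound⇒ : average ≡ bound n (+ c) → 8 * S + 8 * n ≡ 8 * (n * n) + c
  average≡bound⇒ eq = trans (cong (_+ 8 * n) (ℤₚ.+-injective {8 * S} {2 * (4 * n * (n ∸ 1)) + c}
    (/-injective {+ (8 * S)} {+ (2 * (4 * n * (n ∸ 1)) + c)} (4 * n * (n ∸ 1))
      (trans (sym average≡) (trans eq bound≡))))) shift

  average≡bound⇐ : 8 * S + 8 * n ≡ 8 * (n * n) + c → average ≡ bound n (+ c)
  average≡bound⇐ eq = trans average≡ (trans (cong (λ i → + i ℚ./ (4 * n * (n ∸ 1)))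
    (ℕₚ.+-cancelʳ-≡ (8 * n) (8 * S) (2 * (4 * n * (n ∸ 1)) + c) (trans eq (sym shift)))) (sym bound≡))

bound<9/4 : ∀ n .{{_ : NonTrivial n}} → bound n (+ ((n ∸ 2) * (n ∸ 2))) ℚ.< + 9 ℚ./ 4
bound<9/4 n = go n (nonTrivial⇒n>1 n)
  where
  go : ∀ n .{{_ : NonTrivial n}} → 1 < n → bound n (+ ((n ∸ 2) * (n ∸ 2))) ℚ.< + 9 ℚ./ 4
  go (suc (suc w)) _ = subst (ℚ._< + 9 ℚ./ 4) (sym (2+/ (+ (w * w)) D))
    (ℚₚ.toℚᵘ-cancel-< (ℚᵘₚ.<-respˡ-≃ (ℚᵘₚ.≃-sym (toℚᵘ-/ (+ (2 * D + w * w)) (D ∸ 1)))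
      (ℚᵘ.*<* (subst₂ ℤ._<_ (ℤₚ.pos-* (2 * D + w * w) 4) (ℤₚ.pos-* 9 D) (ℤ.+<+ numerators)))))
    where
    D = 4 * suc (suc w) * suc w
    numerators : (2 * (4 * suc (suc w) * suc w) + w * w) * 4 < 9 * (4 * suc (suc w) * suc w)
    numerators = ≤-certificate (12 * w + 7) (ℕₚ.≤-refl {0}) (solve (w ∷ []))

[n-2]² : ∀ n → 1 < n → (+ n ℤ.- + 2) ℤ.* (+ n ℤ.- + 2) ≡ + ((n ∸ 2) * (n ∸ 2))
[n-2]² (suc (suc w)) _ = trans (cong (λ i → i ℤ.* i) (ℤₚ.⊖-≥ {suc (suc w)} {2} (s≤s (s≤s z≤n))))
  (sym (ℤₚ.pos-* w w))
[n-2]² (suc zero) (s≤s ())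

integer-form : ∀ n b e c → n * n + e ≡ c + b * n → + n ℤ.* + n ℤ.- + b ℤ.* + n ℤ.+ + e ≡ + c
integer-form n b e c eq = trans
  (cong₂ (λ x y → x ℤ.- y ℤ.+ + e) (sym (ℤₚ.pos-* n n)) (sym (ℤₚ.pos-* b n)))
  (trans (swap (+ (n * n)) (+ (b * n)) (+ e))
    (trans (cong (λ x → + x ℤ.- + (b * n)) eq) (cancel (+ c) (+ (b * n)))))
  where
  swap : ∀ x y z → x ℤ.- y ℤ.+ z ≡ x ℤ.+ z ℤ.- y
  swap = ℤ-Solver.solve-∀
  cancel : ∀ x y → x ℤ.+ y ℤ.- y ≡ x
  cancel = ℤ-Solver.solve-∀

module Main (G : Multigraph) .{{_ : NonTrivial (order G)}} (minimal : MinimallyTwoEdgeConnected G) where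

  open Analysis G minimal
  open Bounds G minimal

  private
    n = order G
    λ̄ = averageEdgeConnectivity G
    S′ = sumₗ (map (uncurry (localEdgeConnectivity G)) (unorderedPairs n))

    S′≡S : S′ ≡ S
    S′≡S = sum-unorderedPairs (localEdgeConnectivity G)

  general-bound : λ̄ ℚ.≤ bound n ((+ n ℤ.- + 2) ℤ.* (+ n ℤ.- + 2)) ×
                  bound n ((+ n ℤ.- + 2) ℤ.* (+ n ℤ.- + 2)) ℚ.< + 9 ℚ./ 4
  general-bound rewrite [n-2]² n (nonTrivial⇒n>1 n) =
    average≤bound n S′ ((n ∸ 2) * (n ∸ 2)) (subst
      (λ S → 8 * S + 8 * n ≤ 8 * (n * n) + (n ∸ 2) * (n ∸ 2)) (sym S′≡S) 8S≤) , bound<9/4 n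

  private
    scale : ∀ {S n k c τ} → c + 16 * k ≡ 4 * τ → 2 * S + n * 2 + 4 * k ≤ n * (n * 2) + τ →
      8 * S + 8 * n ≤ 8 * (n * n) + c
    scale {S} {n} {k} {c} {τ} eq S≤ = ≤-certificate 0 (4 ⊗ S≤ ⊕ ℕₚ.≤-reflexive (sym eq))
      (solve (S ∷ n ∷ k ∷ c ∷ τ ∷ []))

    scale-reverse : ∀ {S n k c τ} → c + 16 * k ≡ 4 * τ → n * (n * 2) + τ ≤ 2 * S + n * 2 + 4 * k →
      8 * (n * n) + c ≤ 8 * S + 8 * n
    scale-reverse {S} {n} {k} {c} {τ} eq S≥ = ≤-certificate 0 (4 ⊗ S≥ ⊕ ℕₚ.≤-reflexive eq)
      (solve (S ∷ n ∷ k ∷ c ∷ τ ∷ []))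

    unscale : ∀ {S n k c τ} → c + 16 * k ≡ 4 * τ → 8 * (n * n) + c ≤ 8 * S + 8 * n → n *
      (n * 2) + τ ≤ 2 * S + n * 2 + 4 * k
    unscale {S} {n} {k} {c} {τ} eq S≥ = ℕₚ.*-cancelˡ-≤ {n * (n * 2) + τ} {2 * S + n * 2 + 4 * k} 4
      (≤-certificate 0 (S≥ ⊕ ℕₚ.≤-reflexive (sym eq)) (solve (S ∷ n ∷ k ∷ c ∷ τ ∷ [])))

  residue : ∀ k ℓ τ b e (Good : ℕ → ℕ → ℕ → Set) (Structure : Set) → n ≡ 4 * k + ℓ →
    (Xᶜ + 4 * p ≤ 2 * (4 * k + ℓ) → Outcome Good k τ p Xᶜ Qᶜ) →
    (X + 4 * p + 4 ≤ 2 * (4 * k + ℓ) → Q + 4 * k < X + τ) →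
    (∀ {q s} → Good p q s → q * p + s + 4 * p ≡ 2 * (4 * k + ℓ)) →
    b ≤ n → (4 * k + ℓ) * (4 * k + ℓ) + e + 16 * k ≡ 4 * τ + b * (4 * k + ℓ) →
    (∀ {q s} → Good p q s → Tight q → Structure) →
    (Structure → n * (n * 2) + τ ≤ 2 * S + n * 2 + 4 * k) →
    let B = bound n (+ n ℤ.* + n ℤ.- + b ℤ.* + n ℤ.+ + e) in λ̄ ℚ.≤ B × (λ̄ ≡ B ⇔ Structure)
  residue k ℓ τ b e Good Structure n≡ outcome loose balanced b≤n value construct count =
    subst (λ i → λ̄ ℚ.≤ bound n i × (λ̄ ≡ bound n i ⇔ Structure)) (sym (integer-form n b e c c≡))
      ( average≤bound n S′ c upper
      , mk⇔ extremal⇒structure structure⇒extremal )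
    where
    module R = Residue k ℓ τ n≡ Good outcome loose balanced

    c : ℕ
    c = n * n + e ∸ b * n

    c≡ : n * n + e ≡ c + b * n
    c≡ = sym (ℕₚ.m∸n+n≡m (ℕₚ.≤-trans (ℕₚ.*-monoˡ-≤ n b≤n) (ℕₚ.m≤m+n (n * n) e)))

    4τ≡ : c + 16 * k ≡ 4 * τ
    4τ≡ = ℕₚ.+-cancelʳ-≡ (b * n) (c + 16 * k) (4 * τ) (trans (regroup c (16 * k) (b * n))
      (trans (cong (λ x → x + 16 * k) (sym c≡))
        (subst (λ n → n * n + e + 16 * k ≡ 4 * τ + b * n) (sym n≡) value)))
      where
      regroup : ∀ c k b → c + k + b ≡ c + b + k
      regroup = solve-∀

    upper : 8 * S′ + 8 * n ≤ 8 * (n * n) + c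
    upper = subst (λ S → 8 * S + 8 * n ≤ 8 * (n * n) + c) (sym S′≡S)
      (scale {S} {n} {k} {c} {τ} 4τ≡ R.2S≤)

    extremal⇒structure : λ̄ ≡ bound n (+ c) → Structure
    extremal⇒structure eq = construct (R.good S≥) (R.tight S≥)
      where
      S≥ : n * (n * 2) + τ ≤ 2 * S + n * 2 + 4 * k
      S≥ = unscale {S} {n} {k} {c} {τ} 4τ≡ (ℕₚ.≤-reflexive (sym
        (subst (λ S → 8 * S + 8 * n ≡ 8 * (n * n) + c) S′≡S (average≡bound⇒ n S′ c eq))))

    structure⇒extremal : Structure → λ̄ ≡ bound n (+ c)
    structure⇒extremal structure = average≡bound⇐ n S′ c (ℕₚ.≤-antisym upper
      (subst (λ S → 8 * (n * n) + c ≤ 8 * S + 8 * n) (sym S′≡S)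
        (scale-reverse {S} {n} {k} {c} {τ} 4τ≡ (count structure))))

  private
    at-least : ∀ {k b} ℓ → n ≡ 4 * k + ℓ → b ≤ 4 * k → b ≤ n
    at-least {k} ℓ n≡ b≤4k = ℕₚ.≤-trans b≤4k (ℕₚ.≤-trans (ℕₚ.m≤m+n (4 * k) ℓ) (ℕₚ.≤-reflexive (sym n≡)))

    k≤4k : ∀ {a k} → a ≤ k → a ≤ 4 * k
    k≤4k a≤k = ℕₚ.≤-trans a≤k (ℕₚ.m≤m+n _ _)

    sizes : ∀ H → G ≅ subdivide H → ∀ {a} → order H ≡ a → size H ≡ n ∸ a
    sizes H iso refl = sym (trans (cong (_∸ order H) (subdivided-order H iso))
      (ℕₚ.m+n∸m≡n (order H) (size H)))

    size≡n∸k∸1 : ∀ H → G ≅ subdivide H → ∀ {k} → order H ≡ k + 1 → size H ≡ n ∸ k ∸ 1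
    size≡n∸k∸1 H iso {k} eq = trans (sizes H iso eq) (sym (ℕₚ.∸-+-assoc n k 1))

    at-k : ∀ {P m k} ℓ → P ≡ k → 4 * k + ℓ ≡ P + m → m ≡ 3 * k + ℓ
    at-k {m = m} {k} ℓ refl eq = ℕₚ.+-cancelˡ-≡ k m (3 * k + ℓ) (trans (sym eq) (identity k ℓ))
      where
      identity : ∀ k ℓ → 4 * k + ℓ ≡ k + (3 * k + ℓ)
      identity = solve-∀

    at-k+1 : ∀ {P m k} ℓ → P ≡ k + 1 → 4 * k + suc ℓ ≡ P + m → m ≡ 3 * k + ℓ
    at-k+1 {m = m} {k} ℓ refl eq = ℕₚ.+-cancelˡ-≡ (k + 1) m (3 * k + ℓ) (trans (sym eq) (identity k ℓ))
      where
      identity : ∀ k ℓ → 4 * k + suc ℓ ≡ k + 1 + (3 * k + ℓ)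
      identity = solve-∀

    module _ (H : Multigraph) (ideal : IdeallyEdgeConnected H) (iso : G ≅ subdivide H) {d : ℕ}
      (degreesIn : DegreesIn d H) where

      open SubdivisionCount G minimal H ideal iso

      attains-with : ∀ {k τ} P M D A → order H ≡ P → size H ≡ M → 1 ≤ A → A < P → P * D + A ≡ 2 * M →
        P * (P * 2) + τ + 2 * M ≡ P * (P * D) + A * A + 2 * P + 4 * k → n * (n * 2) + τ ≤
          2 * S + n * 2 + 4 * k
      attains-with {k} _ _ D A refl refl 1≤A A<P total value =
        attains-at degreesIn {k = k} D A 1≤A A<P total (subdivided-order H iso) value

  residue₀ : ∀ k → n ≡ 4 * k + 0 → 8 ≤ k → let B = bound n (+ n ℤ.* + n ℤ.- + 4 ℤ.* + n) in
    λ̄ ℚ.≤ B × (λ̄ ≡ B ⇔ (∃[ H ] IdeallyEdgeConnected H × Regular 6 H × order H ≡ k ×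
      IsObtainedBySubdividingEveryEdgeOf G H))
  residue₀ k n≡ 8≤k = subst (λ i → λ̄ ℚ.≤ bound n i × (λ̄ ≡ bound n i ⇔ Structure))
    (ℤₚ.+-identityʳ (+ n ℤ.* + n ℤ.- + 4 ℤ.* + n))
    (residue k 0 (4 * k * k) 4 0 (Good₀ k) Structure n≡ (outcome₀ k 8≤k 1≤p extremal)
      (loose-strict₀ (ℕₚ.≤-trans (ℕₚ.m≤m+n 2 6) 8≤k) 1≤p Q≤pX)
      (λ { (p≡ , refl , refl) → balanced p k p≡ })
        (at-least {k} 0 n≡ (ℕₚ.≤-trans (ℕₚ.m≤m+n 4 4) (k≤4k 8≤k)))
      (solve (k ∷ [])) construct count)
    where
    Structure : Set
    Structure = ∃[ H ] IdeallyEdgeConnected H × Regular 6 H × order H ≡ k ×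
      IsObtainedBySubdividingEveryEdgeOf G H

    balanced : ∀ p k → p ≡ k → 4 * p + 0 + 4 * p ≡ 2 * (4 * k + 0)
    balanced p _ refl = solve (p ∷ [])

    high≡0 : ∀ {P m a} → P ≡ k → m ≡ 3 * k + 0 → P * 6 + a ≡ 2 * m → a ≡ 0
    high≡0 {a = a} refl refl eq = ℕₚ.+-cancelˡ-≡ (k * 6) a 0 (trans eq (solve (k ∷ [])))

    construct : ∀ {q s} → Good₀ k p q s → Tight q → Structure
    construct (p≡ , refl , refl) tight = H , ideal , regular degreesIn (high≡0 (trans order≡ p≡)
        (at-k 0 (trans order≡ p≡) (trans (sym n≡) (subdivided-order H G≅subdivideH)))
          (degree-total degreesIn))
      , trans order≡ p≡ , G≅subdivideH
      where
      open Reconstruction G minimal tight (subst (2 ≤_) (sym p≡) (ℕₚ.≤-trans (ℕₚ.m≤m+n 2 6) 8≤k))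
      open SubdivisionCount G minimal H ideal G≅subdivideH

    count : Structure → n * (n * 2) + 4 * k * k ≤ 2 * S + n * 2 + 4 * k
    count (H , ideal , degree≡6 , p≡ , iso) = attains degreesIn {k = k} (subdivided-order H iso)
      (value p≡ m≡
        (high≡0 p≡ m≡ (degree-total degreesIn)))
      where
      open SubdivisionCount G minimal H ideal iso
      degreesIn : DegreesIn 6 H
      degreesIn v = ℕₚ.≤-reflexive (sym (degree≡6 v)) , ℕₚ.m≤n⇒m≤1+n (ℕₚ.≤-reflexive (degree≡6 v))

      m≡ : size H ≡ 3 * k + 0
      m≡ = at-k 0 p≡ (trans (sym n≡) (subdivided-order H iso))

      value : ∀ {P m a} → P ≡ k → m ≡ 3 * k + 0 → a ≡ 0 →
        P * (P * 2) + 4 * k * k + 2 * m ≡ P * (P * 6) + a * a + 2 * P + 4 * k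
      value refl refl refl = solve (k ∷ [])

  residue₁ : ∀ k → n ≡ 4 * k + 1 → 30 ≤ k → let B = bound n (+ n ℤ.* + n ℤ.- + 6 ℤ.* + n ℤ.+ + 13) in
    λ̄ ℚ.≤ B × (λ̄ ≡ B ⇔ (∃[ H ] IdeallyEdgeConnected H × NearlyRegular H ×
      (order H ≡ k × size H ≡ n ∸ k) ×
      IsObtainedBySubdividingEveryEdgeOf G H))
  residue₁ k n≡ 30≤k = residue k 1 (4 * k * k + 2) 6 13 (Good₁ k) _ n≡ (outcome₁ k 30≤k 1≤p extremal)
      (loose-strict₁ (ℕₚ.≤-trans (ℕₚ.m≤m+n 2 28) 30≤k) 1≤p Q≤pX)
      (λ { (p≡ , refl , refl) → balanced p k p≡ })
        (at-least {k} 1 n≡ (ℕₚ.≤-trans (ℕₚ.m≤m+n 6 24) (k≤4k 30≤k)))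
      (solve (k ∷ [])) construct
      λ (H , ideal , near , (p≡ , _) , iso) → attains-with H ideal iso (nearlyRegular⇒degreesIn H near)
        {k} {4 * k * k + 2} k (3 * k + 1) 6 2 p≡
          (at-k 1 p≡ (trans (sym n≡) (subdivided-order H iso))) (s≤s z≤n)
          (ℕₚ.≤-trans (ℕₚ.m≤m+n 3 27) 30≤k) (solve (k ∷ [])) (solve (k ∷ []))
    where
    balanced : ∀ p k → p ≡ k → 4 * p + 2 + 4 * p ≡ 2 * (4 * k + 1)
    balanced p _ refl = solve (p ∷ [])

    construct : ∀ {q s} → Good₁ k p q s → Tight q → ∃[ H ] IdeallyEdgeConnected H × NearlyRegular H ×
      (order H ≡ k × size H ≡ n ∸ k) × IsObtainedBySubdividingEveryEdgeOf G H
    construct (p≡ , _ , _) tight = H , ideal , nearlyRegular ,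
      (trans order≡ p≡ , sizes H G≅subdivideH (trans order≡ p≡)) , G≅subdivideH
      where
      open Reconstruction G minimal tight (subst (2 ≤_) (sym p≡) (ℕₚ.≤-trans (ℕₚ.m≤m+n 2 28) 30≤k))

  residue₂ : ∀ k → n ≡ 4 * k + 2 → 68 ≤ k → let B = bound n (+ n ℤ.* + n ℤ.- + 8 ℤ.* + n ℤ.+ + 60) in
    λ̄ ℚ.≤ B × (λ̄ ≡ B ⇔ (∃[ H ] IdeallyEdgeConnected H × NearlyRegular H ×
      ((order H ≡ k × size H ≡ n ∸ k) ⊎ (order H ≡ k + 1 × size H ≡ n ∸ k ∸ 1)) ×
        IsObtainedBySubdividingEveryEdgeOf G H))
  residue₂ k n≡ 68≤k = residue k 2 (4 * k * k + 12) 8 60 (Good₂ k) Structure n≡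
    (outcome₂ k 68≤k 1≤p extremal)
      (loose-strict₂ (ℕₚ.≤-trans (ℕₚ.m≤m+n 2 66) 68≤k) 1≤p Q≤pX) balanced
      (at-least {k} 2 n≡ (ℕₚ.≤-trans (ℕₚ.m≤m+n 8 60) (k≤4k 68≤k))) (solve (k ∷ [])) construct count
    where
    Structure : Set
    Structure = ∃[ H ] IdeallyEdgeConnected H × NearlyRegular H ×
      ((order H ≡ k × size H ≡ n ∸ k) ⊎ (order H ≡ k + 1 × size H ≡ n ∸ k ∸ 1)) ×
        IsObtainedBySubdividingEveryEdgeOf G H

    balanced : ∀ {q s} → Good₂ k p q s → q * p + s + 4 * p ≡ 2 * (4 * k + 2)
    balanced (inj₁ (p≡ , refl , refl)) = at-p p k p≡
      where
      at-p : ∀ p k → p ≡ k → 4 * p + 4 + 4 * p ≡ 2 * (4 * k + 2)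
      at-p p _ refl = solve (p ∷ [])
    balanced {s = s} (inj₂ (p≡ , refl , refl)) = at-p p s p≡
      where
      at-p : ∀ p s → p ≡ s + 3 + 1 → 3 * p + s + 4 * p ≡ 2 * (4 * (s + 3) + 2)
      at-p _ s refl = solve (s ∷ [])

    construct : ∀ {q s} → Good₂ k p q s → Tight q → Structure
    construct (inj₁ (p≡ , _ , _)) tight = H , ideal , nearlyRegular ,
      inj₁ (trans order≡ p≡ , sizes H G≅subdivideH (trans order≡ p≡)) , G≅subdivideH
      where
      open Reconstruction G minimal tight (subst (2 ≤_) (sym p≡) (ℕₚ.≤-trans (ℕₚ.m≤m+n 2 66) 68≤k))
    construct (inj₂ (p≡ , _ , _)) tight = H , ideal , nearlyRegular ,
      inj₂ (trans order≡ p≡ , size≡n∸k∸1 H G≅subdivideH {k} (trans order≡ p≡)) , G≅subdivideH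
      where
      open Reconstruction G minimal tight (subst (2 ≤_) (sym p≡)
        (ℕₚ.≤-trans (ℕₚ.m≤m+n 2 66) (ℕₚ.≤-trans 68≤k (ℕₚ.m≤m+n k 1))))

    count : Structure → n * (n * 2) + (4 * k * k + 12) ≤ 2 * S + n * 2 + 4 * k
    count (H , ideal , near , inj₁ (p≡ , _) , iso) = attains-with H ideal iso
      (nearlyRegular⇒degreesIn H near)
      {k} {4 * k * k + 12} k (3 * k + 2) 6 4 p≡
        (at-k 2 p≡ (trans (sym n≡) (subdivided-order H iso))) (s≤s z≤n)
        (ℕₚ.≤-trans (ℕₚ.m≤m+n 5 63) 68≤k) (solve (k ∷ [])) (solve (k ∷ []))
    count (H , ideal , near , inj₂ (p≡ , _) , iso) with ℕₚ.m≤n⇒∃[o]m+o≡n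
      (ℕₚ.≤-trans (ℕₚ.m≤m+n 4 64) 68≤k)
    ... | a , refl = attains-with H ideal iso (nearlyRegular⇒degreesIn H near)
      {4 + a} {4 * (4 + a) * (4 + a) + 12} (4 + a + 1) (3 * (4 + a) + 1) 5 (1 + a) p≡
      (at-k+1 {k = 4 + a} 1 p≡ (trans (sym n≡) (subdivided-order H iso))) (s≤s z≤n)
      (ℕₚ.≤-trans (ℕₚ.m≤n+m (2 + a) 2) (ℕₚ.m≤m+n (4 + a) 1)) (solve (a ∷ [])) (solve (a ∷ []))

  residue₃ : ∀ k → n ≡ 4 * k + 3 → 30 ≤ k → let B = bound n (+ n ℤ.* + n ℤ.- + 6 ℤ.* + n ℤ.+ + 17) in
    λ̄ ℚ.≤ B × (λ̄ ≡ B ⇔ (∃[ H ] IdeallyEdgeConnected H × NearlyRegular H ×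
      (order H ≡ k + 1 × size H ≡ n ∸ k ∸ 1) ×
      IsObtainedBySubdividingEveryEdgeOf G H))
  residue₃ k n≡ 30≤k = residue k 3 (4 * k * k + 4 * k + 2) 6 17 (Good₃ k) Structure n≡
    (outcome₃ k 30≤k 1≤p extremal)
      (loose-strict₃ (ℕₚ.≤-trans (ℕₚ.m≤m+n 2 28) 30≤k) 1≤p Q≤pX)
      (λ { {s = s} (p≡ , refl , refl) → balanced p s p≡ })
        (at-least {k} 3 n≡ (ℕₚ.≤-trans (ℕₚ.m≤m+n 6 24) (k≤4k 30≤k)))
      (solve (k ∷ [])) construct count
    where
    Structure : Set
    Structure = ∃[ H ] IdeallyEdgeConnected H × NearlyRegular H ×
      (order H ≡ k + 1 × size H ≡ n ∸ k ∸ 1) ×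
      IsObtainedBySubdividingEveryEdgeOf G H

    balanced : ∀ p s → p ≡ s + 1 + 1 → 3 * p + s + 4 * p ≡ 2 * (4 * (s + 1) + 3)
    balanced _ s refl = solve (s ∷ [])

    construct : ∀ {q s} → Good₃ k p q s → Tight q → Structure
    construct (p≡ , _ , _) tight = H , ideal , nearlyRegular ,
      (trans order≡ p≡ , size≡n∸k∸1 H G≅subdivideH {k} (trans order≡ p≡)) , G≅subdivideH
      where
      open Reconstruction G minimal tight (subst (2 ≤_) (sym p≡)
        (ℕₚ.≤-trans (ℕₚ.m≤m+n 2 28) (ℕₚ.≤-trans 30≤k (ℕₚ.m≤m+n k 1))))

    count : Structure → n * (n * 2) + (4 * k * k + 4 * k + 2) ≤ 2 * S + n * 2 + 4 * k
    count (H , ideal , near , (p≡ , _) , iso) with ℕₚ.m≤n⇒∃[o]m+o≡n (ℕₚ.≤-trans (ℕₚ.m≤m+n 2 28) 30≤k)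
    ... | a , refl = attains-with H ideal iso (nearlyRegular⇒degreesIn H near)
      {2 + a} {4 * (2 + a) * (2 + a) + 4 * (2 + a) + 2} (2 + a + 1) (3 * (2 + a) + 2) 5 (1 + a) p≡
      (at-k+1 {k = 2 + a} 2 p≡ (trans (sym n≡) (subdivided-order H iso))) (s≤s z≤n)
      (ℕₚ.m≤m+n (2 + a) 1) (solve (a ∷ [])) (solve (a ∷ []))

theorem3p16 : (G : Multigraph) .{{_ : NonTrivial (order G)}} → MinimallyTwoEdgeConnected G →
    let
    n  = order G
    λ̄G = averageEdgeConnectivity G
    N  = + n
    in
    (λ̄G ℚ.≤ bound n ((N ℤ.- + 2) ℤ.* (N ℤ.- + 2)) ×
    bound n ((N ℤ.- + 2) ℤ.* (N ℤ.- + 2)) ℚ.< + 9 ℚ./ 4) ×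
    (∀ (k ℓ : ℕ) → n ≡ 4 * k + ℓ → ℓ < 4 →
    (8 ≤ k → ℓ ≡ 0 →
    let B = bound n (N ℤ.* N ℤ.- + 4 ℤ.* N) in
    λ̄G ℚ.≤ B ×
    (λ̄G ≡ B ⇔
    (∃[ H ] IdeallyEdgeConnected H × Regular 6 H × order H ≡ k ×
    IsObtainedBySubdividingEveryEdgeOf G H))) ×
    (30 ≤ k → ℓ ≡ 1 →
    let B = bound n (N ℤ.* N ℤ.- + 6 ℤ.* N ℤ.+ + 13) in
    λ̄G ℚ.≤ B ×
    (λ̄G ≡ B ⇔
    (∃[ H ] IdeallyEdgeConnected H × NearlyRegular H ×
    (order H ≡ k × size H ≡ n ∸ k) ×
    IsObtainedBySubdividingEveryEdgeOf G H))) ×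
    (68 ≤ k → ℓ ≡ 2 →
    let B = bound n (N ℤ.* N ℤ.- + 8 ℤ.* N ℤ.+ + 60) in
    λ̄G ℚ.≤ B ×
    (λ̄G ≡ B ⇔
    (∃[ H ] IdeallyEdgeConnected H × NearlyRegular H ×
    ((order H ≡ k × size H ≡ n ∸ k) ⊎
    (order H ≡ k + 1 × size H ≡ n ∸ k ∸ 1)) ×
    IsObtainedBySubdividingEveryEdgeOf G H))) ×
    (30 ≤ k → ℓ ≡ 3 →
    let B = bound n (N ℤ.* N ℤ.- + 6 ℤ.* N ℤ.+ + 17) in
    λ̄G ℚ.≤ B ×
    (λ̄G ≡ B ⇔
    (∃[ H ] IdeallyEdgeConnected H × NearlyRegular H ×
    (order H ≡ k + 1 × size H ≡ n ∸ k ∸ 1) ×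
    IsObtainedBySubdividingEveryEdgeOf G H))))
theorem3p16 G minimal = general-bound , λ k ℓ n≡ _ →
  let n≡4k+ = λ {r} (ℓ≡r : ℓ ≡ r) → trans n≡ (cong (λ r → 4 * k + r) ℓ≡r) in
  (λ 8≤k ℓ≡0 → residue₀ k (n≡4k+ ℓ≡0) 8≤k) ,
  (λ 30≤k ℓ≡1 → residue₁ k (n≡4k+ ℓ≡1) 30≤k) ,
  (λ 68≤k ℓ≡2 → residue₂ k (n≡4k+ ℓ≡2) 68≤k) ,
  (λ 30≤k ℓ≡3 → residue₃ k (n≡4k+ ℓ≡3) 30≤k)
  where open Main G minimal
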